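{- For every prime power $q$ and every $\epsilon>0$ there exists an effective constant $C$ (depending only on $q$ and $\epsilon$) such that the following holds. Let $k$ be a finite field with $q$ elements, let $m,n$ be any integers with $0\le 2m\le n+1$, and let $\mu_0,\ldots,\mu_n$ be any probability distributions on $k$. Then $$\left|\Pi_m(\mu_0,\ldots,\mu_n)-q^{2m-(n+1)}\right|<C(1+\epsilon)^n q^{m-n}\prod_{i=0}^n\|\widehat{\mu}_i\|_1 .$$
   Context: For integers $m,n$ with $0\le 2m\le n+1$, $H_m\subseteq k^{n+1}$ is the set of sequences $(x_0,\ldots,x_n)$ for which there exist $a_0,\ldots,a_m\in k$, not all zero, such that $\sum_{i=0}^m a_ix_{i+j}=0$ for each $j=0,1,\ldots,n-m$. Equivalently, the $(m+1)\times(n-m+1)$ Hankel matrix with $(i,j)$ entry $x_{i+j}$ ($0\le i\le m$, $0\le j\le n-m$) has rank at most $m$. A distribution on $k$ is a function $\mu:k\to\mathbf{R}$ with $\mu(x)\ge 0$ for all $x\in k$ and $\sum_{x\in k}\mu(x)=1$. $\Pi_m(\mu_0,\ldots,\mu_n)=\sum_{(x_0,\ldots,x_n)\in H_m}\prod_{i=0}^n\mu_i(x_i)$ is the probability that $(x_0,\ldots,x_n)\in H_m$ when the $x_i$ are chosen independently, $x_i$ from the distribution $\mu_i$. Fix a nontrivial homomorphism $\psi_0$ from the additive group of $k$ to the unit circle in $\mathbf{C}$. For $f:k\to\mathbf{C}$, the Fourier transform is $\widehat f(a)=\sum_{x\in k}f(x)\psi_0(ax)$ for $a\in k$, and $\|\widehat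 f\|_1=\sum_{a\in k}|\widehat f(a)|$. -}

module Defs where

open import Algebra.Bundles using (CommutativeRing)
open import Algebra.Bundles.Raw using (RawRing)
import Algebra.Definitions.RawMonoid as RawMonoidDefs
import Algebra.Properties.Monoid.Sum as MonoidSum
open import Algebra.Morphism.Structures using (IsMonoidHomomorphism)
open import Data.Bool.Base using (if_then_else_)
open import Data.Fin.Base using (Fin; toℕ; fromℕ<; finToFun; funToFin)
import Data.Fin.Properties as Fin
open import Data.Integer.Base as ℤ using (ℤ; +_; -[1+_])
import Data.Integer.Properties as ℤ
import Data.Integer.Solver as ℤSolver
open import Data.Nat.Base as ℕ using (ℕ; zero; suc)
import Data.Nat.Properties as ℕ
open import Data.Nat.Primality using (Prime; prime⇒nonZero)
open import Data.Product.Base using (∃-syntax; _×_; _,_; proj₁; proj₂)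
open import Data.Rational.Base as ℚ using (ℚ; 0ℚ; 1ℚ; ½; ↥_)
import Data.Rational.Properties as ℚ
open import Data.Rational.Unnormalised.Base as ℚᵘ using (mkℚᵘ)
import Data.Rational.Unnormalised.Properties as ℚᵘ
open import Data.Rational.Solver using (module +-*-Solver)
open import Data.Sum.Base using (inj₁; inj₂)
open import Function.Base using (_∘_)
open import Function.Bundles using (Inverse)
open import Level using (Level; 0ℓ; _⊔_) renaming (suc to lsuc)
open import Relation.Binary.PropositionalEquality.Core
  using (_≡_; refl; sym; trans; cong; cong₂; subst)
import Relation.Binary.PropositionalEquality.Properties as ≡
import Relation.Binary.Reasoning.Setoid as SetoidReasoning
open import Relation.Nullary using (¬_; Dec; yes; no; does)
open import Relation.Nullary.Decidable using (map′; ¬?; _×-dec_)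
open import Relation.Unary using (Pred; Decidable)

open +-*-Solver using (solve; _:+_; _:*_; :-_; _:-_; _:=_)
open ℤSolver.+-*-Solver using () renaming
  ( solve to ℤsolve; con to ℤcon; _:+_ to infixl 6 _ℤ:+_
  ; _:*_ to infixl 7 _ℤ:*_; _:=_ to infix 4 _ℤ:=_ )

p≤∣p∣ : ∀ p → p ℚ.≤ ℚ.∣ p ∣
p≤∣p∣ p with ℚ.≤-total 0ℚ p
... | inj₁ 0≤p = ℚ.≤-reflexive (sym (ℚ.0≤p⇒∣p∣≡p 0≤p))
... | inj₂ p≤0 = ℚ.≤-trans p≤0 (ℚ.0≤∣p∣ p)

∣p-q∣≡∣q-p∣ : ∀ p q → ℚ.∣ p ℚ.- q ∣ ≡ ℚ.∣ q ℚ.- p ∣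
∣p-q∣≡∣q-p∣ p q = trans (sym (ℚ.∣-p∣≡∣p∣ (p ℚ.- q)))
  (cong ℚ.∣_∣ (solve 2 (λ a b → :- (a :- b) := b :- a) refl p q))

∣p-q∣≤e⇒p≤q+e : ∀ {p q e} → ℚ.∣ p ℚ.- q ∣ ℚ.≤ e → p ℚ.≤ q ℚ.+ e
∣p-q∣≤e⇒p≤q+e {p} {q} {e} h = begin
  p                     ≡⟨ solve 2 (λ a b → a := b :+ (a :- b)) refl p q ⟩
  q ℚ.+ (p ℚ.- q)       ≤⟨ ℚ.+-monoʳ-≤ q (ℚ.≤-trans (p≤∣p∣ _) h) ⟩
  q ℚ.+ e               ∎
  where open ℚ.≤-Reasoning

∣p-q∣≤e⇒q≤p+e : ∀ {p q e} → ℚ.∣ p ℚ.- q ∣ ℚ.≤ e → q ℚ.≤ p ℚ.+ e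
∣p-q∣≤e⇒q≤p+e {p} {q} {e} h =
  ∣p-q∣≤e⇒p≤q+e {q} {p} {e} (ℚ.≤-trans (ℚ.≤-reflexive (∣p-q∣≡∣q-p∣ q p)) h)

p≤q+e⇒p-q≤e : ∀ {p q e} → p ℚ.≤ q ℚ.+ e → p ℚ.- q ℚ.≤ e
p≤q+e⇒p-q≤e {p} {q} {e} h = begin
  p ℚ.- q             ≤⟨ ℚ.+-monoˡ-≤ (ℚ.- q) h ⟩
  q ℚ.+ e ℚ.- q       ≡⟨ solve 2 (λ b c → b :+ c :- b := c) refl q e ⟩
  e                   ∎
  where open ℚ.≤-Reasoning

∣p-q∣≤e : ∀ {p q e} → p ℚ.≤ q ℚ.+ e → q ℚ.≤ p ℚ.+ e → ℚ.∣ p ℚ.- q ∣ ℚ.≤ e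
∣p-q∣≤e {p} {q} {e} h₁ h₂ with ℚ.∣p∣≡p∨∣p∣≡-p (p ℚ.- q)
... | inj₁ eq = subst (ℚ._≤ e) (sym eq) (p≤q+e⇒p-q≤e {p} {q} {e} h₁)
... | inj₂ eq = subst (ℚ._≤ e)
  (sym (trans eq (solve 2 (λ a b → :- (a :- b) := b :- a) refl p q)))
  (p≤q+e⇒p-q≤e {q} {p} {e} h₂)

½e+½e≡e : ∀ e → ½ ℚ.* e ℚ.+ ½ ℚ.* e ≡ e
½e+½e≡e e = trans (sym (ℚ.*-distribʳ-+ e ½ ½)) (ℚ.*-identityˡ e)

*-pos : ∀ {p q} → 0ℚ ℚ.< p → 0ℚ ℚ.< q → 0ℚ ℚ.< p ℚ.* q
*-pos {p} {q} hp hq = ℚ.positive⁻¹ (p ℚ.* q)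
  {{ℚ.pos*pos⇒pos p {{ℚ.positive hp}} q {{ℚ.positive hq}}}}

+-pos : ∀ {p q} → 0ℚ ℚ.< p → 0ℚ ℚ.< q → 0ℚ ℚ.< p ℚ.+ q
+-pos hp hq = ℚ.+-mono-< hp hq

½e-pos : ∀ {e} → 0ℚ ℚ.< e → 0ℚ ℚ.< ½ ℚ.* e
½e-pos = *-pos (ℚ.positive⁻¹ ½)

*-mono-≤ : ∀ {p q r s} → 0ℚ ℚ.≤ r → 0ℚ ℚ.≤ q →
           p ℚ.≤ q → r ℚ.≤ s → p ℚ.* r ℚ.≤ q ℚ.* s
*-mono-≤ {p} {q} {r} {s} 0≤r 0≤q p≤q r≤s = ℚ.≤-trans
  (ℚ.*-monoʳ-≤-nonNeg r {{ℚ.nonNegative 0≤r}} p≤q)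
  (ℚ.*-monoˡ-≤-nonNeg q {{ℚ.nonNegative 0≤q}} r≤s)

1/-positive : ∀ {p} → 0ℚ ℚ.< p → ∃[ i ] 0ℚ ℚ.< i × i ℚ.* p ≡ 1ℚ
1/-positive {p} 0<p = ℚ.1/ p , ℚ.positive⁻¹ (ℚ.1/ p) {{ℚ.1/pos⇒pos p}} , ℚ.*-inverseˡ p
  where instance
    p-positive = ℚ.positive 0<p
    p-nonZero  = ℚ.pos⇒nonZero p

p≤p+e : ∀ p {e} → 0ℚ ℚ.≤ e → p ℚ.≤ p ℚ.+ e
p≤p+e p {e} 0≤e = subst (ℚ._≤ p ℚ.+ e) (ℚ.+-identityʳ p) (ℚ.+-monoʳ-≤ p 0≤e)

∣∣p∣-∣q∣∣≤∣p-q∣ : ∀ p q → ℚ.∣ ℚ.∣ p ∣ ℚ.- ℚ.∣ q ∣ ∣ ℚ.≤ ℚ.∣ p ℚ.- q ∣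
∣∣p∣-∣q∣∣≤∣p-q∣ p q = ∣p-q∣≤e {ℚ.∣ p ∣} {ℚ.∣ q ∣} {ℚ.∣ p ℚ.- q ∣} (half p q)
  (subst (λ e → ℚ.∣ q ∣ ℚ.≤ ℚ.∣ p ∣ ℚ.+ e) (∣p-q∣≡∣q-p∣ q p) (half q p))
  where
  split : ∀ p q → q ℚ.+ (p ℚ.- q) ≡ p
  split = solve 2 (λ a b → b :+ (a :- b) := a) refl

  half : ∀ p q → ℚ.∣ p ∣ ℚ.≤ ℚ.∣ q ∣ ℚ.+ ℚ.∣ p ℚ.- q ∣
  half p q = subst (λ r → ℚ.∣ r ∣ ℚ.≤ ℚ.∣ q ∣ ℚ.+ ℚ.∣ p ℚ.- q ∣)
    (split p q) (ℚ.∣p+q∣≤∣p∣+∣q∣ q (p ℚ.- q))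

⊔-nonexpansive : ∀ p q r → ℚ.∣ (p ℚ.⊔ r) ℚ.- (q ℚ.⊔ r) ∣ ℚ.≤ ℚ.∣ p ℚ.- q ∣
⊔-nonexpansive p q r = ∣p-q∣≤e {p ℚ.⊔ r} {q ℚ.⊔ r} {e}
  (ℚ.⊔-lub
    (ℚ.≤-trans (∣p-q∣≤e⇒p≤q+e {p} {q} {e} ℚ.≤-refl) (ℚ.+-monoˡ-≤ e (ℚ.p≤p⊔q q r)))
    (ℚ.≤-trans (ℚ.p≤q⊔p q r) (p≤p+e (q ℚ.⊔ r) (ℚ.0≤∣p∣ (p ℚ.- q)))))
  (ℚ.⊔-lub
    (ℚ.≤-trans (∣p-q∣≤e⇒q≤p+e {p} {q} {e} ℚ.≤-refl) (ℚ.+-monoˡ-≤ e (ℚ.p≤p⊔q p r)))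
    (ℚ.≤-trans (ℚ.p≤q⊔p p r) (p≤p+e (p ℚ.⊔ r) (ℚ.0≤∣p∣ (p ℚ.- q)))))
  where e = ℚ.∣ p ℚ.- q ∣

-- An inhabitant of Cauchy x contains a modulus of convergence.
Cauchy : (ℕ → ℚ) → Set
Cauchy x = ∀ ε → 0ℚ ℚ.< ε →
  ∃[ N ] (∀ m n → N ℕ.≤ m → N ℕ.≤ n → ℚ.∣ x m ℚ.- x n ∣ ℚ.≤ ε)

record ℝ : Set where
  constructor mkℝ
  field
    seq    : ℕ → ℚ
    cauchy : Cauchy seq

open ℝ public

infix 4 _≃ℝ_ _≤ℝ_ _<ℝ_

record _≃ℝ_ (x y : ℝ) : Set where
  constructor mk≃
  field
    close : ∀ ε → 0ℚ ℚ.< ε →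
      ∃[ N ] (∀ n → N ℕ.≤ n → ℚ.∣ seq x n ℚ.- seq y n ∣ ℚ.≤ ε)

record _≤ℝ_ (x y : ℝ) : Set where
  constructor mk≤
  field
    below : ∀ ε → 0ℚ ℚ.< ε →
      ∃[ N ] (∀ n → N ℕ.≤ n → seq x n ℚ.≤ seq y n ℚ.+ ε)

record _<ℝ_ (x y : ℝ) : Set where
  constructor mk<
  field
    gap       : ℚ
    0<gap     : 0ℚ ℚ.< gap
    start     : ℕ
    separated : ∀ n → start ℕ.≤ n → seq x n ℚ.+ gap ℚ.≤ seq y n

fromℚ : ℚ → ℝ
fromℚ p = mkℝ (λ _ → p) λ ε 0<ε → 0 , λ _ _ _ _ →
  ℚ.≤-trans (ℚ.≤-reflexive (cong ℚ.∣_∣ (ℚ.+-inverseʳ p))) (ℚ.<⇒≤ 0<ε)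

0ℝ 1ℝ : ℝ
0ℝ = fromℚ 0ℚ
1ℝ = fromℚ 1ℚ

cauchy-nonexpansive : ∀ {x} (f : ℚ → ℚ) →
  (∀ p q → ℚ.∣ f p ℚ.- f q ∣ ℚ.≤ ℚ.∣ p ℚ.- q ∣) → Cauchy x → Cauchy (f ∘ x)
cauchy-nonexpansive f h cx ε 0<ε with cx ε 0<ε
... | N , c = N , λ m n Nm Nn → ℚ.≤-trans (h _ _) (c m n Nm Nn)

cauchy-+ : ∀ {x y} → Cauchy x → Cauchy y → Cauchy (λ n → x n ℚ.+ y n)
cauchy-+ {x} {y} cx cy ε 0<ε
  with cx (½ ℚ.* ε) (½e-pos 0<ε) | cy (½ ℚ.* ε) (½e-pos 0<ε)
... | M , c | N , d = M ℕ.⊔ N , λ m n hm hn → begin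
  ℚ.∣ (x m ℚ.+ y m) ℚ.- (x n ℚ.+ y n) ∣
    ≡⟨ cong ℚ.∣_∣ (solve 4 (λ a b c d → (a :+ b) :- (c :+ d) := (a :- c) :+ (b :- d))
                    refl (x m) (y m) (x n) (y n)) ⟩
  ℚ.∣ (x m ℚ.- x n) ℚ.+ (y m ℚ.- y n) ∣
    ≤⟨ ℚ.∣p+q∣≤∣p∣+∣q∣ (x m ℚ.- x n) (y m ℚ.- y n) ⟩
  ℚ.∣ x m ℚ.- x n ∣ ℚ.+ ℚ.∣ y m ℚ.- y n ∣
    ≤⟨ ℚ.+-mono-≤
         (c m n (ℕ.m⊔n≤o⇒m≤o M N hm) (ℕ.m⊔n≤o⇒m≤o M N hn))
         (d m n (ℕ.m⊔n≤o⇒n≤o M N hm) (ℕ.m⊔n≤o⇒n≤o M N hn)) ⟩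
  ½ ℚ.* ε ℚ.+ ½ ℚ.* ε
    ≡⟨ ½e+½e≡e ε ⟩
  ε ∎
  where open ℚ.≤-Reasoning

neg-nonexpansive : ∀ p q → ℚ.∣ (ℚ.- p) ℚ.- (ℚ.- q) ∣ ℚ.≤ ℚ.∣ p ℚ.- q ∣
neg-nonexpansive p q = ℚ.≤-reflexive (trans
  (cong ℚ.∣_∣ (solve 2 (λ a b → (:- a) :- (:- b) := b :- a) refl p q))
  (∣p-q∣≡∣q-p∣ q p))

cauchy-bounded : ∀ {x} → Cauchy x →
  ∃[ B ] 0ℚ ℚ.< B × ∃[ N ] (∀ n → N ℕ.≤ n → ℚ.∣ x n ∣ ℚ.≤ B)
cauchy-bounded {x} cx with cx 1ℚ (ℚ.positive⁻¹ 1ℚ)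
... | N , c = ℚ.∣ x N ∣ ℚ.+ 1ℚ
  , ℚ.+-mono-≤-< (ℚ.0≤∣p∣ (x N)) (ℚ.positive⁻¹ 1ℚ)
  , N , λ n hn → ∣p-q∣≤e⇒p≤q+e {ℚ.∣ x n ∣} {ℚ.∣ x N ∣} {1ℚ}
      (ℚ.≤-trans (∣∣p∣-∣q∣∣≤∣p-q∣ (x n) (x N)) (c n N hn ℕ.≤-refl))

*-difference : ∀ a b c d → a ℚ.* b ℚ.- c ℚ.* d ≡ a ℚ.* (b ℚ.- d) ℚ.+ d ℚ.* (a ℚ.- c)
*-difference = solve 4
  (λ a b c d → a :* b :- c :* d := a :* (b :- d) :+ d :* (a :- c)) refl

*-estimate : ∀ {a b c d A B η} → 0ℚ ℚ.≤ A → 0ℚ ℚ.≤ B →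
  ℚ.∣ a ∣ ℚ.≤ A → ℚ.∣ d ∣ ℚ.≤ B → ℚ.∣ b ℚ.- d ∣ ℚ.≤ η → ℚ.∣ a ℚ.- c ∣ ℚ.≤ η →
  ℚ.∣ a ℚ.* b ℚ.- c ℚ.* d ∣ ℚ.≤ η ℚ.* (A ℚ.+ B)
*-estimate {a} {b} {c} {d} {A} {B} {η} 0≤A 0≤B a≤A d≤B bd ac = begin
  ℚ.∣ a ℚ.* b ℚ.- c ℚ.* d ∣
    ≡⟨ cong ℚ.∣_∣ (*-difference a b c d) ⟩
  ℚ.∣ a ℚ.* (b ℚ.- d) ℚ.+ d ℚ.* (a ℚ.- c) ∣
    ≤⟨ ℚ.∣p+q∣≤∣p∣+∣q∣ (a ℚ.* (b ℚ.- d)) (d ℚ.* (a ℚ.- c)) ⟩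
  ℚ.∣ a ℚ.* (b ℚ.- d) ∣ ℚ.+ ℚ.∣ d ℚ.* (a ℚ.- c) ∣
    ≡⟨ cong₂ ℚ._+_ (ℚ.∣p*q∣≡∣p∣*∣q∣ a (b ℚ.- d)) (ℚ.∣p*q∣≡∣p∣*∣q∣ d (a ℚ.- c)) ⟩
  ℚ.∣ a ∣ ℚ.* ℚ.∣ b ℚ.- d ∣ ℚ.+ ℚ.∣ d ∣ ℚ.* ℚ.∣ a ℚ.- c ∣
    ≤⟨ ℚ.+-mono-≤
         (*-mono-≤ {ℚ.∣ a ∣} {A} {ℚ.∣ b ℚ.- d ∣} {η} (ℚ.0≤∣p∣ (b ℚ.- d)) 0≤A a≤A bd)
         (*-mono-≤ {ℚ.∣ d ∣} {B} {ℚ.∣ a ℚ.- c ∣} {η} (ℚ.0≤∣p∣ (a ℚ.- c)) 0≤B d≤B ac) ⟩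
  A ℚ.* η ℚ.+ B ℚ.* η
    ≡⟨ ℚ.*-distribʳ-+ η A B ⟨
  (A ℚ.+ B) ℚ.* η
    ≡⟨ ℚ.*-comm (A ℚ.+ B) η ⟩
  η ℚ.* (A ℚ.+ B) ∎
  where open ℚ.≤-Reasoning

cauchy-* : ∀ {x y} → Cauchy x → Cauchy y → Cauchy (λ n → x n ℚ.* y n)
cauchy-* {x} {y} cx cy ε 0<ε =
  let (A , 0<A , M₀ , a) = cauchy-bounded {x} cx
      (B , 0<B , N₀ , b) = cauchy-bounded {y} cy
      (i , 0<i , i*[A+B]≡1) = 1/-positive (+-pos 0<A 0<B)
      (M , c) = cx (ε ℚ.* i) (*-pos 0<ε 0<i)
      (N , d) = cy (ε ℚ.* i) (*-pos 0<ε 0<i)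
      l : ∀ {m} → (M₀ ℕ.⊔ N₀) ℕ.⊔ (M ℕ.⊔ N) ℕ.≤ m → M₀ ℕ.⊔ N₀ ℕ.≤ m
      l = ℕ.m⊔n≤o⇒m≤o (M₀ ℕ.⊔ N₀) (M ℕ.⊔ N)
      r : ∀ {m} → (M₀ ℕ.⊔ N₀) ℕ.⊔ (M ℕ.⊔ N) ℕ.≤ m → M ℕ.⊔ N ℕ.≤ m
      r = ℕ.m⊔n≤o⇒n≤o (M₀ ℕ.⊔ N₀) (M ℕ.⊔ N)
      η*[A+B]≡ε = trans (ℚ.*-assoc ε i (A ℚ.+ B))
        (trans (cong (ε ℚ.*_) i*[A+B]≡1) (ℚ.*-identityʳ ε))
  in (M₀ ℕ.⊔ N₀) ℕ.⊔ (M ℕ.⊔ N) , λ m n hm hn →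
    subst (ℚ.∣ x m ℚ.* y m ℚ.- x n ℚ.* y n ∣ ℚ.≤_) η*[A+B]≡ε
      (*-estimate {x m} {y m} {x n} {y n} {A} {B} {ε ℚ.* i} (ℚ.<⇒≤ 0<A) (ℚ.<⇒≤ 0<B)
        (a m (ℕ.m⊔n≤o⇒m≤o M₀ N₀ (l hm))) (b n (ℕ.m⊔n≤o⇒n≤o M₀ N₀ (l hn)))
        (d m n (ℕ.m⊔n≤o⇒n≤o M N (r hm)) (ℕ.m⊔n≤o⇒n≤o M N (r hn)))
        (c m n (ℕ.m⊔n≤o⇒m≤o M N (r hm)) (ℕ.m⊔n≤o⇒m≤o M N (r hn))))

opaque
  +-cauchy : ∀ x y → Cauchy (λ n → seq x n ℚ.+ seq y n)
  +-cauchy x y = cauchy-+ {seq x} {seq y} (cauchy x) (cauchy y)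

  *-cauchy : ∀ x y → Cauchy (λ n → seq x n ℚ.* seq y n)
  *-cauchy x y = cauchy-* {seq x} {seq y} (cauchy x) (cauchy y)

  neg-cauchy : ∀ x → Cauchy (λ n → ℚ.- seq x n)
  neg-cauchy x = cauchy-nonexpansive {seq x} ℚ.-_ neg-nonexpansive (cauchy x)

  abs-cauchy : ∀ x → Cauchy (λ n → ℚ.∣ seq x n ∣)
  abs-cauchy x = cauchy-nonexpansive {seq x} ℚ.∣_∣ ∣∣p∣-∣q∣∣≤∣p-q∣ (cauchy x)

infixl 6 _+ℝ_ _-ℝ_
infixl 7 _*ℝ_
infix  8 -ℝ_

_+ℝ_ : ℝ → ℝ → ℝ
x +ℝ y = mkℝ (λ n → seq x n ℚ.+ seq y n) (+-cauchy x y)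

_*ℝ_ : ℝ → ℝ → ℝ
x *ℝ y = mkℝ (λ n → seq x n ℚ.* seq y n) (*-cauchy x y)

-ℝ_ : ℝ → ℝ
-ℝ x = mkℝ (λ n → ℚ.- seq x n) (neg-cauchy x)

_-ℝ_ : ℝ → ℝ → ℝ
x -ℝ y = x +ℝ (-ℝ y)

∣_∣ℝ : ℝ → ℝ
∣ x ∣ℝ = mkℝ (λ n → ℚ.∣ seq x n ∣) (abs-cauchy x)

ℝ-rawRing : RawRing 0ℓ 0ℓ
ℝ-rawRing = record
  { Carrier = ℝ ; _≈_ = _≃ℝ_ ; _+_ = _+ℝ_ ; _*_ = _*ℝ_ ; -_ = -ℝ_ ; 0# = 0ℝ ; 1# = 1ℝ }

Σℝ ∏ℝ : ∀ {n} → (Fin n → ℝ) → ℝ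
Σℝ = RawMonoidDefs.sum (RawRing.+-rawMonoid ℝ-rawRing)
∏ℝ = RawMonoidDefs.sum (RawRing.*-rawMonoid ℝ-rawRing)

record ℝ⁺ : Set where
  constructor _,⁺_
  field
    value    : ℝ
    positive : 0ℝ <ℝ value

open ℝ⁺ public

_+⁺_ : ℝ⁺ → ℝ⁺ → ℝ⁺
(x ,⁺ mk< δ 0<δ M a) +⁺ (y ,⁺ mk< η 0<η N b) =
  (x +ℝ y) ,⁺ mk< (δ ℚ.+ η) (+-pos 0<δ 0<η) (M ℕ.⊔ N) (λ n hn → begin
    0ℚ ℚ.+ (δ ℚ.+ η)
      ≡⟨ cong (0ℚ ℚ.+_) (cong (δ ℚ.+_) (ℚ.+-identityˡ η)) ⟨
    0ℚ ℚ.+ (δ ℚ.+ (0ℚ ℚ.+ η))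
      ≡⟨ ℚ.+-assoc 0ℚ δ (0ℚ ℚ.+ η) ⟨
    (0ℚ ℚ.+ δ) ℚ.+ (0ℚ ℚ.+ η)
      ≤⟨ ℚ.+-mono-≤ (a n (ℕ.m⊔n≤o⇒m≤o M N hn)) (b n (ℕ.m⊔n≤o⇒n≤o M N hn)) ⟩
    seq x n ℚ.+ seq y n ∎)
  where open ℚ.≤-Reasoning

fromℕ⁺ : ∀ n → .{{ℕ.NonZero n}} → ℝ⁺
fromℕ⁺ (suc n) = fromℚ p ,⁺ mk< p (ℚ.positive⁻¹ p {{ℚ.normalize-pos (suc n) 1}}) 0
  (λ _ _ → ℚ.≤-reflexive (ℚ.+-identityˡ p))
  where p = + suc n ℚ./ 1

1⁺ : ℝ⁺
1⁺ = fromℕ⁺ 1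

module Reciprocal {δ : ℚ} (0<δ : 0ℚ ℚ.< δ) where

  0<_⊔δ : ∀ p → 0ℚ ℚ.< p ℚ.⊔ δ
  0< p ⊔δ = ℚ.<-≤-trans 0<δ (ℚ.p≤q⊔p p δ)

  recip : ℚ → ℚ
  recip p = proj₁ (1/-positive 0< p ⊔δ)

  recip-inv : ∀ p → recip p ℚ.* (p ℚ.⊔ δ) ≡ 1ℚ
  recip-inv p = proj₂ (proj₂ (1/-positive 0< p ⊔δ))

  recip-nonNeg : ∀ p → 0ℚ ℚ.≤ recip p
  recip-nonNeg p = ℚ.<⇒≤ (proj₁ (proj₂ (1/-positive 0< p ⊔δ)))

  d : ℚ
  d = proj₁ (1/-positive 0<δ)

  0<d : 0ℚ ℚ.< d
  0<d = proj₁ (proj₂ (1/-positive 0<δ))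

  d*δ≡1 : d ℚ.* δ ≡ 1ℚ
  d*δ≡1 = proj₂ (proj₂ (1/-positive 0<δ))

  open ℚ.≤-Reasoning

  recip≤d : ∀ p → recip p ℚ.≤ d
  recip≤d p = begin
    u                   ≡⟨ ℚ.*-identityʳ u ⟨
    u ℚ.* 1ℚ            ≡⟨ cong (u ℚ.*_) (trans (ℚ.*-comm δ d) d*δ≡1) ⟨
    u ℚ.* (δ ℚ.* d)     ≤⟨ ℚ.*-monoˡ-≤-nonNeg u {{ℚ.nonNegative (recip-nonNeg p)}}
                             (ℚ.*-monoʳ-≤-nonNeg d {{ℚ.nonNegative (ℚ.<⇒≤ 0<d)}} (ℚ.p≤q⊔p p δ)) ⟩
    u ℚ.* (a ℚ.* d)     ≡⟨ ℚ.*-assoc u a d ⟨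
    u ℚ.* a ℚ.* d       ≡⟨ cong (ℚ._* d) (recip-inv p) ⟩
    1ℚ ℚ.* d            ≡⟨ ℚ.*-identityˡ d ⟩
    d                   ∎
    where
    u = recip p
    a = p ℚ.⊔ δ

  difference : ∀ a b u v → u ℚ.* a ≡ 1ℚ → v ℚ.* b ≡ 1ℚ →
               u ℚ.- v ≡ (b ℚ.- a) ℚ.* (u ℚ.* v)
  difference a b u v ua vb = begin-equality
    u ℚ.- v                                   ≡⟨ cong₂ ℚ._-_ (ℚ.*-identityˡ u) (ℚ.*-identityˡ v) ⟨
    1ℚ ℚ.* u ℚ.- 1ℚ ℚ.* v                     ≡⟨ cong₂ (λ s t → s ℚ.* u ℚ.- t ℚ.* v) vb ua ⟨
    v ℚ.* b ℚ.* u ℚ.- u ℚ.* a ℚ.* v           ≡⟨ solve 4 (λ a b u v → v :* b :* u :- u :* a :* v := (b :- a) :* (u :* v)) refl a b u v ⟩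
    (b ℚ.- a) ℚ.* (u ℚ.* v)                   ∎

  recip-lipschitz : ∀ p q → ℚ.∣ recip p ℚ.- recip q ∣ ℚ.≤ ℚ.∣ p ℚ.- q ∣ ℚ.* (d ℚ.* d)
  recip-lipschitz p q = begin
    ℚ.∣ u ℚ.- v ∣
      ≡⟨ cong ℚ.∣_∣ (difference a b u v (recip-inv p) (recip-inv q)) ⟩
    ℚ.∣ (b ℚ.- a) ℚ.* (u ℚ.* v) ∣
      ≡⟨ ℚ.∣p*q∣≡∣p∣*∣q∣ (b ℚ.- a) (u ℚ.* v) ⟩
    ℚ.∣ b ℚ.- a ∣ ℚ.* ℚ.∣ u ℚ.* v ∣
      ≡⟨ cong₂ ℚ._*_ (∣p-q∣≡∣q-p∣ b a) (ℚ.0≤p⇒∣p∣≡p 0≤uv) ⟩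
    ℚ.∣ a ℚ.- b ∣ ℚ.* (u ℚ.* v)
      ≤⟨ *-mono-≤ {ℚ.∣ a ℚ.- b ∣} {ℚ.∣ p ℚ.- q ∣} {u ℚ.* v} {d ℚ.* d}
           0≤uv (ℚ.0≤∣p∣ (p ℚ.- q)) (⊔-nonexpansive p q δ)
           (*-mono-≤ {u} {d} {v} {d} (recip-nonNeg q) (ℚ.<⇒≤ 0<d) (recip≤d p) (recip≤d q)) ⟩
    ℚ.∣ p ℚ.- q ∣ ℚ.* (d ℚ.* d) ∎
    where
    a = p ℚ.⊔ δ
    b = q ℚ.⊔ δ
    u = recip p
    v = recip q
    0≤uv : 0ℚ ℚ.≤ u ℚ.* v
    0≤uv = ℚ.nonNegative⁻¹ (u ℚ.* v) {{ℚ.nonNeg*nonNeg⇒nonNeg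
      u {{ℚ.nonNegative (recip-nonNeg p)}} v {{ℚ.nonNegative (recip-nonNeg q)}}}}

  regroup : ∀ e a d → e ℚ.* (a ℚ.* a) ℚ.* (d ℚ.* d) ≡ e ℚ.* ((d ℚ.* a) ℚ.* (d ℚ.* a))
  regroup = solve 3 (λ e a d → e :* (a :* a) :* (d :* d) := e :* ((d :* a) :* (d :* a))) refl

  cauchy-recip : ∀ {x} → Cauchy x → Cauchy (recip ∘ x)
  cauchy-recip {x} cx ε 0<ε =
    let (N , c) = cx (ε ℚ.* (δ ℚ.* δ)) (*-pos 0<ε (*-pos 0<δ 0<δ))
    in N , λ m n hm hn → begin
    ℚ.∣ recip (x m) ℚ.- recip (x n) ∣
      ≤⟨ recip-lipschitz (x m) (x n) ⟩
    ℚ.∣ x m ℚ.- x n ∣ ℚ.* (d ℚ.* d)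
      ≤⟨ ℚ.*-monoʳ-≤-nonNeg (d ℚ.* d) {{ℚ.nonNegative (ℚ.<⇒≤ (*-pos 0<d 0<d))}} (c m n hm hn) ⟩
    ε ℚ.* (δ ℚ.* δ) ℚ.* (d ℚ.* d)
      ≡⟨ regroup ε δ d ⟩
    ε ℚ.* ((d ℚ.* δ) ℚ.* (d ℚ.* δ))
      ≡⟨ cong (λ z → ε ℚ.* (z ℚ.* z)) d*δ≡1 ⟩
    ε ℚ.* 1ℚ
      ≡⟨ ℚ.*-identityʳ ε ⟩
    ε ∎

opaque
  recip-cauchy : ∀ {δ} (0<δ : 0ℚ ℚ.< δ) (x : ℝ) → Cauchy (λ n → Reciprocal.recip 0<δ (seq x n))
  recip-cauchy 0<δ x = Reciprocal.cauchy-recip 0<δ {seq x} (cauchy x)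

-- The witness of 0 < x supplies δ > 0 with x n ≥ δ for all large n;
-- replacing x n by x n ⊔ δ alters only finitely many terms.
1/ℝ_ : ℝ⁺ → ℝ
1/ℝ (x ,⁺ mk< δ 0<δ _ _) = mkℝ (λ n → recip (seq x n)) (recip-cauchy 0<δ x)
  where open Reciprocal 0<δ using (recip)

infixr 8 _^ℕ_ _^ℤ_

_^ℕ_ : ℝ → ℕ → ℝ
x ^ℕ zero  = 1ℝ
x ^ℕ suc n = x *ℝ x ^ℕ n

_^ℤ_ : ℝ⁺ → ℤ → ℝ
x ^ℤ (+ n)    = value x ^ℕ n
x ^ℤ -[1+ n ] = (1/ℝ x) ^ℕ suc n

module _ {ℓ} {P : Pred ℕ ℓ} (P? : Decidable P) where

  -- The largest s ≤ b with P s (or 0 if there is none).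
  last : ℕ → ℕ
  last zero    = zero
  last (suc b) = if does (P? (suc b)) then suc b else last b

  last-holds : P 0 → ∀ b → P (last b)
  last-holds p₀ zero = p₀
  last-holds p₀ (suc b) with P? (suc b)
  ... | yes p = p
  ... | no  _ = last-holds p₀ b

  last-fails : ∀ b → ¬ P (suc b) → ¬ P (suc (last b))
  last-fails zero ¬p = ¬p
  last-fails (suc b) ¬p with P? (suc b)
  ... | yes _  = ¬p
  ... | no ¬p′ = last-fails b ¬p′

square≤? : ∀ n p → Decidable (λ s → + s ℚ./ suc n ℚ.* (+ s ℚ./ suc n) ℚ.≤ p)
square≤? n p s = + s ℚ./ suc n ℚ.* (+ s ℚ./ suc n) ℚ.≤? p

-- For p ≥ 0, the largest s / (n + 1) whose square is at most p. The
-- search bound b satisfies (b + 1) / (n + 1) = ∣ ↥ p ∣ + 1, whose square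
-- exceeds p.
√-numerator : ℕ → ℚ → ℕ
√-numerator n p = last (square≤? n p) (n ℕ.+ ℤ.∣ ↥ p ∣ ℕ.* suc n)

-- Opaque only to keep type checking from normalising the search;
-- specified by sqrtℚ-lower and sqrtℚ-upper below.
opaque
  sqrtℚ : ℕ → ℚ → ℚ
  sqrtℚ n p = + √-numerator n p ℚ./ suc n

fromℚᵘ-+ : ∀ p q → ℚ.fromℚᵘ (p ℚᵘ.+ q) ≡ ℚ.fromℚᵘ p ℚ.+ ℚ.fromℚᵘ q
fromℚᵘ-+ p q = ℚ.toℚᵘ-injective (begin-equality
  ℚ.toℚᵘ (ℚ.fromℚᵘ (p ℚᵘ.+ q))                    ≃⟨ ℚ.toℚᵘ-fromℚᵘ (p ℚᵘ.+ q) ⟩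
  p ℚᵘ.+ q                                        ≃⟨ ℚᵘ.+-cong (ℚ.toℚᵘ-fromℚᵘ p) (ℚ.toℚᵘ-fromℚᵘ q) ⟨
  ℚ.toℚᵘ (ℚ.fromℚᵘ p) ℚᵘ.+ ℚ.toℚᵘ (ℚ.fromℚᵘ q)    ≃⟨ ℚ.toℚᵘ-homo-+ (ℚ.fromℚᵘ p) (ℚ.fromℚᵘ q) ⟨
  ℚ.toℚᵘ (ℚ.fromℚᵘ p ℚ.+ ℚ.fromℚᵘ q)              ∎)
  where open ℚᵘ.≤-Reasoning

suc-/ : ∀ n s → + suc s ℚ./ suc n ≡ + s ℚ./ suc n ℚ.+ + 1 ℚ./ suc n
suc-/ n s = trans
  (ℚ.fromℚᵘ-cong {mkℚᵘ (+ suc s) n} {mkℚᵘ (+ s) n ℚᵘ.+ mkℚᵘ (+ 1) n}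
    (ℚᵘ.*≡* (ℤsolve 2
      (λ s d → (ℤcon (+ 1) ℤ:+ s) ℤ:* (d ℤ:* d)
                 ℤ:= (s ℤ:* d ℤ:+ ℤcon (+ 1) ℤ:* d) ℤ:* d)
      refl (+ s) (+ suc n))))
  (fromℚᵘ-+ (mkℚᵘ (+ s) n) (mkℚᵘ (+ 1) n))

/-nonNeg : ∀ n s → 0ℚ ℚ.≤ + s ℚ./ suc n
/-nonNeg n s = ℚ.nonNegative⁻¹ _ {{ℚ.normalize-nonNeg s (suc n)}}

p<1+∣↥p∣ : ∀ p → p ℚ.< + suc ℤ.∣ ↥ p ∣ ℚ./ 1
p<1+∣↥p∣ p@(ℚ.mkℚ i d _) = ℚ.toℚᵘ-cancel-< (begin-strict
  mkℚᵘ i d                                    <⟨ ℚᵘ.*<* (lemma i) ⟩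
  mkℚᵘ (+ suc ℤ.∣ i ∣) 0                      ≃⟨ ℚ.toℚᵘ-fromℚᵘ (mkℚᵘ (+ suc ℤ.∣ i ∣) 0) ⟨
  ℚ.toℚᵘ (+ suc ℤ.∣ i ∣ ℚ./ 1)                ∎)
  where
  open ℚᵘ.≤-Reasoning
  lemma : ∀ i → i ℤ.* + 1 ℤ.< + suc ℤ.∣ i ∣ ℤ.* + suc d
  lemma (+ m) = subst (ℤ._< + suc m ℤ.* + suc d) (sym (ℤ.*-identityʳ (+ m)))
    (subst (+ m ℤ.<_) (ℤ.pos-* (suc m) (suc d)) (ℤ.+<+ (ℕ.m≤m*n (suc m) (suc d))))
  lemma -[1+ m ] = ℤ.-<+

p≤p*p : ∀ p → 1ℚ ℚ.≤ p → p ℚ.≤ p ℚ.* p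
p≤p*p p 1≤p = subst (ℚ._≤ p ℚ.* p) (ℚ.*-identityʳ p)
  (ℚ.*-monoˡ-≤-nonNeg p
    {{ℚ.nonNegative (ℚ.≤-trans (ℚ.nonNegative⁻¹ 1ℚ) 1≤p)}} 1≤p)

1/-small : ∀ ε → 0ℚ ℚ.< ε → ∃[ N ] (∀ n → N ℕ.≤ n → + 1 ℚ./ suc n ℚ.≤ ε)
1/-small ε@(ℚ.mkℚ (+ zero) d _) (ℚ.*<* (ℤ.+<+ ()))
1/-small ε@(ℚ.mkℚ (+ suc a) d _) _ = d , λ n d≤n → ℚ.toℚᵘ-cancel-≤ (begin
  ℚ.toℚᵘ (+ 1 ℚ./ suc n)      ≃⟨ ℚ.toℚᵘ-fromℚᵘ (mkℚᵘ (+ 1) n) ⟩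
  mkℚᵘ (+ 1) n                ≤⟨ ℚᵘ.*≤* (lemma d≤n) ⟩
  mkℚᵘ (+ suc a) d            ∎)
  where
  open ℚᵘ.≤-Reasoning
  lemma : ∀ {n} → d ℕ.≤ n → + 1 ℤ.* + suc d ℤ.≤ + suc a ℤ.* + suc n
  lemma {n} d≤n = ℤ.≤-trans
    (ℤ.≤-reflexive (ℤ.*-identityˡ (+ suc d)))
    (ℤ.≤-trans (ℤ.+≤+ (ℕ.≤-trans (ℕ.s≤s d≤n) (ℕ.m≤n*m (suc n) (suc a))))
               (ℤ.≤-reflexive (ℤ.pos-* (suc a) (suc n))))

opaque
  unfolding sqrtℚ

  sqrtℚ-nonNeg : ∀ n p → 0ℚ ℚ.≤ sqrtℚ n p
  sqrtℚ-nonNeg n p = /-nonNeg n (√-numerator n p)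

  sqrtℚ-lower : ∀ n p → 0ℚ ℚ.≤ p → sqrtℚ n p ℚ.* sqrtℚ n p ℚ.≤ p
  sqrtℚ-lower n p 0≤p = last-holds (square≤? n p)
    (subst (ℚ._≤ p) (cong₂ ℚ._*_ (sym (ℚ.0/n≡0 (suc n))) (sym (ℚ.0/n≡0 (suc n)))) 0≤p)
    (n ℕ.+ ℤ.∣ ↥ p ∣ ℕ.* suc n)

  sqrtℚ-upper : ∀ n p → p ℚ.< (sqrtℚ n p ℚ.+ + 1 ℚ./ suc n) ℚ.* (sqrtℚ n p ℚ.+ + 1 ℚ./ suc n)
  sqrtℚ-upper n p = subst (λ r → p ℚ.< r ℚ.* r) (suc-/ n (√-numerator n p))
    (ℚ.≰⇒> (last-fails (square≤? n p) (n ℕ.+ ℤ.∣ ↥ p ∣ ℕ.* suc n)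
      (λ h → ℚ.<-irrefl refl (ℚ.<-≤-trans bound h))))
    where
    k : ℕ
    k = suc ℤ.∣ ↥ p ∣

    k≡ : + (k ℕ.* suc n) ℚ./ suc n ≡ + k ℚ./ 1
    k≡ = ℚ.fromℚᵘ-cong {mkℚᵘ (+ (k ℕ.* suc n)) n} {mkℚᵘ (+ k) 0}
      (ℚᵘ.*≡* (trans (ℤ.*-identityʳ (+ (k ℕ.* suc n))) (ℤ.pos-* k (suc n))))

    1≤k : 1ℚ ℚ.≤ + k ℚ./ 1
    1≤k = subst (1ℚ ℚ.≤_) (sym (suc-/ 0 ℤ.∣ ↥ p ∣))
      (subst (ℚ._≤ + ℤ.∣ ↥ p ∣ ℚ./ 1 ℚ.+ 1ℚ) (ℚ.+-identityˡ 1ℚ) (ℚ.+-monoˡ-≤ 1ℚ (/-nonNeg 0 ℤ.∣ ↥ p ∣)))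

    bound : p ℚ.< (+ (k ℕ.* suc n) ℚ./ suc n) ℚ.* (+ (k ℕ.* suc n) ℚ./ suc n)
    bound = subst (λ r → p ℚ.< r ℚ.* r) (sym k≡)
      (ℚ.<-≤-trans (p<1+∣↥p∣ p) (p≤p*p (+ k ℚ./ 1) 1≤k))

square : ∀ w h → w ℚ.* w ℚ.+ h ℚ.* h ℚ.+ (h ℚ.* w ℚ.+ h ℚ.* w) ≡ (w ℚ.+ h) ℚ.* (w ℚ.+ h)
square = solve 2
  (λ w h → w :* w :+ h :* h :+ (h :* w :+ h :* w) := (w :+ h) :* (w :+ h)) refl

-- Here r and s stand for approximate square roots of p and q.
root-close : ∀ {p q r s g h} → 0ℚ ℚ.≤ r → 0ℚ ℚ.≤ s → 0ℚ ℚ.≤ g → 0ℚ ℚ.< h →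
  r ℚ.* r ℚ.≤ p → q ℚ.< (s ℚ.+ g) ℚ.* (s ℚ.+ g) → g ℚ.≤ h → p ℚ.≤ q ℚ.+ h ℚ.* h →
  r ℚ.≤ s ℚ.+ (h ℚ.+ h)
root-close {p} {q} {r} {s} {g} {h} 0≤r 0≤s 0≤g 0<h rr≤p q<[s+g]² g≤h p≤q+hh =
  ℚ.≮⇒≥ λ s+h+h<r → ℚ.<-irrefl refl (begin-strict
    p
      ≤⟨ p≤q+hh ⟩
    q ℚ.+ h ℚ.* h
      <⟨ ℚ.+-monoˡ-< (h ℚ.* h) q<ww ⟩
    w ℚ.* w ℚ.+ h ℚ.* h
      ≤⟨ p≤p+e (w ℚ.* w ℚ.+ h ℚ.* h) 0≤2hw ⟩
    w ℚ.* w ℚ.+ h ℚ.* h ℚ.+ (h ℚ.* w ℚ.+ h ℚ.* w)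
      ≡⟨ square w h ⟩
    (w ℚ.+ h) ℚ.* (w ℚ.+ h)
      ≤⟨ *-mono-≤ {w ℚ.+ h} {r} {w ℚ.+ h} {r} 0≤w+h 0≤r (w+h≤r s+h+h<r) (w+h≤r s+h+h<r) ⟩
    r ℚ.* r
      ≤⟨ rr≤p ⟩
    p ∎)
  where
  open ℚ.≤-Reasoning
  w = s ℚ.+ h

  0<w : 0ℚ ℚ.< w
  0<w = ℚ.+-mono-≤-< 0≤s 0<h

  0≤w+h : 0ℚ ℚ.≤ w ℚ.+ h
  0≤w+h = ℚ.<⇒≤ (+-pos 0<w 0<h)

  0≤2hw : 0ℚ ℚ.≤ h ℚ.* w ℚ.+ h ℚ.* w
  0≤2hw = ℚ.<⇒≤ (+-pos (*-pos 0<h 0<w) (*-pos 0<h 0<w))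

  w+h≤r : s ℚ.+ (h ℚ.+ h) ℚ.< r → w ℚ.+ h ℚ.≤ r
  w+h≤r lt = subst (ℚ._≤ r) (sym (ℚ.+-assoc s h h)) (ℚ.<⇒≤ lt)

  s+g≤w : s ℚ.+ g ℚ.≤ w
  s+g≤w = ℚ.+-monoʳ-≤ s g≤h

  q<ww : q ℚ.< w ℚ.* w
  q<ww = ℚ.<-≤-trans q<[s+g]² (*-mono-≤ {s ℚ.+ g} {w} {s ℚ.+ g} {w}
    (ℚ.+-mono-≤ 0≤s 0≤g) (ℚ.<⇒≤ 0<w) s+g≤w s+g≤w)

sqrtℚ-close : ∀ m n {p q h} → 0ℚ ℚ.≤ p → 0ℚ ℚ.< h →
  + 1 ℚ./ suc n ℚ.≤ h → p ℚ.≤ q ℚ.+ h ℚ.* h →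
  sqrtℚ m p ℚ.≤ sqrtℚ n q ℚ.+ (h ℚ.+ h)
sqrtℚ-close m n {p} {q} 0≤p 0<h = root-close
  (sqrtℚ-nonNeg m p) (sqrtℚ-nonNeg n q) (/-nonNeg n 1) 0<h
  (sqrtℚ-lower m p 0≤p) (sqrtℚ-upper n q)

cauchy-sqrt : ∀ {x} → Cauchy x → Cauchy (λ n → sqrtℚ n (x n ℚ.⊔ 0ℚ))
cauchy-sqrt {x} cx ε 0<ε = M ℕ.⊔ N , λ m n hm hn →
  ∣p-q∣≤e {y m} {y n} {ε} (half m n hm hn) (half n m hn hm)
  where
  y : ℕ → ℚ
  y n = sqrtℚ n (x n ℚ.⊔ 0ℚ)
  h = ½ ℚ.* ε
  0<h = ½e-pos 0<ε
  M = proj₁ (1/-small h 0<h)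
  N = proj₁ (cx (h ℚ.* h) (*-pos 0<h 0<h))

  half : ∀ m n → M ℕ.⊔ N ℕ.≤ m → M ℕ.⊔ N ℕ.≤ n → y m ℚ.≤ y n ℚ.+ ε
  half m n hm hn = subst (λ e → y m ℚ.≤ y n ℚ.+ e) (½e+½e≡e ε)
    (sqrtℚ-close m n {x m ℚ.⊔ 0ℚ} {x n ℚ.⊔ 0ℚ} {h} (ℚ.p≤q⊔p (x m) 0ℚ) 0<h
      (proj₂ (1/-small h 0<h) n (ℕ.m⊔n≤o⇒m≤o M N hn))
      (∣p-q∣≤e⇒p≤q+e {x m ℚ.⊔ 0ℚ} {x n ℚ.⊔ 0ℚ} {h ℚ.* h}
        (ℚ.≤-trans (⊔-nonexpansive (x m) (x n) 0ℚ)
          (proj₂ (cx (h ℚ.* h) (*-pos 0<h 0<h)) m n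
            (ℕ.m⊔n≤o⇒n≤o M N hm) (ℕ.m⊔n≤o⇒n≤o M N hn)))))

opaque
  √-cauchy : ∀ x → Cauchy (λ n → sqrtℚ n (seq x n ℚ.⊔ 0ℚ))
  √-cauchy x = cauchy-sqrt {seq x} (cauchy x)

-- √ x is the square root of max(x, 0).
√_ : ℝ → ℝ
√ x = mkℝ (λ n → sqrtℚ n (seq x n ℚ.⊔ 0ℚ)) (√-cauchy x)

record ℂ : Set where
  constructor _+i_
  field
    re im : ℝ

open ℂ public

infix 4 _≃ℂ_

_≃ℂ_ : ℂ → ℂ → Set
z ≃ℂ w = re z ≃ℝ re w × im z ≃ℝ im w

fromℝ : ℝ → ℂ
fromℝ x = x +i 0ℝ

ℂ-rawRing : RawRing 0ℓ 0ℓ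
ℂ-rawRing = record
  { Carrier = ℂ
  ; _≈_     = _≃ℂ_
  ; _+_     = λ z w → (re z +ℝ re w) +i (im z +ℝ im w)
  ; _*_     = λ z w → (re z *ℝ re w -ℝ im z *ℝ im w) +i (re z *ℝ im w +ℝ im z *ℝ re w)
  ; -_      = λ z → (-ℝ re z) +i (-ℝ im z)
  ; 0#      = fromℝ 0ℝ
  ; 1#      = fromℝ 1ℝ
  }

open RawRing ℂ-rawRing public using () renaming (_*_ to infixl 7 _*ℂ_; 1# to 1ℂ)

Σℂ : ∀ {n} → (Fin n → ℂ) → ℂ
Σℂ = RawMonoidDefs.sum (RawRing.+-rawMonoid ℂ-rawRing)

∣_∣ℂ : ℂ → ℝ
∣ z ∣ℂ = √ (re z *ℝ re z +ℝ im z *ℝ im z)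

IsPrimePower : ℕ → Set
IsPrimePower q = ∃[ p ] ∃[ e ] Prime p × q ≡ p ℕ.^ suc e

isPrimePower⇒nonZero : ∀ {q} → IsPrimePower q → ℕ.NonZero q
isPrimePower⇒nonZero (p , e , p-prime , refl) =
  ℕ.m^n≢0 p (suc e) {{prime⇒nonZero p-prime}}

record FiniteField (c ℓ : Level) (q : ℕ) : Set (lsuc (c ⊔ ℓ)) where
  field
    commutativeRing : CommutativeRing c ℓ

  open CommutativeRing commutativeRing public

  field
    1≉0         : ¬ 1# ≈ 0#
    inverse     : ∀ x → ¬ x ≈ 0# → ∃[ y ] x * y ≈ 1#
    enumeration : Inverse (≡.setoid (Fin q)) setoid

  open Inverse enumeration public using ()
    renaming (to to element; from to index)

  element-index : ∀ x → element (index x) ≈ x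
  element-index = Inverse.strictlyInverseˡ enumeration

  index-injective : ∀ {x y} → index x ≡ index y → x ≈ y
  index-injective {x} {y} eq = begin
    x                    ≈⟨ element-index x ⟨
    element (index x)    ≡⟨ cong element eq ⟩
    element (index y)    ≈⟨ element-index y ⟩
    y                    ∎
    where open SetoidReasoning setoid

  infix 4 _≈?_

  _≈?_ : ∀ x y → Dec (x ≈ y)
  x ≈? y = map′ index-injective (Inverse.from-cong enumeration) (index x Fin.≟ index y)

module _ {c ℓ q} (k : FiniteField c ℓ q) where

  open FiniteField k

  record NontrivialCharacter : Set (c ⊔ ℓ) where
    field
      ψ              : Carrier → ℂ
      isHomomorphism : IsMonoidHomomorphism
                         (RawRing.+-rawMonoid rawRing) (RawRing.*-rawMonoid ℂ-rawRing) ψ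
      unitary        : ∀ x → ∣ ψ x ∣ℂ ≃ℝ 1ℝ
      nontrivial     : ¬ (∀ x → ψ x ≃ℂ 1ℂ)

  record Distribution : Set (c ⊔ ℓ) where
    field
      mass       : Carrier → ℝ
      mass-cong  : ∀ {x y} → x ≈ y → mass x ≃ℝ mass y
      nonNeg     : ∀ x → 0ℝ ≤ℝ mass x
      normalised : Σℝ (mass ∘ element) ≃ℝ 1ℝ

  open Distribution

  fourier : NontrivialCharacter → (Carrier → ℂ) → Carrier → ℂ
  fourier ψ₀ f a = Σℂ (λ i → f (element i) *ℂ ψ (a * element i))
    where open NontrivialCharacter ψ₀

  l1Norm : (Carrier → ℂ) → ℝ
  l1Norm f = Σℝ (λ i → ∣ f (element i) ∣ℂ)

  open RawMonoidDefs (RawRing.+-rawMonoid rawRing) using () renaming (sum to Σk)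

  index-bound : ∀ {m N} (i : Fin (suc m)) (j : Fin (N ℕ.∸ m)) → toℕ i ℕ.+ toℕ j ℕ.< N
  index-bound {m} {N} i j = begin-strict
    toℕ i ℕ.+ toℕ j      ≤⟨ ℕ.+-monoˡ-≤ (toℕ j) (ℕ.s≤s⁻¹ (Fin.toℕ<n i)) ⟩
    m ℕ.+ toℕ j          <⟨ ℕ.+-monoʳ-< m (Fin.toℕ<n j) ⟩
    m ℕ.+ (N ℕ.∸ m)      ≡⟨ ℕ.m+[n∸m]≡n m≤N ⟩
    N                    ∎
    where
    open ℕ.≤-Reasoning
    m≤N : m ℕ.≤ N
    m≤N = ℕ.<⇒≤ (ℕ.m∸n≢0⇒n<m (λ eq → Fin.¬Fin0 (subst Fin eq j)))

  -- Σ_{i=0}^{m} aᵢ x_{i+j}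
  hankelSum : ∀ {m N} → (Fin (suc m) → Carrier) → (Fin N → Carrier) → Fin (N ℕ.∸ m) → Carrier
  hankelSum a x j = Σk (λ i → a i * x (fromℕ< (index-bound i j)))

  -- Sequences x₀ … xₙ are indexed by Fin N with N = n + 1, so that the
  -- range 0 ≤ j ≤ n - m becomes Fin (N ∸ m).
  H : ∀ {N} → ℕ → (Fin N → Carrier) → Set (c ⊔ ℓ)
  H {N} m x = ∃[ a ] (∃[ i ] ¬ a i ≈ 0#) × (∀ j → hankelSum {m} {N} a x j ≈ 0#)

  -- The t-th of the q ^ N sequences in k^N.
  sequence : ∀ N → Fin (q ℕ.^ N) → Fin N → Carrier
  sequence N t = element ∘ finToFun t

  sequence-surjective : ∀ {N} (a : Fin N → Carrier) →
    ∀ i → sequence N (funToFin (index ∘ a)) i ≈ a i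
  sequence-surjective a i = begin
    element (finToFun (funToFin (index ∘ a)) i)    ≡⟨ cong element (Fin.finToFun-funToFin (index ∘ a) i) ⟩
    element (index (a i))                          ≈⟨ element-index (a i) ⟩
    a i                                            ∎
    where open SetoidReasoning setoid

  H-resp : ∀ {N} m (x : Fin N → Carrier) (a b : Fin (suc m) → Carrier) → (∀ i → b i ≈ a i) →
    (∃[ i ] ¬ a i ≈ 0#) × (∀ j → hankelSum a x j ≈ 0#) →
    (∃[ i ] ¬ b i ≈ 0#) × (∀ j → hankelSum b x j ≈ 0#)
  H-resp {N} m x a b b≈a ((i , aᵢ≉0) , a-eqs) = (i , bᵢ≉0) , b-eqs
    where
    open SetoidReasoning setoid

    bᵢ≉0 : ¬ b i ≈ 0#
    bᵢ≉0 bᵢ≈0 = aᵢ≉0 (begin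
      a i    ≈⟨ b≈a i ⟨
      b i    ≈⟨ bᵢ≈0 ⟩
      0#     ∎)

    b-eqs : ∀ j → hankelSum b x j ≈ 0#
    b-eqs j = begin
      hankelSum b x j    ≈⟨ MonoidSum.sum-cong-≋ +-monoid (λ i → *-congʳ {x (fromℕ< (index-bound i j))} (b≈a i)) ⟩
      hankelSum a x j    ≈⟨ a-eqs j ⟩
      0#                 ∎

  H? : ∀ {N} m (x : Fin N → Carrier) → Dec (H m x)
  H? {N} m x = map′
    (λ (t , t-works) → sequence (suc m) t , t-works)
    (λ (a , a-works) → funToFin (index ∘ a) ,
      H-resp m x a (sequence (suc m) (funToFin (index ∘ a))) (sequence-surjective a) a-works)
    (Fin.any? {n = q ℕ.^ suc m} λ t →
      Fin.any? (λ i → ¬? (sequence (suc m) t i ≈? 0#))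
        ×-dec Fin.all? (λ j → hankelSum (sequence (suc m) t) x j ≈? 0#))

  Π : ∀ {N} → ℕ → (Fin N → Distribution) → ℝ
  Π {N} m μ = Σℝ {q ℕ.^ N} λ t →
    let x = sequence N t in
    if does (H? m x) then ∏ℝ (λ i → mass (μ i) (x i)) else 0ℝ

open Distribution public using (mass)

{-# OPTIONS --safe #-}

-- Let w_j(x) be the number of a in k^j with (a b)·x = 0 for all b in k^(N+1-j),
-- where a and b are multiplied as polynomials and · is the dot product on k^N.
-- Along j the sizes w_j are log-convex, because (a , a′) ↦ X a + a′ maps pairs
-- of kernel vectors to kernel vectors, and they are symmetric under j ↦ N+1-j
-- up to powers of q. Hence w_{m+1} = q w_m when 2m ≤ N and w_{m+1} > 1, so that
--   (q - 1) [x ∈ H_m] = w_{m+1}(x) - q w_m(x) + (q - 1).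
-- By orthogonality of characters q^(N+1-j) E[w_j] = Σ_{a,b} ∏ᵢ μ̂ᵢ((a b)ᵢ). The
-- pairs with a b = 0 contribute q^j + q^(N+1-j) - 1 and produce the main term
-- q^(2m-N). A nonzero y occurs at most as often as it has divisors, so the
-- other pairs contribute at most max τ(y) · ∏ᵢ ‖μ̂ᵢ‖₁.
-- The divisor bound is τ(y) ≤ C (1 + 1/R)^deg y: an irreducible factor of
-- degree ≥ R at most doubles τ, which is paid for by (1 + 1/R)^R ≥ 2, and an
-- irreducible factor of smaller degree and exponent e multiplies τ by at most
-- e + 1 ≤ R (1 + 1/R)^e; there are at most q^R of the latter.
module Submission where

open import Defs
open import Algebra.Bundles using (CommutativeRing; CommutativeSemiring)
open import Algebra.Bundles.Raw using (RawRing)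
open import Algebra.Morphism.Structures using (IsMonoidHomomorphism)
import Algebra.Properties.AbelianGroup as AbelianGroupProperties
import Algebra.Properties.CommutativeMonoid.Sum as MonoidSum
import Algebra.Properties.CommutativeSemigroup as SemigroupProperties
import Algebra.Properties.Group as GroupProperties
import Algebra.Properties.Ring as RingProperties
import Algebra.Properties.Semiring.Mult as Mult
import Algebra.Properties.Semiring.Sum as SemiringSum
open import Algebra.Structures using (IsCommutativeRing)
open import Data.Bool.Base using (if_then_else_; true; false)
open import Data.Empty using (⊥-elim)
open import Data.Fin.Base as Fin using (Fin; finToFun; funToFin; toℕ; fromℕ<; combine; remQuot; _↑ˡ_; _↑ʳ_)
open import Data.Fin.Permutation using (permutation)
import Data.Fin.Properties as Fin
open import Data.Integer.Base as ℤ using (ℤ; +_; -[1+_])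
import Data.Integer.Properties as ℤ
open import Data.List.Base as List using (List; []; _∷_; _++_; length)
import Data.List.Properties as List
open import Data.List.Relation.Unary.Any as Any using (Any; here; there)
import Data.List.Relation.Unary.Any.Properties as Any
open import Data.Nat.Base as ℕ using (ℕ; zero; suc)
import Data.Nat.Properties as ℕ
open import Data.Nat.Solver using () renaming (module +-*-Solver to ℕ-Solver)
open import Data.Product.Base using (∃-syntax; _×_; _,_; proj₁; proj₂)
open import Data.Rational.Base as ℚ using (ℚ; 0ℚ; 1ℚ; ½; ↥_)
import Data.Rational.Properties as ℚ
open import Data.Rational.Solver using () renaming (module +-*-Solver to ℚ-Solver)
open import Data.Sum.Base using (_⊎_; inj₁; inj₂)
open import Data.Unit.Base using (⊤; tt)
open import Function.Base using (_∘_)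
open import Function.Bundles using (Inverse)
open import Level using (Level; 0ℓ; _⊔_)
open import Relation.Binary.PropositionalEquality
  using (_≡_; refl; sym; trans; cong; cong₂; subst; module ≡-Reasoning)
import Relation.Binary.Reasoning.Setoid as SetoidReasoning
open import Relation.Nullary using (¬_; Dec; yes; no; does)
open import Relation.Nullary.Decidable
  using (¬¬-excluded-middle; decidable-stable; dec-true; map′; ¬?; _×-dec_; _⊎-dec_)

-- Only sizes of kernels are used, never ranks or bases. Convexity alone makes the sizes grow by at
-- least a factor `q` per step once a kernel is nontrivial; symmetry about the middle gives the
-- matching upper bound as long as `2m ≤ N`. The combination `w_(m+1) - q w_m` is also the right one
-- for the averages. Multiplied by `q^(N-m)` it turns both expectations into sums over pairs, and
-- the parts `q^(N-m)` and `q^(N+1-m)` of the zero-pair counts cancel against `q^(N-m) (q - 1)`; the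
-- main term and two error sums remain. The obstacle is constructive. Reducibility and divisibility
-- of polynomials are not decided, so irreducible factors exist only under double negation. This is
-- harmless: they serve to bound counts, and `≤` on `ℕ` is decidable. Signs of reals cannot be
-- decided either, but `≤ℝ` and `≃ℝ` are stable. `C` has to be fixed before the field, so no
-- property of the irreducible polynomials of a particular `k` may enter it; only the number of all
-- polynomials of degree below `R` does.

-- Ring structure, order and roots of the Cauchy reals.

module Real where
  open ℚ-Solver using (solve; _:+_; _:*_; :-_; _:-_; _:=_; con)

  Eventually : (ℕ → Set) → Set
  Eventually P = ∃[ N ] (∀ n → N ℕ.≤ n → P n)

  always : ∀ {P} → (∀ n → P n) → Eventually P
  always p = 0 , λ n _ → p n

  zipE : ∀ {P Q R} → (∀ n → P n → Q n → R n) → Eventually P → Eventually Q → Eventually R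
  zipE f (M , p) (N , q) = M ℕ.⊔ N , λ n hn →
    f n (p n (ℕ.m⊔n≤o⇒m≤o M N hn)) (q n (ℕ.m⊔n≤o⇒n≤o M N hn))

  mapE : ∀ {P Q} → (∀ n → P n → Q n) → Eventually P → Eventually Q
  mapE f (N , p) = N , λ n hn → f n (p n hn)

  witness : ∀ {P} {A : Set} → Eventually P → (∀ n → P n → A) → A
  witness (N , p) f = f N (p N ℕ.≤-refl)

  0<½ : 0ℚ ℚ.< ½
  0<½ = ℚ.positive⁻¹ ½

  ≃-refl : ∀ {x} → x ≃ℝ x
  ≃-refl {x} = mk≃ λ ε 0<ε → always λ n →
    ℚ.≤-trans (ℚ.≤-reflexive (cong ℚ.∣_∣ (ℚ.+-inverseʳ (seq x n)))) (ℚ.<⇒≤ 0<ε)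

  pointwise : ∀ {x y} → (∀ n → seq x n ≡ seq y n) → x ≃ℝ y
  pointwise {x} {y} eq = mk≃ λ ε 0<ε → always λ n →
    subst (λ r → ℚ.∣ seq x n ℚ.- r ∣ ℚ.≤ ε) (eq n) (proj₂ (_≃ℝ_.close (≃-refl {x}) ε 0<ε) n
      ℕ.z≤n)

  ≃-sym : ∀ {x y} → x ≃ℝ y → y ≃ℝ x
  ≃-sym {x} {y} (mk≃ c) = mk≃ λ ε 0<ε → mapE
    (λ n → ℚ.≤-trans (ℚ.≤-reflexive (∣p-q∣≡∣q-p∣ (seq y n) (seq x n)))) (c ε 0<ε)

  ≤-refl : ∀ {x} → x ≤ℝ x
  ≤-refl {x} = mk≤ λ ε 0<ε → always λ n → p≤p+e (seq x n) (ℚ.<⇒≤ 0<ε)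

  ≤-trans : ∀ {x y z} → x ≤ℝ y → y ≤ℝ z → x ≤ℝ z
  ≤-trans {x} {y} {z} (mk≤ a) (mk≤ b) = mk≤ λ ε 0<ε → zipE
    (λ n p q → begin
      seq x n                              ≤⟨ p ⟩
      seq y n ℚ.+ ½ ℚ.* ε                  ≤⟨ ℚ.+-monoˡ-≤ (½ ℚ.* ε) q ⟩
      seq z n ℚ.+ ½ ℚ.* ε ℚ.+ ½ ℚ.* ε      ≡⟨ ℚ.+-assoc (seq z n) _ _ ⟩
      seq z n ℚ.+ (½ ℚ.* ε ℚ.+ ½ ℚ.* ε)    ≡⟨ cong (seq z n ℚ.+_) (½e+½e≡e ε) ⟩
      seq z n ℚ.+ ε                        ∎)
    (a (½ ℚ.* ε) (½e-pos 0<ε)) (b (½ ℚ.* ε) (½e-pos 0<ε))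
    where open ℚ.≤-Reasoning

  ≃⇒≤ : ∀ {x y} → x ≃ℝ y → x ≤ℝ y
  ≃⇒≤ {x} {y} (mk≃ c) = mk≤ λ ε 0<ε →
    mapE (λ n → ∣p-q∣≤e⇒p≤q+e {seq x n} {seq y n} {ε}) (c ε 0<ε)

  ≤-antisym : ∀ {x y} → x ≤ℝ y → y ≤ℝ x → x ≃ℝ y
  ≤-antisym {x} {y} (mk≤ a) (mk≤ b) = mk≃ λ ε 0<ε →
    zipE (λ n → ∣p-q∣≤e {seq x n} {seq y n} {ε}) (a ε 0<ε) (b ε 0<ε)

  ≃-trans : ∀ {x y z} → x ≃ℝ y → y ≃ℝ z → x ≃ℝ z
  ≃-trans p q = ≤-antisym (≤-trans (≃⇒≤ p) (≃⇒≤ q)) (≤-trans (≃⇒≤ (≃-sym q)) (≃⇒≤ (≃-sym p)))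

  +-mono-≤ : ∀ {x y u v} → x ≤ℝ y → u ≤ℝ v → x +ℝ u ≤ℝ y +ℝ v
  +-mono-≤ {x} {y} {u} {v} (mk≤ a) (mk≤ b) = mk≤ λ ε 0<ε → zipE
    (λ n p q → begin
      seq x n ℚ.+ seq u n                                  ≤⟨ ℚ.+-mono-≤ p q ⟩
      (seq y n ℚ.+ ½ ℚ.* ε) ℚ.+ (seq v n ℚ.+ ½ ℚ.* ε)      ≡⟨ solve 3
          (λ y v h → (y :+ h) :+ (v :+ h) := (y :+ v) :+ (h :+ h)) refl (seq y n) (seq v n) (½ ℚ.* ε) ⟩
      seq y n ℚ.+ seq v n ℚ.+ (½ ℚ.* ε ℚ.+ ½ ℚ.* ε)        ≡⟨ cong (seq y n ℚ.+ seq v n ℚ.+_) (½e+½e≡e ε) ⟩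
      seq y n ℚ.+ seq v n ℚ.+ ε                            ∎)
    (a (½ ℚ.* ε) (½e-pos 0<ε)) (b (½ ℚ.* ε) (½e-pos 0<ε))
    where open ℚ.≤-Reasoning

  neg-mono-≤ : ∀ {x y} → x ≤ℝ y → -ℝ y ≤ℝ -ℝ x
  neg-mono-≤ {x} {y} (mk≤ a) = mk≤ λ ε 0<ε → mapE
    (λ n p → begin
      ℚ.- seq y n
        ≡⟨ solve 3 (λ x y e → :- y := :- y :+ (:- x) :+ x) refl (seq x n) (seq y n) ε ⟩
      ℚ.- seq y n ℚ.+ (ℚ.- seq x n) ℚ.+ seq x n
        ≤⟨ ℚ.+-monoʳ-≤ (ℚ.- seq y n ℚ.+ (ℚ.- seq x n)) p ⟩
      ℚ.- seq y n ℚ.+ (ℚ.- seq x n) ℚ.+ (seq y n ℚ.+ ε)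
        ≡⟨ solve 3 (λ x y e → :- y :+ (:- x) :+ (y :+ e) := :- x :+ e) refl (seq x n) (seq y n) ε ⟩
      ℚ.- seq x n ℚ.+ ε ∎)
    (a ε 0<ε)
    where open ℚ.≤-Reasoning

  +-cong : ∀ {x y u v} → x ≃ℝ y → u ≃ℝ v → x +ℝ u ≃ℝ y +ℝ v
  +-cong p q = ≤-antisym (+-mono-≤ (≃⇒≤ p) (≃⇒≤ q)) (+-mono-≤ (≃⇒≤ (≃-sym p)) (≃⇒≤ (≃-sym q)))

  neg-cong : ∀ {x y} → x ≃ℝ y → -ℝ x ≃ℝ -ℝ y
  neg-cong p = ≤-antisym (neg-mono-≤ (≃⇒≤ (≃-sym p))) (neg-mono-≤ (≃⇒≤ p))

  *-congʳ : ∀ {x y} z → x ≃ℝ y → x *ℝ z ≃ℝ y *ℝ z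
  *-congʳ {x} {y} z (mk≃ c) = mk≃ λ ε 0<ε →
    let (B , 0<B , bounded)  = cauchy-bounded {seq z} (cauchy z)
        (i , 0<i , i*B≡1) = 1/-positive 0<B
    in zipE
      (λ n p q → begin
        ℚ.∣ seq x n ℚ.* seq z n ℚ.- seq y n ℚ.* seq z n ∣
          ≡⟨ cong ℚ.∣_∣ (solve 3 (λ x y z → x :* z :- y :* z := (x :- y) :* z) refl (seq x n) (seq y n) (seq z n)) ⟩
        ℚ.∣ (seq x n ℚ.- seq y n) ℚ.* seq z n ∣
          ≡⟨ ℚ.∣p*q∣≡∣p∣*∣q∣ (seq x n ℚ.- seq y n) (seq z n) ⟩
        ℚ.∣ seq x n ℚ.- seq y n ∣ ℚ.* ℚ.∣ seq z n ∣
          ≤⟨ *-mono-≤ {ℚ.∣ seq x n ℚ.- seq y n ∣} {ε ℚ.* i} {ℚ.∣ seq z n ∣} {B} (ℚ.0≤∣p∣ (seq z n))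
              (ℚ.<⇒≤ (*-pos 0<ε 0<i)) p q ⟩
        ε ℚ.* i ℚ.* B
          ≡⟨ trans (ℚ.*-assoc ε i B) (trans (cong (ε ℚ.*_) i*B≡1) (ℚ.*-identityʳ ε)) ⟩
        ε ∎)
      (c (ε ℚ.* i) (*-pos 0<ε 0<i)) bounded
    where open ℚ.≤-Reasoning

  *-comm : ∀ x y → x *ℝ y ≃ℝ y *ℝ x
  *-comm x y = pointwise λ n → ℚ.*-comm (seq x n) (seq y n)

  *-cong : ∀ {x y u v} → x ≃ℝ y → u ≃ℝ v → x *ℝ u ≃ℝ y *ℝ v
  *-cong {x} {y} {u} {v} p q = ≃-trans (*-congʳ u p)
    (≃-trans (*-comm y u) (≃-trans (*-congʳ y q) (*-comm v y)))

  ℝ-commutativeRing : CommutativeRing 0ℓ 0ℓ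
  ℝ-commutativeRing = record
    { Carrier = ℝ ; _≈_ = _≃ℝ_ ; _+_ = _+ℝ_ ; _*_ = _*ℝ_ ; -_ = -ℝ_ ; 0# = 0ℝ ; 1# = 1ℝ
    ; isCommutativeRing = record
      { isRing = record
        { +-isAbelianGroup = record
          { isGroup = record
            { isMonoid = record
              { isSemigroup = record
                { isMagma = record
                  { isEquivalence = record { refl = ≃-refl ; sym = ≃-sym ; trans = ≃-trans }
                  ; ∙-cong = +-cong
                  }
                ; assoc = λ x y z → pointwise λ n → ℚ.+-assoc (seq x n) (seq y n) (seq z n)
                }
              ; identity = (λ x → pointwise λ n → ℚ.+-identityˡ (seq x n))
                         , (λ x → pointwise λ n → ℚ.+-identityʳ (seq x n))
              }
            ; inverse = (λ x → pointwise λ n → ℚ.+-inverseˡ (seq x n))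
                      , (λ x → pointwise λ n → ℚ.+-inverseʳ (seq x n))
            ; ⁻¹-cong = neg-cong
            }
          ; comm = λ x y → pointwise λ n → ℚ.+-comm (seq x n) (seq y n)
          }
        ; *-cong = *-cong
        ; *-assoc = λ x y z → pointwise λ n → ℚ.*-assoc (seq x n) (seq y n) (seq z n)
        ; *-identity = (λ x → pointwise λ n → ℚ.*-identityˡ (seq x n))
                     , (λ x → pointwise λ n → ℚ.*-identityʳ (seq x n))
        ; distrib = (λ x y z → pointwise λ n → ℚ.*-distribˡ-+ (seq x n) (seq y n) (seq z n))
                  , (λ x y z → pointwise λ n → ℚ.*-distribʳ-+ (seq x n) (seq y n) (seq z n))
        }
      ; *-comm = *-comm
      }
    }

  <⇒≱ : ∀ {x y} → x <ℝ y → ¬ (y ≤ℝ x)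
  <⇒≱ {x} {y} (mk< δ 0<δ M a) (mk≤ b) = witness
    (zipE (λ n p q → ℚ.≤-trans p q) (M , a) (b (½ ℚ.* δ) (½e-pos 0<δ)))
    (λ n p → ℚ.<-irrefl refl (ℚ.<-≤-trans (ℚ.+-monoʳ-< (seq x n) ½δ<δ) p))
    where
    ½δ<δ : ½ ℚ.* δ ℚ.< δ
    ½δ<δ = subst (ℚ._< δ) (ℚ.+-identityʳ (½ ℚ.* δ)) (subst ((½ ℚ.* δ ℚ.+ 0ℚ) ℚ.<_) (½e+½e≡e δ)
      (ℚ.+-monoʳ-< (½ ℚ.* δ) (½e-pos 0<δ)))

  -- A Cauchy sequence is eventually below ε or eventually above ε / 4; this
  -- makes the order stable under double negation.
  ≮⇒≥ : ∀ {x y} → ¬ (y <ℝ x) → x ≤ℝ y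
  ≮⇒≥ {x} {y} y≮x = mk≤ below
    where
    open ℚ.≤-Reasoning
    z = x -ℝ y
    below : ∀ ε → 0ℚ ℚ.< ε → Eventually λ n → seq x n ℚ.≤ seq y n ℚ.+ ε
    below ε 0<ε with cauchy z (½ ℚ.* ½ ℚ.* ε) (*-pos (*-pos 0<½ 0<½) 0<ε)
    ... | N , c = decide (seq z N ℚ.≤? ½ ℚ.* ε)
      where
      h = ½ ℚ.* ½ ℚ.* ε
      0<h = *-pos (*-pos 0<½ 0<½) 0<ε
      ½ε≡h+h : ½ ℚ.* ε ≡ h ℚ.+ h
      ½ε≡h+h = sym (trans (cong₂ ℚ._+_ (ℚ.*-assoc ½ ½ ε) (ℚ.*-assoc ½ ½ ε)) (½e+½e≡e (½ ℚ.* ε)))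
      decide : Dec (seq z N ℚ.≤ ½ ℚ.* ε) → Eventually λ n → seq x n ℚ.≤ seq y n ℚ.+ ε
      decide (yes small) = N , λ n hn → begin
        seq x n
          ≡⟨ solve 2 (λ x y → x := y :+ (x :- y)) refl (seq x n) (seq y n) ⟩
        seq y n ℚ.+ seq z n
          ≤⟨ ℚ.+-monoʳ-≤ (seq y n) (begin
               seq z n ≤⟨ ∣p-q∣≤e⇒p≤q+e {seq z n} {seq z N} (c n N hn ℕ.≤-refl) ⟩
               seq z N ℚ.+ h ≤⟨ ℚ.+-mono-≤ small (ℚ.≤-trans (p≤p+e h (ℚ.<⇒≤ 0<h)) (ℚ.≤-reflexive (sym ½ε≡h+h))) ⟩
               ½ ℚ.* ε ℚ.+ ½ ℚ.* ε ≡⟨ ½e+½e≡e ε ⟩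
               ε ∎) ⟩
        seq y n ℚ.+ ε ∎
      decide (no large) = ⊥-elim (y≮x (mk< h 0<h N λ n hn → begin
        seq y n ℚ.+ h
          ≤⟨ ℚ.+-monoʳ-≤ (seq y n) (begin
               h ≡⟨ solve 1 (λ h → h := h :+ h :- h) refl h ⟩
               h ℚ.+ h ℚ.- h ≡⟨ cong (ℚ._- h) ½ε≡h+h ⟨
               ½ ℚ.* ε ℚ.- h ≤⟨ ℚ.+-monoˡ-≤ (ℚ.- h) (ℚ.<⇒≤ (ℚ.≰⇒> large)) ⟩
               seq z N ℚ.- h ≤⟨ p≤q+e⇒p-q≤e {seq z N} {h} {seq z n}
                   (ℚ.≤-trans (∣p-q∣≤e⇒p≤q+e {seq z N} {seq z n} (c N n ℕ.≤-refl hn))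
                   (ℚ.≤-reflexive (ℚ.+-comm (seq z n) h))) ⟩
               seq z n ∎) ⟩
        seq y n ℚ.+ seq z n
          ≡⟨ solve 2 (λ x y → y :+ (x :- y) := x) refl (seq x n) (seq y n) ⟩
        seq x n ∎))

  ≤-stable : ∀ {x y} → ¬ ¬ (x ≤ℝ y) → x ≤ℝ y
  ≤-stable h = ≮⇒≥ λ y<x → h (<⇒≱ y<x)

  ≃-stable : ∀ {x y} → ¬ ¬ (x ≃ℝ y) → x ≃ℝ y
  ≃-stable h = ≤-antisym (≤-stable λ k → h (k ∘ ≃⇒≤)) (≤-stable λ k → h (k ∘ ≃⇒≤ ∘ ≃-sym))

  <-≤-trans : ∀ {x y z} → x <ℝ y → y ≤ℝ z → x <ℝ z
  <-≤-trans {x} {y} {z} (mk< δ 0<δ M a) (mk≤ b) =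
    let (N , c) = zipE
          (λ n p q → begin
            seq x n ℚ.+ ½ ℚ.* δ
              ≡⟨ solve 2 (λ x h → x :+ h := x :+ (h :+ h) :- h) refl (seq x n) (½ ℚ.* δ) ⟩
            seq x n ℚ.+ (½ ℚ.* δ ℚ.+ ½ ℚ.* δ) ℚ.- ½ ℚ.* δ
              ≡⟨ cong (λ e → seq x n ℚ.+ e ℚ.- ½ ℚ.* δ) (½e+½e≡e δ) ⟩
            seq x n ℚ.+ δ ℚ.- ½ ℚ.* δ
              ≤⟨ ℚ.+-monoˡ-≤ (ℚ.- (½ ℚ.* δ)) (ℚ.≤-trans p q) ⟩
            seq z n ℚ.+ ½ ℚ.* δ ℚ.- ½ ℚ.* δ
              ≡⟨ solve 2 (λ z h → z :+ h :- h := z) refl (seq z n) (½ ℚ.* δ) ⟩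
            seq z n ∎)
          (M , a) (b (½ ℚ.* δ) (½e-pos 0<δ))
    in mk< (½ ℚ.* δ) (½e-pos 0<δ) N c
    where open ℚ.≤-Reasoning

  +-pos-≤ : ∀ {x y} → 0ℝ <ℝ y → x <ℝ x +ℝ y
  +-pos-≤ {x} {y} (mk< δ 0<δ M a) = mk< δ 0<δ M λ n hn → ℚ.+-monoʳ-≤ (seq x n)
    (subst (ℚ._≤ seq y n) (ℚ.+-identityˡ δ) (a n hn))

  difference-pos : ∀ {x y} → y <ℝ x → 0ℝ <ℝ x -ℝ y
  difference-pos {x} {y} (mk< δ 0<δ M a) = mk< δ 0<δ M λ n hn →
    subst (ℚ._≤ seq x n ℚ.- seq y n)
      (solve 2 (λ y d → y :+ d :- y := con 0ℚ :+ d) refl (seq y n) δ)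
      (ℚ.+-monoˡ-≤ (ℚ.- seq y n) (a n hn))

  ≤-<-trans : ∀ {x y z} → x ≤ℝ y → y <ℝ z → x <ℝ z
  ≤-<-trans {x} {y} {z} x≤y y<z = <-≤-trans
    {y = x +ℝ (z -ℝ y)}
    (+-pos-≤ {x} {z -ℝ y} (difference-pos y<z))
    (≤-trans (+-mono-≤ x≤y (≤-refl {z -ℝ y}))
      (≃⇒≤ (pointwise λ n → solve 2 (λ y z → y :+ (z :- y) := z) refl (seq y n) (seq z n))))

  *-pos-< : ∀ {x y} → 0ℝ <ℝ x → 0ℝ <ℝ y → 0ℝ <ℝ x *ℝ y
  *-pos-< {x} {y} (mk< δ 0<δ M a) (mk< η 0<η N b) =
    let (K , c) = zipE
          (λ n p q → subst (ℚ._≤ seq x n ℚ.* seq y n) (sym (ℚ.+-identityˡ (δ ℚ.* η)))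
            (*-mono-≤ {δ} {seq x n} {η} {seq y n} (ℚ.<⇒≤ 0<η)
              (ℚ.≤-trans (ℚ.<⇒≤ 0<δ) (subst (ℚ._≤ seq x n) (ℚ.+-identityˡ δ) p))
              (subst (ℚ._≤ seq x n) (ℚ.+-identityˡ δ) p)
              (subst (ℚ._≤ seq y n) (ℚ.+-identityˡ η) q)))
          (M , a) (N , b)
    in mk< (δ ℚ.* η) (*-pos 0<δ 0<η) K c

  <⇒≤ : ∀ {x y} → x <ℝ y → x ≤ℝ y
  <⇒≤ {x} {y} (mk< δ 0<δ M a) = mk≤ λ ε 0<ε → M , λ n hn →
    ℚ.≤-trans (ℚ.≤-trans (p≤p+e (seq x n) (ℚ.<⇒≤ 0<δ)) (a n hn)) (p≤p+e (seq y n) (ℚ.<⇒≤ 0<ε))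

  -- Positivity carries a rational gap, which cannot be read off from `x ≄ 0`. The doubly negated
  -- form suffices wherever the goal is itself a negation.
  0≤x∧x≄0⇒¬¬0<x : ∀ {x} → 0ℝ ≤ℝ x → ¬ (x ≃ℝ 0ℝ) → ¬ ¬ (0ℝ <ℝ x)
  0≤x∧x≄0⇒¬¬0<x 0≤x x≄0 h = x≄0 (≤-antisym (≮⇒≥ h) 0≤x)

  *-zeroˡ : ∀ {x} y → x ≃ℝ 0ℝ → x *ℝ y ≃ℝ 0ℝ
  *-zeroˡ y x≃0 = ≃-trans (*-congʳ y x≃0) (CommutativeRing.zeroˡ ℝ-commutativeRing y)

  *-zeroʳ : ∀ x {y} → y ≃ℝ 0ℝ → x *ℝ y ≃ℝ 0ℝ
  *-zeroʳ x {y} y≃0 = ≃-trans (*-comm x y) (*-zeroˡ x y≃0)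

  -- Signs cannot be decided, so a negative product is refuted instead: it excludes that either
  -- factor is zero, hence both are positive up to double negation, and then so is the product.
  *-nonNeg : ∀ {x y} → 0ℝ ≤ℝ x → 0ℝ ≤ℝ y → 0ℝ ≤ℝ x *ℝ y
  *-nonNeg {x} {y} 0≤x 0≤y = ≮⇒≥ λ xy<0 →
    0≤x∧x≄0⇒¬¬0<x 0≤x (λ x≃0 → <⇒≱ xy<0 (≃⇒≤ (≃-sym (*-zeroˡ y x≃0)))) λ 0<x →
    0≤x∧x≄0⇒¬¬0<x 0≤y (λ y≃0 → <⇒≱ xy<0 (≃⇒≤ (≃-sym (*-zeroʳ x y≃0)))) λ 0<y →
    <⇒≱ xy<0 (<⇒≤ (*-pos-< 0<x 0<y))

  *-monoʳ-≤ : ∀ {x y} z → 0ℝ ≤ℝ z → x ≤ℝ y → x *ℝ z ≤ℝ y *ℝ z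
  *-monoʳ-≤ {x} {y} z 0≤z x≤y = ≤-trans
    (≃⇒≤ (pointwise λ n → solve 2 (λ x z → x :* z := con 0ℚ :+ x :* z) refl (seq x n) (seq z n)))
    (≤-trans (+-mono-≤ (*-nonNeg {y -ℝ x} {z} 0≤y-x 0≤z) (≤-refl {x *ℝ z}))
    (≃⇒≤ (pointwise λ n → solve 3 (λ x y z → (y :- x) :* z :+ x :* z := y :* z) refl (seq x n) (seq y n)
        (seq z n))))
    where
    0≤y-x : 0ℝ ≤ℝ y -ℝ x
    0≤y-x = ≤-trans (≃⇒≤ (≃-sym (CommutativeRing.-‿inverseʳ ℝ-commutativeRing x))) (+-mono-≤ x≤y (≤-refl { -ℝ x}))

  *-mono-≤ℝ : ∀ {x y u v} → 0ℝ ≤ℝ u → 0ℝ ≤ℝ y → x ≤ℝ y → u ≤ℝ v → x *ℝ u ≤ℝ y *ℝ v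
  *-mono-≤ℝ {x} {y} {u} {v} 0≤u 0≤y x≤y u≤v = ≤-trans (*-monoʳ-≤ u 0≤u x≤y)
    (≤-trans (≃⇒≤ (*-comm y u)) (≤-trans (*-monoʳ-≤ y 0≤y u≤v) (≃⇒≤ (*-comm v y))))

  *-cancelʳ-≃0 : ∀ {x y} → 0ℝ ≤ℝ x → 0ℝ ≤ℝ y → ¬ (y ≃ℝ 0ℝ) → x *ℝ y ≃ℝ 0ℝ → x ≃ℝ 0ℝ
  *-cancelʳ-≃0 0≤x 0≤y y≄0 xy≃0 = ≤-antisym
    (≮⇒≥ λ 0<x → 0≤x∧x≄0⇒¬¬0<x 0≤y y≄0 λ 0<y → <⇒≱ (*-pos-< 0<x 0<y) (≃⇒≤ xy≃0)) 0≤x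

  -- If `y < x`, then `x - y` and `x + y = (x - y) + 2 y` are positive, hence also `x² - y²`.
  -- Comparisons with `∣_∣ℂ` are reduced to squares in this way.
  x²≤y²⇒x≤y : ∀ {x y} → 0ℝ ≤ℝ y → x *ℝ x ≤ℝ y *ℝ y → x ≤ℝ y
  x²≤y²⇒x≤y {x} {y} 0≤y x²≤y² = ≮⇒≥ λ y<x →
    let 0<x-y = difference-pos y<x
        0<x+y = <-≤-trans 0<x-y (≤-trans
          (≃⇒≤ (pointwise λ n → solve 2 (λ x y → x :- y := x :- y :+ (con 0ℚ :+ con 0ℚ)) refl (seq x n) (seq y n)))
          (≤-trans (+-mono-≤ (≤-refl {x -ℝ y}) (+-mono-≤ 0≤y 0≤y))
          (≃⇒≤ (pointwise {y = x +ℝ y} λ n → solve 2 (λ x y → x :- y :+ (y :+ y) := x :+ y) refl (seq x n)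
              (seq y n)))))
    in <⇒≱ (*-pos-< 0<x-y 0<x+y) (≤-trans
         (≃⇒≤ (pointwise {y = x *ℝ x +ℝ -ℝ (y *ℝ y)} λ n →
             solve 2 (λ x y → (x :- y) :* (x :+ y) := x :* x :- y :* y) refl (seq x n) (seq y n)))
         (≤-trans (+-mono-≤ x²≤y² (≤-refl { -ℝ (y *ℝ y)}))
             (≃⇒≤ (CommutativeRing.-‿inverseʳ ℝ-commutativeRing (y *ℝ y)))))

  square-nonNeg : ∀ x → 0ℝ ≤ℝ x *ℝ x
  square-nonNeg x = mk≤ λ ε 0<ε → always λ n → ℚ.≤-trans
    (subst (0ℚ ℚ.≤_) (trans (ℚ.∣p*q∣≡∣p∣*∣q∣ (seq x n) (seq x n) ) (lemma (seq x n)))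
        (ℚ.0≤∣p∣ (seq x n ℚ.* seq x n)))
    (p≤p+e (seq x n ℚ.* seq x n) (ℚ.<⇒≤ 0<ε))
    where
    lemma : ∀ p → ℚ.∣ p ∣ ℚ.* ℚ.∣ p ∣ ≡ p ℚ.* p
    lemma p with ℚ.∣p∣≡p∨∣p∣≡-p p
    ... | inj₁ eq = cong₂ ℚ._*_ eq eq
    ... | inj₂ eq = trans (cong₂ ℚ._*_ eq eq) (solve 1 (λ p → (:- p) :* (:- p) := p :* p) refl p)

  x²+y²≃0⇒x≃0 : ∀ {x y} → x *ℝ x +ℝ y *ℝ y ≃ℝ 0ℝ → x ≃ℝ 0ℝ
  x²+y²≃0⇒x≃0 {x} {y} eq = ≤-antisym
    (x²≤y²⇒x≤y ≤-refl x²≤0)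
    (≤-trans (≃⇒≤ (pointwise λ n → refl)) (≤-trans (neg-mono-≤ -x≤0)
        (≃⇒≤ (pointwise λ n → solve 1 (λ x → :- (:- x) := x) refl (seq x n)))))
    where
    x²≤0 : x *ℝ x ≤ℝ 0ℝ *ℝ 0ℝ
    x²≤0 = ≤-trans (≃⇒≤ (≃-sym (CommutativeRing.+-identityʳ ℝ-commutativeRing (x *ℝ x))))
      (≤-trans (+-mono-≤ (≤-refl {x *ℝ x}) (square-nonNeg y)) (≤-trans (≃⇒≤ eq) (≃⇒≤ (pointwise λ n → refl))))
    -x≤0 : -ℝ x ≤ℝ 0ℝ
    -x≤0 = x²≤y²⇒x≤y ≤-refl (≤-trans (≃⇒≤ (pointwise λ n → solve 1 (λ p → (:- p) :* (:- p) := p :* p) refl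
        (seq x n))) x²≤0)

  ∣x∣≤y : ∀ {x y} → x ≤ℝ y → -ℝ x ≤ℝ y → ∣ x ∣ℝ ≤ℝ y
  ∣x∣≤y {x} {y} (mk≤ a) (mk≤ b) = mk≤ λ ε 0<ε → zipE (λ n → lemma (seq x n) (seq y n ℚ.+ ε)) (a ε 0<ε) (b ε 0<ε)
    where
    lemma : ∀ p q → p ℚ.≤ q → ℚ.- p ℚ.≤ q → ℚ.∣ p ∣ ℚ.≤ q
    lemma p q h k with ℚ.∣p∣≡p∨∣p∣≡-p p
    ... | inj₁ eq = subst (ℚ._≤ q) (sym eq) h
    ... | inj₂ eq = subst (ℚ._≤ q) (sym eq) k

  √-nonNeg : ∀ x → 0ℝ ≤ℝ √ x
  √-nonNeg x = mk≤ λ ε 0<ε → always λ n →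
    ℚ.≤-trans (sqrtℚ-nonNeg n (seq x n ℚ.⊔ 0ℚ)) (p≤p+e (seq (√ x) n) (ℚ.<⇒≤ 0<ε))

  √-square : ∀ {x} → 0ℝ ≤ℝ x → √ x *ℝ √ x ≃ℝ x
  √-square {x} (mk≤ 0≤x) = mk≃ λ ε 0<ε →
    let (B , 0<B , bounded)  = cauchy-bounded {seq (√ x)} (cauchy (√ x))
        -- `(s + g)² - s² = g (2 s + g)` is at most `g (2 B + 1)` once `s ≤ B` and `g ≤ 1`, so `g`
        -- has to fall below `ε / (2 B + 1)`.
        0<A = +-pos (+-pos 0<B 0<B) (ℚ.positive⁻¹ 1ℚ)
        (i , 0<i , i*A≡1) = 1/-positive 0<A
    in zipE {Q = λ n → (s n ℚ.≤ B × + 1 ℚ./ suc n ℚ.≤ 1ℚ) × + 1 ℚ./ suc n ℚ.≤ ε ℚ.* i}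
      (λ n p≤ (( s≤B , g≤1) , g≤εi) → ∣p-q∣≤e {s n ℚ.* s n} {seq x n} {ε}
        (ℚ.≤-trans (sqrtℚ-lower n (seq x n ℚ.⊔ 0ℚ) (ℚ.p≤q⊔p (seq x n) 0ℚ))
            (ℚ.⊔-lub (p≤p+e (seq x n) (ℚ.<⇒≤ 0<ε)) p≤))
        (let g = + 1 ℚ./ suc n in begin
          seq x n
            ≤⟨ ℚ.p≤p⊔q (seq x n) 0ℚ ⟩
          seq x n ℚ.⊔ 0ℚ
            ≤⟨ ℚ.<⇒≤ (sqrtℚ-upper n (seq x n ℚ.⊔ 0ℚ)) ⟩
          (s n ℚ.+ g) ℚ.* (s n ℚ.+ g)
            ≡⟨ solve 2 (λ s g → (s :+ g) :* (s :+ g) := s :* s :+ g :* (s :+ s :+ g)) refl (s n) g ⟩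
          s n ℚ.* s n ℚ.+ g ℚ.* (s n ℚ.+ s n ℚ.+ g)
            ≤⟨ ℚ.+-monoʳ-≤ (s n ℚ.* s n)
                (*-mono-≤ {g} {ε ℚ.* i} {s n ℚ.+ s n ℚ.+ g} {B ℚ.+ B ℚ.+ 1ℚ}
                  (ℚ.+-mono-≤ (ℚ.+-mono-≤ (0≤s n) (0≤s n)) (/-nonNeg n 1))
                  (ℚ.<⇒≤ (*-pos 0<ε 0<i)) g≤εi (ℚ.+-mono-≤ (ℚ.+-mono-≤ s≤B s≤B) g≤1)) ⟩
          s n ℚ.* s n ℚ.+ ε ℚ.* i ℚ.* (B ℚ.+ B ℚ.+ 1ℚ)
            ≡⟨ cong (s n ℚ.* s n ℚ.+_) (trans (ℚ.*-assoc ε i _) (trans (cong (ε ℚ.*_) i*A≡1) (ℚ.*-identityʳ ε))) ⟩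
          s n ℚ.* s n ℚ.+ ε ∎))
      (0≤x ε 0<ε)
      (zipE (λ n a b → a , b)
        (zipE (λ n a b → ℚ.≤-trans (p≤∣p∣ (s n)) a , b) bounded (1/-small 1ℚ (ℚ.positive⁻¹ 1ℚ)))
        (1/-small (ε ℚ.* i) (*-pos 0<ε 0<i)))
    where
    open ℚ.≤-Reasoning
    s : ℕ → ℚ
    s n = seq (√ x) n
    0≤s : ∀ n → 0ℚ ℚ.≤ s n
    0≤s n = sqrtℚ-nonNeg n (seq x n ℚ.⊔ 0ℚ)

  1/-inverseˡ : ∀ x → (1/ℝ x) *ℝ value x ≃ℝ 1ℝ
  1/-inverseˡ (x ,⁺ mk< δ 0<δ M a) = mk≃ λ ε 0<ε → M , λ n hn →
    ℚ.≤-trans (ℚ.≤-reflexive (trans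
      (cong (λ r → ℚ.∣ r ℚ.- 1ℚ ∣) (trans
        (cong (recip (seq x n) ℚ.*_) (sym (ℚ.p≥q⇒p⊔q≡p (subst (ℚ._≤ seq x n) (ℚ.+-identityˡ δ) (a n hn)))))
        (recip-inv (seq x n))))
      refl)) (ℚ.<⇒≤ 0<ε)
    where open Reciprocal 0<δ

  1/-nonNeg : ∀ x → 0ℝ ≤ℝ 1/ℝ x
  1/-nonNeg (x ,⁺ mk< δ 0<δ M a) = mk≤ λ ε 0<ε → always λ n →
    ℚ.≤-trans (recip-nonNeg (seq x n)) (p≤p+e _ (ℚ.<⇒≤ 0<ε))
    where open Reciprocal 0<δ

  1/-pos : ∀ x → 0ℝ <ℝ 1/ℝ x
  1/-pos y@(x ,⁺ mk< δ 0<δ M a) =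
    let (B , 0<B , N , bounded)  = cauchy-bounded {seq x} (cauchy x)
        -- `B + δ` dominates `x n` and `δ` together, hence the truncated denominator, so its inverse
        -- `i` is a gap that works for all large `n`.
        0<C = +-pos 0<B 0<δ
        (i , 0<i , i*C≡1) = 1/-positive 0<C
    in mk< i 0<i N λ n hn → begin
      0ℚ ℚ.+ i
        ≡⟨ trans (ℚ.+-identityˡ i) (sym (ℚ.*-identityˡ i)) ⟩
      1ℚ ℚ.* i
        ≡⟨ cong (ℚ._* i) (recip-inv (seq x n)) ⟨
      recip (seq x n) ℚ.* (seq x n ℚ.⊔ δ) ℚ.* i
        ≤⟨ ℚ.*-monoʳ-≤-nonNeg i {{ℚ.nonNegative (ℚ.<⇒≤ 0<i)}}
            (ℚ.*-monoˡ-≤-nonNeg (recip (seq x n)) {{ℚ.nonNegative (recip-nonNeg (seq x n))}}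
            (ℚ.⊔-lub (ℚ.≤-trans (p≤∣p∣ (seq x n)) (ℚ.≤-trans (bounded n hn) (p≤p+e B (ℚ.<⇒≤ 0<δ))))
               (subst (ℚ._≤ B ℚ.+ δ) (ℚ.+-identityˡ δ) (ℚ.+-monoˡ-≤ δ (ℚ.<⇒≤ 0<B))))) ⟩
      recip (seq x n) ℚ.* (B ℚ.+ δ) ℚ.* i
        ≡⟨ trans (ℚ.*-assoc (recip (seq x n)) (B ℚ.+ δ) i)
            (trans (cong (recip (seq x n) ℚ.*_) (trans (ℚ.*-comm (B ℚ.+ δ) i) i*C≡1)) (ℚ.*-identityʳ _)) ⟩
      recip (seq x n) ∎
    where
    open Reciprocal 0<δ
    open ℚ.≤-Reasoning

-- Finite sums and products in a commutative semiring.

module FiniteSums {c ℓ} (R : CommutativeSemiring c ℓ) where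
  open CommutativeSemiring R renaming (sym to ≈-sym; trans to ≈-trans; refl to ≈-refl)
  open SetoidReasoning setoid
  open MonoidSum +-commutativeMonoid public
    using (sum; sum-cong-≋; ∑-distrib-+; ∑-comm; sum-permute; sum-replicate-zero)
  open SemiringSum semiring public using (*-distribˡ-sum; *-distribʳ-sum)
  open MonoidSum *-commutativeMonoid public using () renaming
    (sum to prod; sum-cong-≋ to prod-cong-≋; ∑-distrib-+ to prod-distrib-*)
  open Mult semiring using () renaming (_×_ to _×ₛ_; ×1-homo-* to ×ₛ1-homo-*; ×-homo-+ to ×ₛ-homo-+)

  ι : ℕ → Carrier
  ι n = n ×ₛ 1#

  ι-+ : ∀ m n → ι (m ℕ.+ n) ≈ ι m + ι n
  ι-+ = ×ₛ-homo-+ 1#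

  ι-* : ∀ m n → ι (m ℕ.* n) ≈ ι m * ι n
  ι-* = ×ₛ1-homo-*

  ι-cong : ∀ {m n} → m ≡ n → ι m ≈ ι n
  ι-cong refl = ≈-refl

  ι-1 : ι 1 ≈ 1#
  ι-1 = +-identityʳ 1#

  sum-const : ∀ n x → sum {n} (λ _ → x) ≈ ι n * x
  sum-const zero    x = ≈-sym (zeroˡ x)
  sum-const (suc n) x = begin
    x + sum {n} (λ _ → x)    ≈⟨ +-cong (≈-sym (*-identityˡ x)) (sum-const n x) ⟩
    1# * x + ι n * x         ≈⟨ distribʳ x 1# (ι n) ⟨
    ι (suc n) * x            ∎

  sum-zero : ∀ n → sum {n} (λ _ → 0#) ≈ 0#
  sum-zero n = sum-replicate-zero n

  sum-split : ∀ m {n} (f : Fin (m ℕ.+ n) → Carrier) →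
    sum f ≈ sum (λ i → f (i ↑ˡ n)) + sum (λ j → f (m ↑ʳ j))
  sum-split zero    f = ≈-sym (+-identityˡ _)
  sum-split (suc m) f = ≈-trans (+-congˡ (sum-split m (f ∘ Fin.suc))) (≈-sym (+-assoc _ _ _))

  sum-combine : ∀ m {n} (f : Fin (m ℕ.* n) → Carrier) →
    sum f ≈ sum (λ (i : Fin m) → sum (λ (j : Fin n) → f (combine i j)))
  sum-combine zero        f = ≈-refl
  sum-combine (suc m) {n} f = ≈-trans (sum-split n f) (+-congˡ (sum-combine m (f ∘ (n ↑ʳ_))))

  -- Distributivity, with choice functions coded by numbers below `q ^ N`. It expresses independence
  -- of the coordinates: the sum of a coordinatewise product over all vectors factors.
  prod-of-sums : ∀ {q} N (g : Fin N → Fin q → Carrier) →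
    prod (λ i → sum (g i)) ≈ sum (λ (t : Fin (q ℕ.^ N)) → prod (λ i → g i (finToFun t i)))
  prod-of-sums         zero    g = ≈-sym (+-identityʳ 1#)
  prod-of-sums {q} (suc N) g = begin
    sum (g Fin.zero) * prod (λ i → sum (g (Fin.suc i)))
      ≈⟨ *-congˡ (prod-of-sums N (g ∘ Fin.suc)) ⟩
    sum (g Fin.zero) * sum (λ (t : Fin (q ℕ.^ N)) → P t)
      ≈⟨ *-distribʳ-sum (sum P) (g Fin.zero) ⟩
    sum (λ z → g Fin.zero z * sum P)
      ≈⟨ sum-cong-≋ (λ z → *-distribˡ-sum (g Fin.zero z) P) ⟩
    sum (λ z → sum (λ t → g Fin.zero z * P t))
      ≈⟨ sum-cong-≋ (λ z → sum-cong-≋ (λ t → split z t)) ⟨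
    sum (λ (z : Fin q) → sum (λ (t : Fin (q ℕ.^ N)) → Q (combine z t)))
      ≈⟨ sum-combine q {q ℕ.^ N} Q ⟨
    sum Q ∎
    where
    P : Fin (q ℕ.^ N) → Carrier
    P t = prod (λ i → g (Fin.suc i) (finToFun t i))
    Q : Fin (q ℕ.^ suc N) → Carrier
    Q t = prod (λ i → g i (finToFun t i))
    split : ∀ z t → Q (combine z t) ≈ g Fin.zero z * P t
    split z t = reflexive (cong
      (λ (z , t) → g Fin.zero z * prod (λ i → g (Fin.suc i) (finToFun t i)))
      (Fin.remQuot-combine z t))

  sum-ι : ∀ {n} (f : Fin n → ℕ) → ι (MonoidSum.sum ℕ.+-0-commutativeMonoid f) ≈ sum (ι ∘ f)
  sum-ι {zero}  f = ≈-refl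
  sum-ι {suc n} f = ≈-trans (ι-+ (f Fin.zero) _) (+-congˡ (sum-ι (f ∘ Fin.suc)))

  prod-one : ∀ {n} (f : Fin n → Carrier) → (∀ i → f i ≈ 1#) → prod f ≈ 1#
  prod-one {zero}  f h = ≈-refl
  prod-one {suc n} f h = ≈-trans (*-cong (h Fin.zero) (prod-one (f ∘ Fin.suc) (h ∘ Fin.suc))) (*-identityˡ 1#)

  prod-zero : ∀ {n} (f : Fin n → Carrier) i → f i ≈ 0# → prod f ≈ 0#
  prod-zero {suc n} f Fin.zero    h = ≈-trans (*-congʳ h) (zeroˡ _)
  prod-zero {suc n} f (Fin.suc i) h = ≈-trans (*-congˡ (prod-zero (f ∘ Fin.suc) i h)) (zeroʳ _)

  prod-const : ∀ n m → prod {n} (λ _ → ι m) ≈ ι (m ℕ.^ n)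
  prod-const zero    m = ≈-sym ι-1
  prod-const (suc n) m = ≈-trans (*-congˡ (prod-const n m)) (≈-sym (ι-* m (m ℕ.^ n)))

-- The complex numbers and their squared norm.

module Complex where
  open Real
  open ℚ-Solver using (solve; _:+_; _:*_; :-_; _:-_; _:=_; con)

  ℂ-commutativeRing : CommutativeRing 0ℓ 0ℓ
  ℂ-commutativeRing = record
    { Carrier = ℂ ; _≈_ = _≃ℂ_ ; _+_ = C._+_ ; _*_ = C._*_ ; -_ = C.-_ ; 0# = C.0# ; 1# = C.1#
    ; isCommutativeRing = record
      { isRing = record
        { +-isAbelianGroup = record
          { isGroup = record
            { isMonoid = record
              { isSemigroup = record
                { isMagma = record
                  { isEquivalence = record
                    { refl  = ≃-refl , ≃-refl
                    ; sym   = λ (p , q) → ≃-sym p , ≃-sym q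
                    ; trans = λ (p , q) (r , s) → ≃-trans p r , ≃-trans q s }
                  ; ∙-cong = λ (p , q) (r , s) → +-cong p r , +-cong q s
                  }
                ; assoc = λ x y z → R.+-assoc (re x) (re y) (re z) , R.+-assoc (im x) (im y) (im z)
                }
              ; identity = (λ x → R.+-identityˡ (re x) , R.+-identityˡ (im x))
                         , (λ x → R.+-identityʳ (re x) , R.+-identityʳ (im x))
              }
            ; inverse = (λ x → R.-‿inverseˡ (re x) , R.-‿inverseˡ (im x))
                      , (λ x → R.-‿inverseʳ (re x) , R.-‿inverseʳ (im x))
            ; ⁻¹-cong = λ (p , q) → neg-cong p , neg-cong q
            }
          ; comm = λ x y → R.+-comm (re x) (re y) , R.+-comm (im x) (im y)
          }
        ; *-cong = λ (p , q) (r , s) →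
            +-cong (*-cong p r) (neg-cong (*-cong q s)) , +-cong (*-cong p s) (*-cong q r)
        ; *-assoc = λ x y z →
            (pointwise λ n → solve 6 (λ a b c d e f →
                (a :* c :- b :* d) :* e :- (a :* d :+ b :* c) :* f
                  := a :* (c :* e :- d :* f) :- b :* (c :* f :+ d :* e)) refl
              (seq (re x) n) (seq (im x) n) (seq (re y) n) (seq (im y) n) (seq (re z) n) (seq (im z) n))
          , (pointwise λ n → solve 6 (λ a b c d e f →
                (a :* c :- b :* d) :* f :+ (a :* d :+ b :* c) :* e
                  := a :* (c :* f :+ d :* e) :+ b :* (c :* e :- d :* f)) refl
              (seq (re x) n) (seq (im x) n) (seq (re y) n) (seq (im y) n) (seq (re z) n) (seq (im z) n))
        ; *-identity = one , λ x → ≃ℂ-trans (*ℂ-comm x C.1#) (one x)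
        ; distrib = dist , λ x y z → ≃ℂ-trans (*ℂ-comm (y C.+ z) x)
            (≃ℂ-trans (dist x y z) (+ℂ-cong (*ℂ-comm x y) (*ℂ-comm x z)))
        }
      ; *-comm = *ℂ-comm
      }
    }
    where
    module C = RawRing ℂ-rawRing
    module R = CommutativeRing ℝ-commutativeRing
    ≃ℂ-trans : ∀ {x y z} → x ≃ℂ y → y ≃ℂ z → x ≃ℂ z
    ≃ℂ-trans (p , q) (r , s) = ≃-trans p r , ≃-trans q s
    +ℂ-cong : ∀ {x y u v} → x ≃ℂ y → u ≃ℂ v → (x C.+ u) ≃ℂ (y C.+ v)
    +ℂ-cong (p , q) (r , s) = +-cong p r , +-cong q s
    *ℂ-comm : ∀ x y → (x C.* y) ≃ℂ (y C.* x)
    *ℂ-comm x y =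
        (pointwise λ n → solve 4 (λ a b c d → a :* c :- b :* d := c :* a :- d :* b) refl
          (seq (re x) n) (seq (im x) n) (seq (re y) n) (seq (im y) n))
      , (pointwise λ n → solve 4 (λ a b c d → a :* d :+ b :* c := c :* b :+ d :* a) refl
          (seq (re x) n) (seq (im x) n) (seq (re y) n) (seq (im y) n))
    one : ∀ x → (C.1# C.* x) ≃ℂ x
    one x =
        (pointwise λ n → solve 2 (λ a b → con 1ℚ :* a :- con 0ℚ :* b := a) refl
          (seq (re x) n) (seq (im x) n))
      , (pointwise λ n → solve 2 (λ a b → con 1ℚ :* b :+ con 0ℚ :* a := b) refl
          (seq (re x) n) (seq (im x) n))
    dist : ∀ x y z → (x C.* (y C.+ z)) ≃ℂ ((x C.* y) C.+ (x C.* z))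
    dist x y z =
        (pointwise λ n → solve 6 (λ a b c d e f →
            a :* (c :+ e) :- b :* (d :+ f) := (a :* c :- b :* d) :+ (a :* e :- b :* f)) refl
          (seq (re x) n) (seq (im x) n) (seq (re y) n) (seq (im y) n) (seq (re z) n) (seq (im z) n))
      , (pointwise λ n → solve 6 (λ a b c d e f →
            a :* (d :+ f) :+ b :* (c :+ e) := (a :* d :+ b :* c) :+ (a :* f :+ b :* e)) refl
          (seq (re x) n) (seq (im x) n) (seq (re y) n) (seq (im y) n) (seq (re z) n) (seq (im z) n))

  normSq : ℂ → ℝ
  normSq z = re z *ℝ re z +ℝ im z *ℝ im z

  normSq-* : ∀ z w → normSq (z *ℂ w) ≃ℝ normSq z *ℝ normSq w
  normSq-* z w = pointwise λ n → solve 4 (λ a b c d →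
      (a :* c :- b :* d) :* (a :* c :- b :* d) :+ (a :* d :+ b :* c) :* (a :* d :+ b :* c)
        := (a :* a :+ b :* b) :* (c :* c :+ d :* d)) refl
    (seq (re z) n) (seq (im z) n) (seq (re w) n) (seq (im w) n)

  normSq-nonNeg : ∀ z → 0ℝ ≤ℝ normSq z
  normSq-nonNeg z = ≤-trans (≃⇒≤ (pointwise λ n → refl)) (+-mono-≤ (square-nonNeg (re z)) (square-nonNeg (im z)))

  normSq≃0⇒≃0 : ∀ {z} → normSq z ≃ℝ 0ℝ → z ≃ℂ fromℝ 0ℝ
  normSq≃0⇒≃0 {z} h = x²+y²≃0⇒x≃0 h
    , x²+y²≃0⇒x≃0 (≃-trans (CommutativeRing.+-comm ℝ-commutativeRing (im z *ℝ im z) (re z *ℝ re z)) h)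

  normSq-cong : ∀ {z w} → z ≃ℂ w → normSq z ≃ℝ normSq w
  normSq-cong (p , q) = +-cong (*-cong p p) (*-cong q q)

  ≃ℂ-stable : ∀ {z w} → ¬ ¬ (z ≃ℂ w) → z ≃ℂ w
  ≃ℂ-stable h = ≃-stable (λ k → h (k ∘ proj₁)) , ≃-stable (λ k → h (k ∘ proj₂))

  *ℂ-cancelʳ-≃0 : ∀ {z w} → z *ℂ w ≃ℂ fromℝ 0ℝ → ¬ (w ≃ℂ fromℝ 0ℝ) → z ≃ℂ fromℝ 0ℝ
  *ℂ-cancelʳ-≃0 {z} {w} zw≃0 w≄0 = normSq≃0⇒≃0 (*-cancelʳ-≃0 (normSq-nonNeg z) (normSq-nonNeg w)
    (λ h → w≄0 (normSq≃0⇒≃0 h))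
    (≃-trans (≃-sym (normSq-* z w)) (≃-trans (normSq-cong zw≃0) (pointwise λ n → refl))))

  re≤∣∣ : ∀ z {r} → 0ℝ ≤ℝ r → normSq z ≤ℝ r *ℝ r → ∣ re z ∣ℝ ≤ℝ r
  re≤∣∣ z {r} 0≤r h = ∣x∣≤y
    (x²≤y²⇒x≤y 0≤r (≤-trans x²≤ h))
    (x²≤y²⇒x≤y 0≤r (≤-trans (≃⇒≤ (pointwise λ n → solve 1 (λ p → (:- p) :* (:- p) := p :* p) refl (seq (re z) n)))
        (≤-trans x²≤ h)))
    where
    x²≤ : re z *ℝ re z ≤ℝ normSq z
    x²≤ = ≤-trans (≃⇒≤ (≃-sym (CommutativeRing.+-identityʳ ℝ-commutativeRing (re z *ℝ re z))))
        (+-mono-≤ ≤-refl (square-nonNeg (im z)))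

-- Counting with decidable predicates.

module Counting where
  private
    variable
      a b : Level
      A : Set a

  open FiniteSums ℕ.+-*-commutativeSemiring public

  ⟦_⟧ : Dec A → ℕ
  ⟦ d ⟧ = if does d then 1 else 0

  ⟦⟧-true : (d : Dec A) → A → ⟦ d ⟧ ≡ 1
  ⟦⟧-true (yes _) _ = refl
  ⟦⟧-true (no ¬x) x = ⊥-elim (¬x x)

  ⟦⟧-false : (d : Dec A) → ¬ A → ⟦ d ⟧ ≡ 0
  ⟦⟧-false (yes x) ¬x = ⊥-elim (¬x x)
  ⟦⟧-false (no _)  _  = refl

  ⟦⟧≤ : ∀ {n} (d : Dec A) → (A → 1 ℕ.≤ n) → ⟦ d ⟧ ℕ.≤ n
  ⟦⟧≤ (yes x) h = h x
  ⟦⟧≤ (no _)  _ = ℕ.z≤n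

  sum-mono-≤ : ∀ {n} {f g : Fin n → ℕ} → (∀ i → f i ℕ.≤ g i) → sum f ℕ.≤ sum g
  sum-mono-≤ {zero}  h = ℕ.z≤n
  sum-mono-≤ {suc n} h = ℕ.+-mono-≤ (h Fin.zero) (sum-mono-≤ (h ∘ Fin.suc))

  term≤sum : ∀ {n} (f : Fin n → ℕ) i → f i ℕ.≤ sum f
  term≤sum f Fin.zero    = ℕ.m≤m+n _ _
  term≤sum f (Fin.suc i) = ℕ.≤-trans (term≤sum (f ∘ Fin.suc) i) (ℕ.m≤n+m _ _)

  count : ∀ {n} {P : Fin n → Set a} → (∀ t → Dec (P t)) → ℕ
  count P? = sum (λ t → ⟦ P? t ⟧)

  count≡0 : ∀ {n} {P : Fin n → Set a} (P? : ∀ t → Dec (P t)) → (∀ t → ¬ P t) → count P? ≡ 0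
  count≡0 {n = zero}  P? h = refl
  count≡0 {n = suc n} P? h = cong₂ ℕ._+_ (⟦⟧-false (P? Fin.zero) (h Fin.zero))
      (count≡0 (P? ∘ Fin.suc) (h ∘ Fin.suc))

  1≤count : ∀ {n} {P : Fin n → Set a} (P? : ∀ t → Dec (P t)) t → P t → 1 ℕ.≤ count P?
  1≤count P? t p = ℕ.≤-trans (ℕ.≤-reflexive (sym (⟦⟧-true (P? t) p))) (term≤sum (λ t → ⟦ P? t ⟧) t)

  count≤1 : ∀ {n} {P : Fin n → Set a} (P? : ∀ t → Dec (P t)) →
            (∀ t u → P t → P u → t ≡ u) → count P? ℕ.≤ 1
  count≤1 {n = zero}  P? h = ℕ.z≤n
  count≤1 {n = suc n} P? h with P? Fin.zero
  ... | yes p = ℕ.s≤s (ℕ.≤-reflexive (count≡0 (P? ∘ Fin.suc) λ t p′ → Fin.0≢1+n (h Fin.zero (Fin.suc t) p p′)))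
  ... | no  _ = count≤1 (P? ∘ Fin.suc) λ t u p p′ → Fin.suc-injective (h (Fin.suc t) (Fin.suc u) p p′)

  -- The related pairs are counted in two ways: every `t` with `P t` lies in at least one of them,
  -- and every `u` in at most `c u`.
  count-fibres : ∀ {r m n} {P : Fin m → Set a} (P? : ∀ t → Dec (P t))
    {R : Fin m → Fin n → Set r} (R? : ∀ t u → Dec (R t u)) (c : Fin n → ℕ) →
    (∀ t → P t → ∃[ u ] R t u) → (∀ u → count (λ t → R? t u) ℕ.≤ c u) → count P? ℕ.≤ sum c
  count-fibres P? R? c cover bound = begin
    sum (λ t → ⟦ P? t ⟧)                      ≤⟨ sum-mono-≤ (λ t → ⟦⟧≤ (P? t) λ p →
                                                  let (u , r) = cover t p in 1≤count (R? t) u r) ⟩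
    sum (λ t → sum (λ u → ⟦ R? t u ⟧))        ≡⟨ ∑-comm (λ t u → ⟦ R? t u ⟧) ⟩
    sum (λ u → sum (λ t → ⟦ R? t u ⟧))        ≤⟨ sum-mono-≤ bound ⟩
    sum c                                     ∎
    where open ℕ.≤-Reasoning

  count-injection : ∀ {m n} {P : Fin m → Set a} (P? : ∀ t → Dec (P t))
    {Q : Fin n → Set b} (Q? : ∀ u → Dec (Q u)) (f : Fin m → Fin n) →
    (∀ t → P t → Q (f t)) → (∀ t t′ → P t → P t′ → f t ≡ f t′ → t ≡ t′) → count P? ℕ.≤ count Q?
  count-injection {P = P} P? {Q} Q? f f-maps f-inj =
    count-fibres P? R? (λ u → ⟦ Q? u ⟧) (λ t p → f t , p , refl) λ u → bound u (Q? u)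
    where
    R? : ∀ t u → Dec (P t × f t ≡ u)
    R? t u = P? t ×-dec (f t Fin.≟ u)
    bound : ∀ u (d : Dec (Q u)) → count (λ t → R? t u) ℕ.≤ ⟦ d ⟧
    bound u (yes _) = count≤1 (λ t → R? t u) λ t t′ (p , eq) (p′ , eq′) → f-inj t t′ p p′ (trans eq (sym eq′))
    bound u (no ¬q) = ℕ.≤-reflexive (count≡0 (λ t → R? t u) λ { t (p , refl) → ¬q (f-maps t p) })

  count-all : ∀ n → sum {n} (λ _ → 1) ≡ n
  count-all n = trans (sum-const n 1) (trans (ℕ.*-identityʳ (ι n)) (ι≡ n))
    where
    ι≡ : ∀ n → ι n ≡ n
    ι≡ zero    = refl
    ι≡ (suc n) = cong suc (ι≡ n)

-- Powers of 1 + 1/R, cleared of denominators.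

bernoulli : ∀ R e → (R ℕ.+ e) ℕ.* R ℕ.^ e ℕ.≤ R ℕ.* suc R ℕ.^ e
bernoulli R zero = ℕ.≤-reflexive (cong (ℕ._* 1) (ℕ.+-identityʳ R))
bernoulli R (suc e) = begin
  (R ℕ.+ suc e) ℕ.* (R ℕ.* R ℕ.^ e)
    ≡⟨ solve 3 (λ R e x → (R :+ (con 1 :+ e)) :* (R :* x) := (R :* R :+ R :+ R :* e) :* x) refl R e (R ℕ.^ e) ⟩
  (R ℕ.* R ℕ.+ R ℕ.+ R ℕ.* e) ℕ.* R ℕ.^ e
    ≤⟨ ℕ.*-monoˡ-≤ (R ℕ.^ e) (ℕ.m≤m+n (R ℕ.* R ℕ.+ R ℕ.+ R ℕ.* e) e) ⟩
  (R ℕ.* R ℕ.+ R ℕ.+ R ℕ.* e ℕ.+ e) ℕ.* R ℕ.^ e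
    ≡⟨ solve 3 (λ R e x → (R :* R :+ R :+ R :* e :+ e) :* x := (con 1 :+ R) :* ((R :+ e) :* x)) refl R e (R ℕ.^ e) ⟩
  suc R ℕ.* ((R ℕ.+ e) ℕ.* R ℕ.^ e)
    ≤⟨ ℕ.*-monoʳ-≤ (suc R) (bernoulli R e) ⟩
  suc R ℕ.* (R ℕ.* suc R ℕ.^ e)
    ≡⟨ solve 2 (λ R x → (con 1 :+ R) :* (R :* x) := R :* ((con 1 :+ R) :* x)) refl R (suc R ℕ.^ e) ⟩
  R ℕ.* (suc R ℕ.* suc R ℕ.^ e) ∎
  where
  open ℕ.≤-Reasoning
  open ℕ-Solver using (solve; con; _:+_; _:*_; _:=_)

1+e≤R[1+1/R]^e : ∀ R .{{_ : ℕ.NonZero R}} e → suc e ℕ.* R ℕ.^ e ℕ.≤ R ℕ.* suc R ℕ.^ e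
1+e≤R[1+1/R]^e R@(suc r) e = ℕ.≤-trans (ℕ.*-monoˡ-≤ (R ℕ.^ e) (ℕ.+-monoˡ-≤ e (ℕ.s≤s (ℕ.z≤n {r})))) (bernoulli R e)

2≤[1+1/R]^e : ∀ R .{{_ : ℕ.NonZero R}} e → R ℕ.≤ e → 2 ℕ.* R ℕ.^ e ℕ.≤ suc R ℕ.^ e
2≤[1+1/R]^e R@(suc _) e R≤e = ℕ.*-cancelˡ-≤ R (ℕ.≤-trans
  (ℕ.≤-reflexive (trans (sym (ℕ.*-assoc R 2 (R ℕ.^ e)))
      (cong (ℕ._* R ℕ.^ e) (trans (ℕ.*-comm R 2) (cong (R ℕ.+_) (ℕ.+-identityʳ R))))))
  (ℕ.≤-trans (ℕ.*-monoˡ-≤ (R ℕ.^ e) (ℕ.+-monoʳ-≤ R R≤e)) (bernoulli R e)))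

-- Polynomials over a finite field: degree, division and Euclid's lemma.

module Polynomials {c ℓ q} (k : FiniteField c ℓ q) where
  open FiniteField k renaming (refl to ≈-refl; sym to ≈-sym; trans to ≈-trans)
  open RingProperties ring using (-0#≈0#)
  open SemigroupProperties +-commutativeSemigroup using () renaming (interchange to +-interchange; x∙yz≈y∙xz to +-x∙yz≈y∙xz)
  module ≈R = SetoidReasoning setoid

  *-integral : ∀ {x y} → ¬ x ≈ 0# → ¬ y ≈ 0# → ¬ x * y ≈ 0#
  *-integral {x} {y} x≉0 y≉0 xy≈0 = y≉0 (begin
    y                ≈⟨ *-identityˡ y ⟨
    1# * y           ≈⟨ *-congʳ (≈-trans (*-comm x⁻¹ x) (proj₂ (inverse x x≉0))) ⟨
    x⁻¹ * x * y      ≈⟨ *-assoc x⁻¹ x y ⟩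
    x⁻¹ * (x * y)    ≈⟨ *-congˡ xy≈0 ⟩
    x⁻¹ * 0#         ≈⟨ zeroʳ x⁻¹ ⟩
    0#               ∎)
    where
    open ≈R
    x⁻¹ = proj₁ (inverse x x≉0)

  Series : Set c
  Series = ℕ → Carrier

  infix 4 _≋_
  infixl 7 _⊛_

  _≋_ : Series → Series → Set ℓ
  f ≋ g = ∀ n → f n ≈ g n

  -- The Cauchy product, from (a + X f′) g = a g + X (f′ g).
  _⊛_ : Series → Series → Series
  (f ⊛ g) zero    = f 0 * g 0
  (f ⊛ g) (suc n) = f 0 * g (suc n) + ((f ∘ suc) ⊛ g) n

  𝟘 𝟙 : Series
  𝟘 n = 0#
  𝟙 zero    = 1#
  𝟙 (suc n) = 0#

  ⊛-cong : ∀ {f f′ g g′} → f ≋ f′ → g ≋ g′ → f ⊛ g ≋ f′ ⊛ g′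
  ⊛-cong h k zero    = *-cong (h 0) (k 0)
  ⊛-cong h k (suc n) = +-cong (*-cong (h 0) (k (suc n))) (⊛-cong (h ∘ suc) k n)

  ⊛-zeroˡ : ∀ g → 𝟘 ⊛ g ≋ 𝟘
  ⊛-zeroˡ g zero    = zeroˡ (g 0)
  ⊛-zeroˡ g (suc n) = ≈-trans (+-cong (zeroˡ (g (suc n))) (⊛-zeroˡ g n)) (+-identityˡ 0#)

  ⊛-distribʳ : ∀ h f g → (λ n → f n + g n) ⊛ h ≋ λ n → (f ⊛ h) n + (g ⊛ h) n
  ⊛-distribʳ h f g zero    = distribʳ (h 0) (f 0) (g 0)
  ⊛-distribʳ h f g (suc n) = ≈-trans
    (+-cong (distribʳ (h (suc n)) (f 0) (g 0)) (⊛-distribʳ h (f ∘ suc) (g ∘ suc) n))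
    (+-interchange _ _ _ _)

  ⊛-scaleˡ : ∀ a f g → (λ n → a * f n) ⊛ g ≋ λ n → a * (f ⊛ g) n
  ⊛-scaleˡ a f g zero    = *-assoc a (f 0) (g 0)
  ⊛-scaleˡ a f g (suc n) = ≈-trans
    (+-cong (*-assoc a (f 0) (g (suc n))) (⊛-scaleˡ a (f ∘ suc) g n))
    (≈-sym (distribˡ a _ _))

  ⊛-sucʳ : ∀ f g n → (f ⊛ g) (suc n) ≈ f (suc n) * g 0 + (f ⊛ (g ∘ suc)) n
  ⊛-sucʳ f g zero    = +-comm (f 0 * g 1) (f 1 * g 0)
  ⊛-sucʳ f g (suc n) = ≈-trans (+-congˡ (⊛-sucʳ (f ∘ suc) g n)) (+-x∙yz≈y∙xz _ _ _)

  ⊛-comm : ∀ f g → f ⊛ g ≋ g ⊛ f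
  ⊛-comm f g zero    = *-comm (f 0) (g 0)
  ⊛-comm f g (suc n) = ≈-trans
    (+-cong (*-comm (f 0) (g (suc n))) (⊛-comm (f ∘ suc) g n))
    (≈-sym (⊛-sucʳ g f n))

  ⊛-assoc : ∀ f g h → (f ⊛ g) ⊛ h ≋ f ⊛ (g ⊛ h)
  ⊛-assoc f g h zero    = *-assoc (f 0) (g 0) (h 0)
  ⊛-assoc f g h (suc n) = begin
    f 0 * g 0 * h (suc n) + (((λ i → f 0 * g (suc i) + (f′ ⊛ g) i)) ⊛ h) n
      ≈⟨ +-cong (*-assoc (f 0) (g 0) (h (suc n))) (⊛-distribʳ h (λ i → f 0 * g (suc i)) (f′ ⊛ g) n) ⟩
    f 0 * (g 0 * h (suc n)) + (((λ i → f 0 * g (suc i)) ⊛ h) n + ((f′ ⊛ g) ⊛ h) n)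
      ≈⟨ +-congˡ (+-cong (⊛-scaleˡ (f 0) (g ∘ suc) h n) (⊛-assoc f′ g h n)) ⟩
    f 0 * (g 0 * h (suc n)) + (f 0 * ((g ∘ suc) ⊛ h) n + (f′ ⊛ (g ⊛ h)) n)
      ≈⟨ +-assoc _ _ _ ⟨
    f 0 * (g 0 * h (suc n)) + f 0 * ((g ∘ suc) ⊛ h) n + (f′ ⊛ (g ⊛ h)) n
      ≈⟨ +-congʳ (distribˡ (f 0) _ _) ⟨
    f 0 * (g 0 * h (suc n) + ((g ∘ suc) ⊛ h) n) + (f′ ⊛ (g ⊛ h)) n ∎
    where
    open ≈R
    f′ = f ∘ suc

  ⊛-identityˡ : ∀ g → 𝟙 ⊛ g ≋ g
  ⊛-identityˡ g zero    = *-identityˡ (g 0)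
  ⊛-identityˡ g (suc n) = ≈-trans (+-cong (*-identityˡ (g (suc n))) (⊛-zeroˡ g n)) (+-identityʳ (g (suc n)))

  Bounded : ℕ → Series → Set ℓ
  Bounded d f = ∀ i → d ℕ.≤ i → f i ≈ 0#

  ⊛-vanish : ∀ {f} g → Bounded 0 f → f ⊛ g ≋ 𝟘
  ⊛-vanish g f≋0 n = ≈-trans (⊛-cong (λ i → f≋0 i ℕ.z≤n) (λ _ → ≈-refl) n) (⊛-zeroˡ g n)

  ⊛-bounded : ∀ d e {f g} → Bounded d f → Bounded e g → Bounded (d ℕ.+ e) (f ⊛ g)
  ⊛-bounded zero    e {g = g} f-b g-b i _ = ⊛-vanish g f-b i
  ⊛-bounded (suc d) e {f} f-b g-b (suc i) (ℕ.s≤s d+e≤i) = ≈-trans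
    (+-cong (≈-trans (*-congˡ (g-b (suc i) (ℕ.≤-trans (ℕ.≤-trans (ℕ.m≤n+m e d) d+e≤i) (ℕ.n≤1+n i)))) (zeroʳ (f 0)))
            (⊛-bounded d e (λ i h → f-b (suc i) (ℕ.s≤s h)) g-b i d+e≤i))
    (+-identityˡ 0#)

  bounded-mono : ∀ {d e f} → d ℕ.≤ e → Bounded d f → Bounded e f
  bounded-mono d≤e b i e≤i = b i (ℕ.≤-trans d≤e e≤i)

  -- `size` is only an upper bound for the degree and is ignored by `_≈ₚ_`, so sums and products
  -- need no normalisation; `degree?` recovers the exact degree from decidable equality in the
  -- field.
  record Polynomial : Set (c ⊔ ℓ) where
    constructor poly
    field
      coeff   : Series
      size    : ℕ
      bounded : Bounded size coeff

  open Polynomial public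

  infix 4 _≈ₚ_

  record _≈ₚ_ (f g : Polynomial) : Set ℓ where
    constructor mk≈
    field at : coeff f ≋ coeff g

  open _≈ₚ_ public

  0ₚ 1ₚ : Polynomial
  0ₚ = poly 𝟘 0 (λ _ _ → ≈-refl)
  1ₚ = poly 𝟙 1 (λ { (suc i) _ → ≈-refl })

  -- Opaque so that unification treats sums and products as neutral.
  opaque
    _+ₚ_ _*ₚ_ : Polynomial → Polynomial → Polynomial
    f +ₚ g = poly (λ n → coeff f n + coeff g n) (size f ℕ.⊔ size g) (λ i h → ≈-trans
      (+-cong (bounded f i (ℕ.m⊔n≤o⇒m≤o (size f) (size g) h)) (bounded g i (ℕ.m⊔n≤o⇒n≤o (size f) (size g) h)))
      (+-identityˡ 0#))
    f *ₚ g = poly (coeff f ⊛ coeff g) (size f ℕ.+ size g) (⊛-bounded (size f) (size g) (bounded f) (bounded g))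

    -ₚ_ : Polynomial → Polynomial
    -ₚ f = poly (λ n → - coeff f n) (size f) (λ i h → ≈-trans (-‿cong (bounded f i h)) -0#≈0#)

    coeff-+ : ∀ f g → coeff (f +ₚ g) ≋ λ n → coeff f n + coeff g n
    coeff-+ f g n = ≈-refl

    coeff-* : ∀ f g → coeff (f *ₚ g) ≋ coeff f ⊛ coeff g
    coeff-* f g n = ≈-refl

    polyRing-isCommutativeRing : IsCommutativeRing _≈ₚ_ _+ₚ_ _*ₚ_ -ₚ_ 0ₚ 1ₚ
    polyRing-isCommutativeRing = record
      { isRing = record
        { +-isAbelianGroup = record
          { isGroup = record
            { isMonoid = record
              { isSemigroup = record
                { isMagma = record
                  { isEquivalence = record
                    { refl  = mk≈ λ _ → ≈-refl
                    ; sym   = λ h → mk≈ λ n → ≈-sym (at h n)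
                    ; trans = λ g h → mk≈ λ n → ≈-trans (at g n) (at h n)
                    }
                  ; ∙-cong = λ g h → mk≈ λ n → +-cong (at g n) (at h n)
                  }
                ; assoc = λ f g h → mk≈ λ n → +-assoc _ _ _
                }
              ; identity = (λ f → mk≈ λ n → +-identityˡ _) , (λ f → mk≈ λ n → +-identityʳ _)
              }
            ; inverse = (λ f → mk≈ λ n → -‿inverseˡ _) , (λ f → mk≈ λ n → -‿inverseʳ _)
            ; ⁻¹-cong = λ h → mk≈ λ n → -‿cong (at h n)
            }
          ; comm = λ f g → mk≈ λ n → +-comm _ _
          }
        ; *-cong = λ g h → mk≈ (⊛-cong (at g) (at h))
        ; *-assoc = λ f g h → mk≈ (⊛-assoc (coeff f) (coeff g) (coeff h))
        ; *-identity = (λ f → mk≈ (⊛-identityˡ (coeff f)))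
                     , (λ f → mk≈ λ n → ≈-trans (⊛-comm (coeff f) 𝟙 n) (⊛-identityˡ (coeff f) n))
        ; distrib = (λ f g h → mk≈ λ n → ≈-trans (⊛-comm (coeff f) _ n)
            (≈-trans (⊛-distribʳ (coeff f) (coeff g) (coeff h) n)
                      (+-cong (⊛-comm (coeff g) (coeff f) n) (⊛-comm (coeff h) (coeff f) n))))
                  , (λ h f g → mk≈ (⊛-distribʳ (coeff h) (coeff f) (coeff g)))
        }
      ; *-comm = λ f g → mk≈ (⊛-comm (coeff f) (coeff g))
      }

  polyRing : CommutativeRing (c ⊔ ℓ) ℓ
  polyRing = record { isCommutativeRing = polyRing-isCommutativeRing }

  module P = CommutativeRing polyRing
  module P*  = SemigroupProperties P.*-commutativeSemigroup
  module PR  = RingProperties P.ring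
  module PG  = GroupProperties P.+-group
  module PA  = AbelianGroupProperties P.+-abelianGroup
  module P≈R = SetoidReasoning P.setoid

  Degree : Series → ℕ → Set ℓ
  Degree f d = ¬ f d ≈ 0# × Bounded (suc d) f

  degree? : ∀ d {f} → Bounded d f → f ≋ 𝟘 ⊎ (∃[ e ] e ℕ.< d × Degree f e)
  degree? zero    b = inj₁ λ i → b i ℕ.z≤n
  degree? (suc d) {f} b with f d ≈? 0#
  ... | no  fd≉0 = inj₂ (d , ℕ.≤-refl , fd≉0 , b)
  ... | yes fd≈0 with degree? d {f} b′
    where
    b′ : Bounded d f
    b′ i d≤i with ℕ.m≤n⇒m<n∨m≡n d≤i
    ... | inj₁ d<i  = b i d<i
    ... | inj₂ refl = fd≈0
  ...   | inj₁ f≋0             = inj₁ f≋0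
  ...   | inj₂ (e , e<d , deg) = inj₂ (e , ℕ.m≤n⇒m≤1+n e<d , deg)

  degree-unique : ∀ {f d e} → Degree f d → Degree f e → d ≡ e
  degree-unique {f} {d} {e} (fd≉0 , bd) (fe≉0 , be) = ℕ.≤-antisym
    (ℕ.≮⇒≥ λ e<d → fd≉0 (be d e<d)) (ℕ.≮⇒≥ λ d<e → fe≉0 (bd e d<e))

  degree-resp : ∀ {f g d} → f ≋ g → Degree f d → Degree g d
  degree-resp f≋g (fd≉0 , b) = (λ gd≈0 → fd≉0 (≈-trans (f≋g _) gd≈0)) , λ i h → ≈-trans (≈-sym (f≋g i)) (b i h)

  ⊛-constant : ∀ {f} g → Bounded 1 f → ∀ n → (f ⊛ g) n ≈ f 0 * g n
  ⊛-constant g b zero    = ≈-refl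
  ⊛-constant g b (suc n) = ≈-trans (+-congˡ (⊛-vanish g (λ i _ → b (suc i) (ℕ.s≤s ℕ.z≤n)) n)) (+-identityʳ _)

  -- The constant coefficient of `f` contributes to `f ⊛ g` only up to index `e`, which is below the
  -- leading index when `f` is nonconstant. It can therefore be split off without touching the
  -- leading coefficient, until `f` is a constant.
  degree-⊛ : ∀ d e {f g} → Degree f d → Degree g e → Degree (f ⊛ g) (d ℕ.+ e)
  degree-⊛ zero e {f} {g} (f0≉0 , f-b) (ge≉0 , g-b) =
      (λ h → *-integral f0≉0 ge≉0 (≈-trans (≈-sym (⊛-constant g f-b e)) h))
    , λ i h → ≈-trans (⊛-constant g f-b i) (≈-trans (*-congˡ (g-b i h)) (zeroʳ (f 0)))
  degree-⊛ (suc d) e {f} {g} (fd≉0 , f-b) (ge≉0 , g-b) =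
      (λ h → proj₁ deg′ (≈-trans (≈-sym (tail (d ℕ.+ e) (ℕ.s≤s (ℕ.m≤n+m e d)))) h))
    , λ { (suc i) (ℕ.s≤s h) → ≈-trans
            (tail i (ℕ.≤-trans (ℕ.s≤s (ℕ.m≤n+m e d)) (ℕ.≤-trans h (ℕ.n≤1+n i)))) (proj₂ deg′ i h) }
    where
    deg′ : Degree ((f ∘ suc) ⊛ g) (d ℕ.+ e)
    deg′ = degree-⊛ d e (fd≉0 , λ i h → f-b (suc i) (ℕ.s≤s h)) (ge≉0 , g-b)
    tail : ∀ i → suc e ℕ.≤ suc i → (f ⊛ g) (suc i) ≈ ((f ∘ suc) ⊛ g) i
    tail i h = ≈-trans (+-congʳ (≈-trans (*-congˡ (g-b (suc i) h)) (zeroʳ (f 0)))) (+-identityˡ _)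

  ⊛-integral : ∀ f g → f P.* g P.≈ P.0# → f P.≈ P.0# ⊎ g P.≈ P.0#
  ⊛-integral f g fg≈0 with degree? (size f) (bounded f) | degree? (size g) (bounded g)
  ... | inj₁ f≈0 | _ = inj₁ (mk≈ f≈0)
  ... | inj₂ _ | inj₁ g≈0 = inj₂ (mk≈ g≈0)
  ... | inj₂ (d , _ , deg-f) | inj₂ (e , _ , deg-g) = ⊥-elim
      (proj₁ (degree-⊛ d e deg-f deg-g) (≈-trans (≈-sym (coeff-* f g (d ℕ.+ e))) (at fg≈0 (d ℕ.+ e))))

  nonzero-degree : ∀ f → ¬ f P.≈ P.0# → ∃[ d ] d ℕ.< size f × Degree (coeff f) d
  nonzero-degree f f≉0 with degree? (size f) (bounded f)
  ... | inj₁ f≈0 = ⊥-elim (f≉0 (mk≈ f≈0))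
  ... | inj₂ deg = deg

  degree⇒≉0 : ∀ {f d} → Degree f d → ¬ f ≋ 𝟘
  degree⇒≉0 (fd≉0 , _) f≋0 = fd≉0 (f≋0 _)

  ⊛-cancelˡ : ∀ p f g → ¬ p P.≈ P.0# → p P.* f P.≈ p P.* g → f P.≈ g
  ⊛-cancelˡ p f g p≉0 pf≈pg with ⊛-integral p (f P.- g) (P.trans
      (P.trans (P.distribˡ p f (P.- g)) (P.+-congˡ (P.sym (PR.-‿distribʳ-* p g))))
      (P.trans (P.+-congʳ pf≈pg) (P.-‿inverseʳ (p P.* g))))
  ... | inj₁ p≈0 = ⊥-elim (p≉0 p≈0)
  ... | inj₂ f-g≈0 = PG.x∙y⁻¹≈ε⇒x≈y f g f-g≈0

  cons : Carrier → Series → Series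
  cons a f zero    = a
  cons a f (suc n) = f n

  cons-bounded : ∀ {d f} a → Bounded d f → Bounded (suc d) (cons a f)
  cons-bounded a b (suc i) (ℕ.s≤s h) = b i h

  -- Long division: dividing f′ by g gives f′ = s g + r, hence
  -- a + X f′ = (X s) g + (a + X r), and one more subtraction of a
  -- multiple of g lowers the degree of a + X r.
  division : ∀ {d g} → Degree g d → ∀ n {f} → Bounded n f →
    ∃[ s ] ∃[ r ] Bounded n s × Bounded d r × (f ≋ λ i → (s ⊛ g) i + r i)
  division {d} {g} deg-g zero {f} b = 𝟘 , 𝟘 , (λ _ _ → ≈-refl) , (λ _ _ → ≈-refl)
    , λ i → ≈-trans (b i ℕ.z≤n) (≈-sym (≈-trans (+-identityʳ _) (⊛-zeroˡ g i)))
  division {d} {g} deg-g@(gd≉0 , g-b) (suc n) {f} b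
    with division deg-g n {f ∘ suc} (λ i h → b (suc i) (ℕ.s≤s h))
  ... | s , r , s-b , r-b , eq = cons t s , (λ i → u i - t * g i) , cons-bounded t s-b , r′-b , eq′
    where
    open ≈R
    u = cons (f 0) r
    t = u d * proj₁ (inverse (g d) gd≉0)
    r′-b : Bounded d (λ i → u i - t * g i)
    r′-b i d≤i with ℕ.m≤n⇒m<n∨m≡n d≤i
    ... | inj₁ d<i = begin
      u i - t * g i    ≈⟨ +-cong (cons-bounded (f 0) r-b i d<i) (-‿cong (*-congˡ (g-b i d<i))) ⟩
      0# - t * 0#      ≈⟨ +-congˡ (-‿cong (zeroʳ t)) ⟩
      0# - 0#          ≈⟨ -‿inverseʳ 0# ⟩
      0#               ∎
    ... | inj₂ refl = begin
      u d - t * g d    ≈⟨ +-congˡ (-‿cong (≈-trans (*-assoc (u d) _ (g d))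
          (≈-trans (*-congˡ (≈-trans (*-comm _ (g d)) (proj₂ (inverse (g d) gd≉0)))) (*-identityʳ (u d))))) ⟩
      u d - u d        ≈⟨ -‿inverseʳ (u d) ⟩
      0#               ∎
    split : ∀ x y → x ≈ y + (x - y)
    split x y = begin
      x                 ≈⟨ +-identityʳ x ⟨
      x + 0#            ≈⟨ +-congˡ (-‿inverseʳ y) ⟨
      x + (y - y)       ≈⟨ +-x∙yz≈y∙xz x y (- y) ⟩
      y + (x - y)       ∎
    eq′ : f ≋ λ i → (cons t s ⊛ g) i + (u i - t * g i)
    eq′ zero    = split (f 0) (t * g 0)
    eq′ (suc i) = begin
      f (suc i)                                                    ≈⟨ eq i ⟩
      (s ⊛ g) i + r i                                              ≈⟨ +-congˡ (split (r i) (t * g (suc i))) ⟩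
      (s ⊛ g) i + (t * g (suc i) + (r i - t * g (suc i)))          ≈⟨ +-assoc _ _ _ ⟨
      (s ⊛ g) i + t * g (suc i) + (r i - t * g (suc i))            ≈⟨ +-congʳ (+-comm _ _) ⟩
      t * g (suc i) + (s ⊛ g) i + (r i - t * g (suc i))            ∎

  infix 4 _∣_

  _∣_ : Polynomial → Polynomial → Set (c ⊔ ℓ)
  f ∣ g = ∃[ h ] f P.* h P.≈ g

  ∣-trans : ∀ {f g h} → f ∣ g → g ∣ h → f ∣ h
  ∣-trans {f} {g} {h} (u , fu≈g) (v , gv≈h) = u P.* v , (begin
    f P.* (u P.* v)    ≈⟨ P.*-assoc f u v ⟨
    f P.* u P.* v      ≈⟨ P.*-congʳ fu≈g ⟩
    g P.* v            ≈⟨ gv≈h ⟩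
    h                  ∎)
    where open P≈R

  -- The Euclidean algorithm inside a family of polynomials that is
  -- closed under subtraction of multiples.
  gcd-in : ∀ {a} (I : Polynomial → Set a) →
    (∀ f g s h → I f → I g → f P.≈ s P.* g P.+ h → I h) →
    ∀ n f g → Bounded n (coeff g) → I f → I g → ∃[ h ] I h × h ∣ f × h ∣ g
  gcd-in I closed n f g b f∈I g∈I with degree? n b
  ... | inj₁ g≈0 = f , f∈I , (P.1# , P.*-identityʳ f) , (P.0# , P.trans (P.zeroʳ f) (P.sym (mk≈ g≈0)))
  gcd-in I closed (suc n) f g b f∈I g∈I | inj₂ (d , d<n , deg)
    with division deg (size f) (bounded f)
  ... | s , r , s-b , r-b , eq =
    let s′ = poly s (size f) s-b
        r′ = poly r d r-b
        f≈s′g+r′ = mk≈ {f} {s′ P.* g P.+ r′} λ i → ≈-trans (eq i)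
            (≈-sym (≈-trans (coeff-+ (s′ P.* g) r′ i) (+-congʳ (coeff-* s′ g i))))
        (h , h∈I , h∣g , h∣r) = gcd-in I closed n g r′ (bounded-mono (ℕ.s≤s⁻¹ d<n) r-b) g∈I
            (closed f g s′ r′ f∈I g∈I f≈s′g+r′)
        (u , hu≈g) = h∣g
        (v , hv≈r) = h∣r
    in h , h∈I
       , (s′ P.* u P.+ v , (begin
           h P.* (s′ P.* u P.+ v)              ≈⟨ P.distribˡ h (s′ P.* u) v ⟩
           h P.* (s′ P.* u) P.+ h P.* v        ≈⟨ P.+-cong (P.trans (P*.x∙yz≈y∙xz h s′ u) (P.*-congˡ hu≈g)) hv≈r ⟩
           s′ P.* g P.+ r′                     ≈⟨ f≈s′g+r′ ⟨
           f                                   ∎))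
       , h∣g
    where open P≈R

  Nonconstant : Polynomial → Set ℓ
  Nonconstant f = ∃[ d ] Degree (coeff f) (suc d)

  Irreducible : Polynomial → Set (c ⊔ ℓ)
  Irreducible p = Nonconstant p × (∀ f g → f P.* g P.≈ p → ¬ (Nonconstant f × Nonconstant g))

  irreducible⇒≉0 : ∀ p → Irreducible p → ¬ p P.≈ P.0#
  irreducible⇒≉0 p ((d , deg) , _) p≈0 = degree⇒≉0 deg (at p≈0)

  constant : Carrier → Polynomial
  constant a = poly (cons a 𝟘) 1 (λ { (suc i) _ → ≈-refl })

  unit : ∀ f → Degree (coeff f) 0 → ∃[ g ] f P.* g P.≈ P.1#
  unit f (f0≉0 , b) = constant f0⁻¹ , mk≈ λ n → ≈-trans (coeff-* f (constant f0⁻¹) n) (eq n)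
    where
    f0⁻¹ = proj₁ (inverse (coeff f 0) f0≉0)
    eq : coeff f ⊛ cons f0⁻¹ 𝟘 ≋ 𝟙
    eq zero    = proj₂ (inverse (coeff f 0) f0≉0)
    eq (suc n) = ≈-trans (⊛-constant (cons f0⁻¹ 𝟘) b (suc n)) (zeroʳ (coeff f 0))

  -- The polynomials `h` with `p ∣ h g` form an ideal containing `p` and `f`, so Euclid's algorithm
  -- run inside it yields a common divisor `h` of `p` and `f` with `p ∣ h g`, without Bézout
  -- coefficients. With `p = h u`, irreducibility makes `h` or `u` a unit: a unit `h` gives `p ∣ g`,
  -- a unit `u` gives `p ∣ f`.
  euclid : ∀ p f g → Irreducible p → p ∣ f P.* g → p ∣ f ⊎ p ∣ g
  euclid p f g p-irr@((d , deg-p) , p-prime) p∣fg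
    with gcd-in (λ h → p ∣ h P.* g) closed (size f) p f (bounded f) (g , P.refl ) p∣fg
    where
    open P≈R
    closed : ∀ u v s w → p ∣ u P.* g → p ∣ v P.* g → u P.≈ s P.* v P.+ w → p ∣ w P.* g
    closed u v s w (a , pa≈ug) (b , pb≈vg) u≈sv+w = a P.- s P.* b , (begin
      p P.* (a P.- s P.* b)
        ≈⟨ P.distribˡ p a (P.- (s P.* b)) ⟩
      p P.* a P.+ p P.* (P.- (s P.* b))
        ≈⟨ P.+-cong pa≈ug
             (P.trans (P.sym (PR.-‿distribʳ-* p (s P.* b)))
             (P.-‿cong (P.trans (P*.x∙yz≈y∙xz p s b) (P.*-congˡ pb≈vg)))) ⟩
      u P.* g P.- s P.* (v P.* g)
        ≈⟨ P.+-congʳ (P.trans (P.*-congʳ u≈sv+w)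
             (P.trans (P.distribʳ g (s P.* v) w) (P.+-congʳ (P.*-assoc s v g)))) ⟩
      s P.* (v P.* g) P.+ w P.* g P.- s P.* (v P.* g)
        ≈⟨ PA.xyx⁻¹≈y (s P.* (v P.* g)) (w P.* g) ⟩
      w P.* g ∎)
  ... | h , p∣hg , (u , hu≈p) , h∣f
    with nonzero-degree h (λ h≈0 → irreducible⇒≉0 p p-irr
        (P.trans (P.sym hu≈p) (P.trans (P.*-congʳ h≈0) (P.zeroˡ u))))
       | nonzero-degree u (λ u≈0 → irreducible⇒≉0 p p-irr
           (P.trans (P.sym hu≈p) (P.trans (P.*-congˡ u≈0) (P.zeroʳ h))))
  ... | zero , _ , deg-h | _ =
    let (v , hv≈1) = unit h deg-h in
    inj₂ (∣-trans p∣hg (v , P.trans (P*.xy∙z≈xz∙y h g v) (P.trans (P.*-congʳ hv≈1) (P.*-identityˡ g))))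
  ... | suc _ , _ , _ | zero , _ , deg-u =
    let (v , uv≈1) = unit u deg-u in
    inj₁ (∣-trans (v , P.trans (P.*-congʳ (P.sym hu≈p))
        (P.trans (P.*-assoc h u v) (P.trans (P.*-congˡ uv≈1) (P.*-identityʳ h)))) h∣f)
  ... | suc a , _ , deg-h | suc b , _ , deg-u = ⊥-elim (p-prime h u hu≈p ((a , deg-h) , (b , deg-u)))

-- The divisor bound.

-- Estimates `c ≤ C (1 + 1 / R) ^ u` multiply, with exponents added like degrees; the divisor bound
-- is accumulated in this way one factor at a time.
scale-bounds : ∀ R {c C len B} u d → c ℕ.* R ℕ.^ u ℕ.≤ C ℕ.* suc R ℕ.^ u → len ℕ.* R ℕ.^ d ℕ.≤ B ℕ.* suc R ℕ.^ d →
  (c ℕ.* len) ℕ.* R ℕ.^ (u ℕ.+ d) ℕ.≤ (C ℕ.* B) ℕ.* suc R ℕ.^ (u ℕ.+ d)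
scale-bounds R {c} {C} {len} {B} u d h k = begin
  (c ℕ.* len) ℕ.* R ℕ.^ (u ℕ.+ d)             ≡⟨ cong ((c ℕ.* len) ℕ.*_) (ℕ.^-distribˡ-+-* R u d) ⟩
  (c ℕ.* len) ℕ.* (R ℕ.^ u ℕ.* R ℕ.^ d)       ≡⟨ interchange c len _ _ ⟩
  (c ℕ.* R ℕ.^ u) ℕ.* (len ℕ.* R ℕ.^ d)       ≤⟨ ℕ.*-mono-≤ h k ⟩
  (C ℕ.* S ℕ.^ u) ℕ.* (B ℕ.* S ℕ.^ d)         ≡⟨ interchange C _ B _ ⟩
  (C ℕ.* B) ℕ.* (S ℕ.^ u ℕ.* S ℕ.^ d)         ≡⟨ cong ((C ℕ.* B) ℕ.*_) (ℕ.^-distribˡ-+-* S u d) ⟨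
  (C ℕ.* B) ℕ.* S ℕ.^ (u ℕ.+ d)               ∎
  where
  open ℕ.≤-Reasoning
  open SemigroupProperties ℕ.*-commutativeSemigroup using (interchange)
  S = suc R

module Divisors {c ℓ q} (k : FiniteField c ℓ q) where
  open FiniteField k using (Carrier; _≈_; 0#; index) renaming (refl to ≈-refl; sym to ≈-sym)
  open Polynomials k

  infix 4 _∈_

  _∈_ : Polynomial → List Polynomial → Set (c ⊔ ℓ)
  f ∈ D = Any (f P.≈_) D

  -- The list may repeat entries or contain non-divisors: what matters is its length, an upper bound
  -- for the number of divisors up to `_≈ₚ_`.
  Complete : Polynomial → List Polynomial → Set (c ⊔ ℓ)
  Complete f D = ∀ a → a ∣ f → a ∈ D

  ∣-respʳ : ∀ {a f g} → f P.≈ g → a ∣ f → a ∣ g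
  ∣-respʳ f≈g (h , ah≈f) = h , P.trans ah≈f f≈g

  complete-resp : ∀ {f g D} → f P.≈ g → Complete f D → Complete g D
  complete-resp f≈g C a a∣g = C a (∣-respʳ (P.sym f≈g) a∣g)

  module _ (p : Polynomial) where

    times-power : ℕ → Polynomial → Polynomial
    times-power zero    f = f
    times-power (suc e) f = p P.* times-power e f

    -- All `p^i d` with `i ≤ e` and `d` in `D`.
    spread : ℕ → List Polynomial → List Polynomial
    spread zero    D = D
    spread (suc e) D = D ++ List.map (p P.*_) (spread e D)

    length-spread : ∀ e D → length (spread e D) ≡ suc e ℕ.* length D
    length-spread zero    D = sym (ℕ.+-identityʳ (length D))
    length-spread (suc e) D = trans (List.length-++ D) (cong (length D ℕ.+_)
      (trans (List.length-map (p P.*_) (spread e D)) (length-spread e D)))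

    spread-mono : ∀ e D {r} {Q : Polynomial → Set r} → Any Q (spread e D) → Any Q (spread (suc e) D)
    spread-mono zero    D x = Any.++⁺ˡ x
    spread-mono (suc e) D x with Any.++⁻ D x
    ... | inj₁ y = Any.++⁺ˡ y
    ... | inj₂ y = Any.++⁺ʳ D (Any.map⁺ (spread-mono e D (Any.map⁻ y)))

    -- By Euclid's lemma a factorisation `a b = p w` lets `p` be cancelled from `a` or from `b`. In
    -- the first case the quotient of `a` divides `w`, so `a` occurs among the multiples of `p`; in
    -- the second `a` itself divides `w`.
    spread-complete : Irreducible p → ∀ {f D} → Complete f D →
                      ∀ e → Complete (times-power e f) (spread e D)
    spread-complete irr C zero = C
    spread-complete irr {f} {D} C (suc e) a (b , ab≈pw)
      with euclid p a b irr (w , P.sym ab≈pw)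
      where w = times-power e f
    ... | inj₁ (a′ , pa′≈a) = Any.++⁺ʳ D (Any.map⁺ (Any.map
          (λ a′≈d → P.trans (P.sym pa′≈a) (P.*-congˡ a′≈d))
          (spread-complete irr C e a′ (b , ⊛-cancelˡ p (a′ P.* b) (times-power e f) (irreducible⇒≉0 p irr)
            (P.trans (P.sym (P.*-assoc p a′ b)) (P.trans (P.*-congʳ pa′≈a) ab≈pw))))))
    ... | inj₂ (b′ , pb′≈b) = spread-mono e D
          (spread-complete irr C e a (b′ , ⊛-cancelˡ p (a P.* b′) (times-power e f) (irreducible⇒≉0 p irr)
            (P.trans (P*.x∙yz≈y∙xz p a b′) (P.trans (P.*-congˡ pb′≈b) ab≈pw))))

  degree-* : ∀ {d e} f g → Degree (coeff f) d → Degree (coeff g) e → Degree (coeff (f P.* g)) (d ℕ.+ e)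
  degree-* {d} {e} f g deg-f deg-g = degree-resp (λ n → ≈-sym (coeff-* f g n)) (degree-⊛ d e deg-f deg-g)

  cofactor-degree : ∀ {d n} p z f → Degree (coeff p) d → Degree (coeff f) n → p P.* z P.≈ f →
    ∃[ e ] n ≡ d ℕ.+ e × Degree (coeff z) e
  cofactor-degree p z f deg-p deg-f pz≈f with nonzero-degree z z≉0
    where
    z≉0 : ¬ z P.≈ P.0#
    z≉0 z≈0 = degree⇒≉0 deg-f (at (P.trans (P.sym pz≈f) (P.trans (P.*-congˡ z≈0) (P.zeroʳ p))))
  ... | e , _ , deg-z = e , degree-unique (degree-resp (at (P.sym pz≈f)) deg-f) (degree-* p z deg-p deg-z) , deg-z

  Reducible : Polynomial → Set (c ⊔ ℓ)
  Reducible f = ∃[ u ] ∃[ v ] u P.* v P.≈ f × Nonconstant u × Nonconstant v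

  -- Descent to a proper factor whenever there is one. Reducibility is not decided, hence the double
  -- negation; `n` bounds the degree and makes the recursion structural.
  irreducible-factor : ∀ n f {d} → d ℕ.< n → Degree (coeff f) (suc d) → ¬ ¬ (∃[ p ] Irreducible p × p ∣ f)
  irreducible-factor (suc n) f {d} (ℕ.s≤s d≤n) deg-f no-factor = ¬¬-excluded-middle {A = Reducible f} λ where
    (yes (u , v , uv≈f , (du , deg-u) , (dv , deg-v))) →
      irreducible-factor n u
        (ℕ.≤-trans
          (ℕ.≤-trans (ℕ.s≤s (ℕ.m≤m+n du dv)) (ℕ.≤-reflexive (trans (sym (ℕ.+-suc du dv)) (sym (ℕ.suc-injective
            (degree-unique deg-f (degree-resp (at uv≈f) (degree-* u v deg-u deg-v))))))))
          d≤n) deg-u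
        λ (p , irr , p∣u) → no-factor (p , irr , ∣-trans p∣u (v , uv≈f))
    (no ¬reducible) → no-factor (f , ((d , deg-f) , λ u v uv≈f (nu , nv) → ¬reducible (u , v , uv≈f , nu , nv))
      , (P.1# , P.*-identityʳ f))

  -- Division by `p` is repeated as long as possible and stops because each division lowers the
  -- degree by `suc dp`.
  extract-power : ∀ n p {dp} → Degree (coeff p) (suc dp) → ∀ f {d} → d ℕ.< n → Degree (coeff f) d →
    ¬ ¬ (∃[ e ] ∃[ z ] ∃[ d′ ] times-power p e z P.≈ f × d ≡ e ℕ.* suc dp ℕ.+ d′ × Degree (coeff z) d′ × ¬ p ∣ z)
  extract-power (suc n) p {dp} deg-p f {d} (ℕ.s≤s d≤n) deg-f κ = ¬¬-excluded-middle {A = p ∣ f} λ where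
    (no ¬p∣f) → κ (0 , f , d , P.refl , refl , deg-f , ¬p∣f)
    (yes (g , pg≈f)) →
      let (d₁ , d≡ , deg-g) = cofactor-degree p g f deg-p deg-f pg≈f in
      extract-power n p deg-p g
        (ℕ.≤-trans (ℕ.≤-trans (ℕ.s≤s (ℕ.m≤n+m d₁ dp)) (ℕ.≤-reflexive (sym d≡))) d≤n) deg-g
        λ (e , z , d′ , eq , d₁≡ , deg-z , ¬p∣z) → κ
          ( suc e , z , d′ , P.trans (P.*-congˡ eq) pg≈f
          , trans d≡ (trans (cong (suc dp ℕ.+_) d₁≡) (sym (ℕ.+-assoc (suc dp) (e ℕ.* suc dp) d′)))
          , deg-z , ¬p∣z)

  irreducible-resp : ∀ {f g} → f P.≈ g → Irreducible f → Irreducible g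
  irreducible-resp f≈g ((d , deg) , prime) =
    (d , degree-resp (at f≈g) deg) , λ u v uv≈g → prime u v (P.trans uv≈g (P.sym f≈g))

  extend : ∀ {J} → (Fin J → Carrier) → Series
  extend {zero}  v n       = 0#
  extend {suc J} v zero    = v Fin.zero
  extend {suc J} v (suc n) = extend (v ∘ Fin.suc) n

  extend-bounded : ∀ {J} (v : Fin J → Carrier) → Bounded J (extend v)
  extend-bounded {zero}  v i _ = ≈-refl
  extend-bounded {suc J} v (suc i) (ℕ.s≤s h) = extend-bounded (v ∘ Fin.suc) i h

  extend-≈ : ∀ J {f} (v : Fin J → Carrier) → (∀ i → v i ≈ f (toℕ i)) → Bounded J f → extend v ≋ f
  extend-≈ zero    v h b n       = ≈-sym (b n ℕ.z≤n)
  extend-≈ (suc J) v h b zero    = h Fin.zero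
  extend-≈ (suc J) v h b (suc n) = extend-≈ J (v ∘ Fin.suc) (h ∘ Fin.suc) (λ i j → b (suc i) (ℕ.s≤s j)) n

  extend-toℕ : ∀ {J} (v : Fin J → Carrier) i → extend v (toℕ i) ≡ v i
  extend-toℕ v Fin.zero    = refl
  extend-toℕ v (Fin.suc i) = extend-toℕ (v ∘ Fin.suc) i

  vecPoly : ∀ {J} → (Fin J → Carrier) → Polynomial
  vecPoly {J} v = poly (extend v) J (extend-bounded v)

  polynomials : ℕ → List Polynomial
  polynomials J = List.tabulate (λ t → vecPoly (sequence k J t))

  polynomials-complete : ∀ J f → Bounded J (coeff f) → f ∈ polynomials J
  polynomials-complete J f b = Any.tabulate⁺ (funToFin (index ∘ a))
    (P.sym (mk≈ (extend-≈ J (sequence k J (funToFin (index ∘ a))) (sequence-surjective k a) b)))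
    where
    a : Fin J → Carrier
    a i = coeff f (toℕ i)

  module DivisorBound (R : ℕ) .{{_ : ℕ.NonZero R}} where

    -- `L` holds the candidates for irreducible factors of degree below `R` that are still to be
    -- treated. For `L = []` every irreducible factor has degree at least `R`.
    SmallFactorsIn : Polynomial → List Polynomial → Set (c ⊔ ℓ)
    SmallFactorsIn f L = ∀ r {e} → Irreducible r → Degree (coeff r) e → e ℕ.< R → r ∣ f → r ∈ L

    -- Each of the `K` small candidates costs a factor `R`; the remaining factor `q` counts the
    -- constants.
    FewDivisors : ℕ → Polynomial → ℕ → Set (c ⊔ ℓ)
    FewDivisors K f d = ∃[ D ] Complete f D × length D ℕ.* R ℕ.^ d ℕ.≤ (R ℕ.^ K ℕ.* q) ℕ.* suc R ℕ.^ d

    -- Irreducible factors are removed one at a time, repetitions included. Each doubles the list,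
    -- and since its degree is at least `R`, the doubling is absorbed by `(1 + 1 / R) ^ deg p ≥ 2`.
    rough-divisors : ∀ n f {d} → d ℕ.< n → Degree (coeff f) d → SmallFactorsIn f [] → ¬ ¬ FewDivisors 0 f d
    -- A divisor of a nonzero constant is a constant; the list consists of all `q` of them, zero
    -- included.
    rough-divisors (suc n) f {zero} _ deg-f@(f0≉0 , f-b) _ κ = κ
      (polynomials 1 , (λ a (b , ab≈f) → polynomials-complete 1 a (bounded-one a b ab≈f))
      , ℕ.≤-reflexive (cong (ℕ._* 1) (trans (List.length-tabulate (λ t → vecPoly (sequence k 1 t)))
          (trans (ℕ.*-identityʳ q) (sym (ℕ.*-identityˡ q))))))
      where
      bounded-one : ∀ a b → a P.* b P.≈ f → Bounded 1 (coeff a)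
      bounded-one a b ab≈f with nonzero-degree a (λ a≈0 →
          degree⇒≉0 deg-f (at (P.trans (P.sym ab≈f) (P.trans (P.*-congʳ a≈0) (P.zeroˡ b)))))
      ... | da , _ , deg-a with cofactor-degree a b f deg-a deg-f ab≈f
      ...   | e , 0≡da+e , _ = subst (λ m → Bounded (suc m) (coeff a)) (ℕ.m+n≡0⇒m≡0 da (sym 0≡da+e)) (proj₂ deg-a)
    rough-divisors (suc n) f {suc d} (ℕ.s≤s d<n) deg-f small κ =
      irreducible-factor (suc d) f ℕ.≤-refl deg-f λ where
        (p , irr@((dp , deg-p) , _) , p∣f@(g , pg≈f)) →
          let (d′ , d≡ , deg-g) = cofactor-degree p g f deg-p deg-f pg≈f in
          rough-divisors n g
            (ℕ.≤-trans (ℕ.≤-trans (ℕ.s≤s (ℕ.m≤n+m d′ dp)) (ℕ.≤-reflexive (sym d≡))) d<n) deg-g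
            (λ r r-irr deg-r e<R r∣g → small r r-irr deg-r e<R (∣-trans r∣g (p , P.trans (P.*-comm g p) pg≈f)))
            λ (D , C , bound) → κ
              ( spread p 1 D
              , complete-resp pg≈f (spread-complete p irr C 1)
              , subst (λ m → length (spread p 1 D) ℕ.* R ℕ.^ m ℕ.≤ (1 ℕ.* q) ℕ.* suc R ℕ.^ m) (sym d≡)
                  (subst (λ l → l ℕ.* R ℕ.^ (suc dp ℕ.+ d′) ℕ.≤ (1 ℕ.* q) ℕ.* suc R ℕ.^ (suc dp ℕ.+ d′))
                      (sym (length-spread p 1 D))
                    (subst (λ B → 2 ℕ.* length D ℕ.* R ℕ.^ (suc dp ℕ.+ d′) ℕ.≤ B ℕ.* suc R ℕ.^ (suc dp ℕ.+ d′))
                        (ℕ.*-identityˡ (1 ℕ.* q))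
                      (scale-bounds R {2} {1} {length D} {1 ℕ.* q} (suc dp) d′
                      (ℕ.≤-trans (2≤[1+1/R]^e R (suc dp) (ℕ.≮⇒≥ λ lt → Any-[] (small p irr deg-p lt p∣f)))
                        (ℕ.≤-reflexive (sym (ℕ.*-identityˡ (suc R ℕ.^ suc dp)))))
                      bound)))
              )
      where
      Any-[] : ∀ {a} {Q : Polynomial → Set a} → ¬ Any Q []
      Any-[] ()

    -- An irreducible candidate `p` is split off with its full power, so that it no longer divides
    -- the cofactor `z` and leaves the list of candidates. A candidate that is not irreducible is
    -- dropped, and the factor `R ≥ 1` reserved for it is given away.
    few-divisors : ∀ L f {d} → Degree (coeff f) d → SmallFactorsIn f L → ¬ ¬ FewDivisors (length L) f d
    few-divisors [] f {d} deg-f small = rough-divisors (suc d) f ℕ.≤-refl deg-f small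
    few-divisors (p ∷ L) f {d} deg-f small κ = ¬¬-excluded-middle {A = Irreducible p} λ where
        (no ¬irr) → few-divisors L f deg-f (λ r r-irr deg-r e<R r∣f → tail r-irr ¬irr (small r r-irr deg-r e<R r∣f))
          λ (D , C , bound) → κ (D , C , ℕ.≤-trans bound (ℕ.*-monoˡ-≤ (suc R ℕ.^ d) (ℕ.*-monoˡ-≤ q
            (ℕ.m≤n*m (R ℕ.^ length L) R))))
        (yes irr@((dp , deg-p) , _)) → extract-power (suc d) p deg-p f ℕ.≤-refl deg-f λ where
          (e , z , d′ , eq , d≡ , deg-z , ¬p∣z) → few-divisors L z deg-z
            (λ r r-irr deg-r e<R r∣z → tail′ ¬p∣z r∣z
                (small r r-irr deg-r e<R (∣-respʳ eq (divides-power r z e r∣z))))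
            λ (D , C , bound) → κ
              ( spread p e D
              , complete-resp eq (spread-complete p irr C e)
              , subst (λ m → length (spread p e D) ℕ.* R ℕ.^ m ℕ.≤ (R ℕ.^ suc (length L) ℕ.* q) ℕ.* suc R ℕ.^ m)
                  (sym d≡)
                  (subst (λ l → l ℕ.* R ℕ.^ (e ℕ.* suc dp ℕ.+ d′) ℕ.≤ (R ℕ.^ suc (length L) ℕ.* q) ℕ.* suc R ℕ.^
                      (e ℕ.* suc dp ℕ.+ d′)) (sym (length-spread p e D))
                    (subst (λ B → suc e ℕ.* length D ℕ.* R ℕ.^ (e ℕ.* suc dp ℕ.+ d′) ℕ.≤ B ℕ.* suc R ℕ.^
                        (e ℕ.* suc dp ℕ.+ d′)) (sym (ℕ.*-assoc R (R ℕ.^ length L) q))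
                      (scale-bounds R {suc e} {R} {length D} {R ℕ.^ length L ℕ.* q} (e ℕ.* suc dp) d′
                        -- `e + 1` is relaxed to `e * deg p + 1`, so that the estimate has the
                        -- degree of `p^e` as its exponent.
                        (ℕ.≤-trans (ℕ.*-monoˡ-≤ (R ℕ.^ (e ℕ.* suc dp)) (ℕ.s≤s (ℕ.m≤m*n e (suc dp))))
                            (1+e≤R[1+1/R]^e R (e ℕ.* suc dp)))
                        bound))))
      where
      tail : ∀ {r} → Irreducible r → ¬ Irreducible p → r ∈ p ∷ L → r ∈ L
      tail r-irr ¬irr (here r≈p) = ⊥-elim (¬irr (irreducible-resp r≈p r-irr))
      tail r-irr ¬irr (there h)  = h
      tail′ : ∀ {r z} → ¬ p ∣ z → r ∣ z → r ∈ p ∷ L → r ∈ L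
      tail′ ¬p∣z (s , rs≈z) (here r≈p) = ⊥-elim (¬p∣z (s , P.trans (P.*-congʳ (P.sym r≈p)) rs≈z))
      tail′ ¬p∣z r∣z        (there h)  = h
      divides-power : ∀ r z e → r ∣ z → r ∣ times-power p e z
      divides-power r z zero    r∣z = r∣z
      divides-power r z (suc e) r∣z with divides-power r z e r∣z
      ... | s , rs≈w = p P.* s , P.trans (P*.x∙yz≈y∙xz r p s) (P.*-congˡ rs≈w)

    -- All `q ^ R` polynomials of degree below `R` serve as candidates, irreducible or not, which
    -- keeps the constant independent of the field. The bound grows with the degree, so the true
    -- degree `d` may be replaced by `n`.
    divisor-bound : ∀ n f → Bounded (suc n) (coeff f) → ¬ f P.≈ P.0# → ¬ ¬ FewDivisors (q ℕ.^ R) f n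
    divisor-bound n f b f≉0 κ with degree? (suc n) b
    ... | inj₁ f≈0 = f≉0 (mk≈ f≈0)
    ... | inj₂ (d , d<1+n , deg) = few-divisors (polynomials R) f deg
      (λ r _ deg-r e<R _ → polynomials-complete R r (bounded-mono e<R (proj₂ deg-r)))
      λ (D , C , bound) → κ (D , C , widen D (subst
        (λ l → length D ℕ.* R ℕ.^ d ℕ.≤ (R ℕ.^ l ℕ.* q) ℕ.* suc R ℕ.^ d)
        (List.length-tabulate (λ t → vecPoly (sequence k R t))) bound))
      where
      widen : ∀ D → length D ℕ.* R ℕ.^ d ℕ.≤ (R ℕ.^ (q ℕ.^ R) ℕ.* q) ℕ.* suc R ℕ.^ d →
              length D ℕ.* R ℕ.^ n ℕ.≤ (R ℕ.^ (q ℕ.^ R) ℕ.* q) ℕ.* suc R ℕ.^ n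
      widen D h = subst (λ m → length D ℕ.* R ℕ.^ m ℕ.≤ B ℕ.* suc R ℕ.^ m) (ℕ.m∸n+n≡m (ℕ.s≤s⁻¹ d<1+n))
        (subst (λ l → l ℕ.* R ℕ.^ (n ℕ.∸ d ℕ.+ d) ℕ.≤ B ℕ.* suc R ℕ.^ (n ℕ.∸ d ℕ.+ d)) (ℕ.*-identityˡ (length D))
          (subst (λ C → 1 ℕ.* length D ℕ.* R ℕ.^ (n ℕ.∸ d ℕ.+ d) ℕ.≤ C ℕ.* suc R ℕ.^ (n ℕ.∸ d ℕ.+ d))
              (ℕ.*-identityˡ B)
            (scale-bounds R {1} {1} {length D} {B} (n ℕ.∸ d) d
              (ℕ.*-monoʳ-≤ 1 (ℕ.^-monoˡ-≤ (n ℕ.∸ d) (ℕ.n≤1+n R))) h)))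
        where B = R ℕ.^ (q ℕ.^ R) ℕ.* q

-- Sizes of Hankel kernels: convexity, growth and the indicator of `H`.

module Hankel {c ℓ q} (k : FiniteField c ℓ q) where
  open FiniteField k renaming (refl to ≈-refl; sym to ≈-sym; trans to ≈-trans)
  open RingProperties ring using (-0#≈0#; -‿distribˡ-*)
  open GroupProperties +-group using ()
    renaming (x∙y⁻¹≈ε⇒x≈y to x-y≈0⇒x≈y; inverseˡ-unique to +-inverseˡ-unique)
  open Polynomials k
  open Divisors k using (extend; extend-bounded; extend-≈; extend-toℕ)
  open Counting using
    (⟦_⟧; ⟦⟧-true; count; count≡0; 1≤count; count≤1; count-fibres; count-injection; count-all; sum-combine)
  module ℕΣ = Counting
  module KΣ = FiniteSums commutativeSemiring

  vector : ∀ J → Fin (q ℕ.^ J) → Series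
  vector J t = extend (sequence k J t)

  vector-bounded : ∀ J t → Bounded J (vector J t)
  vector-bounded J t = extend-bounded (sequence k J t)

  code : ∀ J → Series → Fin (q ℕ.^ J)
  code J f = funToFin {J} (λ i → index (f (toℕ i)))

  vector-code : ∀ J {f} → Bounded J f → vector J (code J f) ≋ f
  vector-code J {f} b = extend-≈ J (sequence k J (code J f)) (sequence-surjective k (f ∘ toℕ)) b

  index-element : ∀ i → index (element i) ≡ i
  index-element = Inverse.strictlyInverseʳ enumeration

  element-injective : ∀ {i j} → element i ≈ element j → i ≡ j
  element-injective {i} {j} h = trans (sym (index-element i))
      (trans (Inverse.from-cong enumeration h) (index-element j))

  finToFun-injective : ∀ {m} J (t u : Fin (m ℕ.^ J)) → (∀ i → finToFun t i ≡ finToFun u i) → t ≡ u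
  finToFun-injective {m} J t u h = trans (sym (Fin.funToFin-finToFin {J} {m} t))
    (trans (cong-funToFin J h) (Fin.funToFin-finToFin {J} {m} u))
    where
    cong-funToFin : ∀ J {f g : Fin J → Fin m} → (∀ i → f i ≡ g i) → funToFin f ≡ funToFin g
    cong-funToFin zero    h = refl
    cong-funToFin (suc J) h = cong₂ combine (h Fin.zero) (cong-funToFin J (h ∘ Fin.suc))

  vector-injective : ∀ J {t u} → vector J t ≋ vector J u → t ≡ u
  vector-injective J {t} {u} h = finToFun-injective J t u λ i → element-injective (begin
    sequence k J t i      ≡⟨ extend-toℕ (sequence k J t) i ⟨
    vector J t (toℕ i)    ≈⟨ h (toℕ i) ⟩
    vector J u (toℕ i)    ≡⟨ extend-toℕ (sequence k J u) i ⟩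
    sequence k J u i      ∎)
    where open ≈R

  opaque
    dot : ℕ → Series → Series → Carrier
    dot M f x = KΣ.sum {M} (λ i → f (toℕ i) * x (toℕ i))

    dot-cong : ∀ M {f g x y} → f ≋ g → x ≋ y → dot M f x ≈ dot M g y
    dot-cong M h k = KΣ.sum-cong-≋ {M} λ i → *-cong (h (toℕ i)) (k (toℕ i))

    dot-+ : ∀ M f g x → dot M (λ i → f i + g i) x ≈ dot M f x + dot M g x
    dot-+ M f g x = ≈-trans (KΣ.sum-cong-≋ {M} λ i → distribʳ (x (toℕ i)) (f (toℕ i)) (g (toℕ i)))
      (KΣ.∑-distrib-+ {M} (λ i → f (toℕ i) * x (toℕ i)) (λ i → g (toℕ i) * x (toℕ i)))

    dot-scale : ∀ M a f x → dot M (λ i → a * f i) x ≈ a * dot M f x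
    dot-scale M a f x = ≈-trans (KΣ.sum-cong-≋ {M} λ i → *-assoc a (f (toℕ i)) (x (toℕ i)))
      (≈-sym (KΣ.*-distribˡ-sum {M} a (λ i → f (toℕ i) * x (toℕ i))))

    dot-zero : ∀ M {f} x → f ≋ 𝟘 → dot M f x ≈ 0#
    dot-zero M x f≋0 = ≈-trans (KΣ.sum-cong-≋ {M} λ i → ≈-trans (*-congʳ (f≋0 (toℕ i))) (zeroˡ (x (toℕ i))))
        (KΣ.sum-zero M)

    dot-neg : ∀ M f x → dot M (λ i → - f i) x ≈ - dot M f x
    dot-neg M f x = +-inverseˡ-unique _ _ (≈-trans (≈-sym (dot-+ M (λ i → - f i) f x))
        (dot-zero M x (λ i → -‿inverseˡ (f i))))

    dot-suc : ∀ M {f} x → Bounded M f → dot (suc M) f x ≈ dot M f x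
    dot-suc zero    {f} x b = ≈-trans (+-identityʳ _) (≈-trans (*-congʳ (b 0 ℕ.z≤n)) (zeroˡ (x 0)))
    dot-suc (suc M) {f} x b = +-congˡ (dot-suc M {f ∘ suc} (x ∘ suc) λ i h → b (suc i) (ℕ.s≤s h))

    dot-cons : ∀ M f x → dot (suc M) (cons 0# f) x ≈ dot M f (x ∘ suc)
    dot-cons M f x = ≈-trans (+-congʳ (zeroˡ (x 0))) (+-identityˡ _)

  opaque
    shift : ℕ → Series → Series
    shift l x i = x (l ℕ.+ i)

    shift-suc : ∀ l x → shift l x ∘ suc ≋ shift (suc l) x
    shift-suc l x i = reflexive (cong x (ℕ.+-suc l i))

  Annihilates : ℕ → ℕ → Series → Series → Set ℓ
  Annihilates M L f x = ∀ (l : Fin L) → dot M f (shift (toℕ l) x) ≈ 0#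

  annihilates? : ∀ M L f x → Dec (Annihilates M L f x)
  annihilates? M L f x = Fin.all? λ l → dot M f (shift (toℕ l) x) ≈? 0#

  annihilates-< : ∀ {M L f x} → Annihilates M L f x → ∀ l → l ℕ.< L → dot M f (shift l x) ≈ 0#
  annihilates-< {M} {L} {f} {x} A l l<L = subst (λ l → dot M f (shift l x) ≈ 0#) (Fin.toℕ-fromℕ< l<L)
      (A (fromℕ< l<L))

  annihilates-resp : ∀ {M L f g x} → f ≋ g → Annihilates M L f x → Annihilates M L g x
  annihilates-resp {M} f≋g A l = ≈-trans (dot-cong M (λ i → ≈-sym (f≋g i)) (λ _ → ≈-refl)) (A l)

  annihilates-zero : ∀ {M L f x} → f ≋ 𝟘 → Annihilates M L f x
  annihilates-zero {M} {L} {f} {x} f≋0 l = dot-zero M (shift (toℕ l) x) f≋0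

  -- For M = m + 1 and L = N - m these vectors form the left kernel of the
  -- Hankel matrix that defines H_m.
  kernelSize : ℕ → ℕ → Series → ℕ
  kernelSize M L x = count (λ t → annihilates? M L (vector M t) x)

  1≤kernelSize : ∀ M L x → 1 ℕ.≤ kernelSize M L x
  1≤kernelSize M L x = 1≤count (λ t → annihilates? M L (vector M t) x) (code M 𝟘)
    (annihilates-zero (vector-code M (λ _ _ → ≈-refl)))

  Nontrivial : ℕ → ℕ → Series → Set (c ⊔ ℓ)
  Nontrivial M L x = ∃[ f ] Bounded M f × ¬ f ≋ 𝟘 × Annihilates M L f x

  trivial⇒≡1 : ∀ M L x → ¬ Nontrivial M L x → kernelSize M L x ≡ 1
  trivial⇒≡1 M L x triv = ℕ.≤-antisym
    (count≤1 (λ t → annihilates? M L (vector M t) x) λ t u At Au →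
      vector-injective M (λ i → ≈-trans (zero-only t At i) (≈-sym (zero-only u Au i))))
    (1≤kernelSize M L x)
    where
    zero-only : ∀ t → Annihilates M L (vector M t) x → vector M t ≋ 𝟘
    zero-only t At with degree? M (vector-bounded M t)
    ... | inj₁ f≋0         = f≋0
    ... | inj₂ (_ , _ , d) = ⊥-elim (triv (vector M t , vector-bounded M t , degree⇒≉0 d , At))

  *-cancelʳ-nonzero : ∀ {x y z} → ¬ z ≈ 0# → x * z ≈ y * z → x ≈ y
  *-cancelʳ-nonzero {x} {y} {z} z≉0 xz≈yz = x-y≈0⇒x≈y x y (decidable-stable (x - y ≈? 0#) λ x-y≉0 →
    *-integral x-y≉0 z≉0 (≈-trans (distribʳ z x (- y))
      (≈-trans (+-cong xz≈yz (≈-sym (-‿distribˡ-* y z))) (-‿inverseʳ (y * z)))))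

  -- The `q` scalar multiples of a nonzero kernel vector are told apart by its leading coefficient.
  nontrivial⇒q≤ : ∀ M L x → Nontrivial M L x → q ℕ.≤ kernelSize M L x
  nontrivial⇒q≤ M L x (f , f-b , f≉0 , A) with degree? M f-b
  ... | inj₁ f≋0 = ⊥-elim (f≉0 f≋0)
  ... | inj₂ (d , _ , fd≉0 , _) = ℕ.≤-trans (ℕ.≤-reflexive (sym (count-all q)))
    (count-injection {P = λ _ → ⊤} (λ _ → yes tt) (λ t → annihilates? M L (vector M t) x)
      (λ i → code M (multiple i))
      (λ i _ → annihilates-resp (λ n → ≈-sym (vector-code M (multiple-b i) n))
        λ l → ≈-trans (dot-scale M (element i) f _) (≈-trans (*-congˡ (A l)) (zeroʳ (element i))))
      λ i j _ _ eq → element-injective (*-cancelʳ-nonzero fd≉0 (≈-trans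
        (≈-sym (vector-code M (multiple-b i) d))
        (≈-trans (reflexive (cong (λ t → vector M t d) eq)) (vector-code M (multiple-b j) d)))))
    where
    multiple : Fin q → Series
    multiple i n = element i * f n
    multiple-b : ∀ i → Bounded M (multiple i)
    multiple-b i n h = ≈-trans (*-congˡ (f-b n h)) (zeroʳ (element i))

  difference-bounded : ∀ {M f g} → Bounded M f → Bounded M g → Bounded M (λ i → f i - g i)
  difference-bounded f-b g-b i h = ≈-trans (+-cong (f-b i h) (≈-trans (-‿cong (g-b i h)) -0#≈0#)) (+-identityˡ 0#)

  difference-annihilates : ∀ {M L f g x} → Annihilates M L f x → Annihilates M L g x →
      Annihilates M L (λ i → f i - g i) x
  difference-annihilates {M} {L} {f} {g} {x} Af Ag l = ≈-trans (dot-+ M f (λ i → - g i) _)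
    (≈-trans (+-cong (Af l) (≈-trans (dot-neg M g _) (≈-trans (-‿cong (Ag l)) -0#≈0#))) (+-identityˡ 0#))

  -- (f , g) ↦ X f + g maps pairs of kernel vectors of length M + 1 to kernel
  -- vectors of length M + 2, and any two points of a fibre differ by
  -- (h , - X h) with h a kernel vector of length M.
  kernelSize-convex : ∀ M L x →
    kernelSize (suc M) (suc L) x ℕ.* kernelSize (suc M) (suc L) x
      ℕ.≤ kernelSize (suc (suc M)) L x ℕ.* kernelSize M (suc (suc L)) x
  kernelSize-convex M L x = begin
    W ℕ.* W                                              ≡⟨ pair-count ⟨
    count Pair?                                          ≤⟨ count-fibres Pair? Fibre? weight
                                                              (λ t p → φ t , p , refl) fibre-bound ⟩
    ℕΣ.sum weight                                        ≡⟨ ℕΣ.*-distribʳ-sum (kernelSize M (2 ℕ.+ L) x)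
                                                              (λ u → ⟦ annihilates? (2 ℕ.+ M) L
                                                                  (vector (2 ℕ.+ M) u) x ⟧) ⟨
    kernelSize (2 ℕ.+ M) L x ℕ.* kernelSize M (2 ℕ.+ L) x    ∎
    where
    open ℕ.≤-Reasoning
    W = kernelSize (suc M) (suc L) x
    Q = q ℕ.^ suc M

    A? : ∀ t → Dec (Annihilates (suc M) (suc L) (vector (suc M) t) x)
    A? t = annihilates? (suc M) (suc L) (vector (suc M) t) x

    π₁ π₂ : Fin (Q ℕ.* Q) → Fin Q
    π₁ t = proj₁ (remQuot {Q} Q t)
    π₂ t = proj₂ (remQuot {Q} Q t)

    F G : Fin (Q ℕ.* Q) → Series
    F t = vector (suc M) (π₁ t)
    G t = vector (suc M) (π₂ t)

    Pair : Fin (Q ℕ.* Q) → Set ℓ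
    Pair t = Annihilates (suc M) (suc L) (F t) x × Annihilates (suc M) (suc L) (G t) x

    Pair? : ∀ t → Dec (Pair t)
    Pair? t = A? (π₁ t) ×-dec A? (π₂ t)

    ⟦×⟧ : ∀ {a b} {A : Set a} {B : Set b} (d : Dec A) (e : Dec B) → ⟦ d ×-dec e ⟧ ≡ ⟦ d ⟧ ℕ.* ⟦ e ⟧
    ⟦×⟧ (yes _) (yes _) = refl
    ⟦×⟧ (yes _) (no _)  = refl
    ⟦×⟧ (no _)  _       = refl

    pair-count : count Pair? ≡ W ℕ.* W
    pair-count = trans (sum-combine Q {Q} (λ t → ⟦ Pair? t ⟧)) (trans
      (ℕΣ.sum-cong-≋ {Q} λ i → trans
        (ℕΣ.sum-cong-≋ {Q} λ j → trans (⟦×⟧ (A? (π₁ (combine i j))) (A? (π₂ (combine i j))))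
          (cong (λ (i , j) → ⟦ A? i ⟧ ℕ.* ⟦ A? j ⟧) (Fin.remQuot-combine i j)))
        (sym (ℕΣ.*-distribˡ-sum {Q} ⟦ A? i ⟧ (λ j → ⟦ A? j ⟧))))
      (sym (ℕΣ.*-distribʳ-sum {Q} W (λ i → ⟦ A? i ⟧))))

    combination : Fin (Q ℕ.* Q) → Series
    combination t i = cons 0# (F t) i + G t i

    combination-b : ∀ t → Bounded (2 ℕ.+ M) (combination t)
    combination-b t i h = ≈-trans (+-cong (cons-bounded 0# (vector-bounded (suc M) (π₁ t)) i h)
      (vector-bounded (suc M) (π₂ t) i (ℕ.≤-trans (ℕ.n≤1+n (suc M)) h))) (+-identityˡ 0#)

    φ : Fin (Q ℕ.* Q) → Fin (q ℕ.^ (2 ℕ.+ M))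
    φ t = code (2 ℕ.+ M) (combination t)

    Fibre? : ∀ t u → Dec (Pair t × φ t ≡ u)
    Fibre? t u = Pair? t ×-dec (φ t Fin.≟ u)

    weight : Fin (q ℕ.^ (2 ℕ.+ M)) → ℕ
    weight u = ⟦ annihilates? (2 ℕ.+ M) L (vector (2 ℕ.+ M) u) x ⟧ ℕ.* kernelSize M (2 ℕ.+ L) x

    φ-annihilates : ∀ t → Pair t → Annihilates (2 ℕ.+ M) L (vector (2 ℕ.+ M) (φ t)) x
    φ-annihilates t (Af , Ag) = annihilates-resp (λ i → ≈-sym (vector-code (2 ℕ.+ M) (combination-b t) i)) λ l →
      ≈-trans (dot-+ (2 ℕ.+ M) (cons 0# (F t)) (G t) _)
      (≈-trans (+-cong
        (≈-trans (dot-cons (suc M) (F t) (shift (toℕ l) x))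
            (≈-trans (dot-cong (suc M) (λ _ → ≈-refl) (shift-suc (toℕ l) x))
          (annihilates-< Af (suc (toℕ l)) (ℕ.s≤s (Fin.toℕ<n l)))))
        (≈-trans (dot-suc (suc M) (shift (toℕ l) x) (vector-bounded (suc M) (π₂ t)))
          (annihilates-< Ag (toℕ l) (ℕ.m≤n⇒m≤1+n (Fin.toℕ<n l)))))
      (+-identityˡ 0#))

    combination-eq : ∀ t u → φ t ≡ φ u → combination t ≋ combination u
    combination-eq t u eq i = ≈-trans (≈-sym (vector-code (2 ℕ.+ M) (combination-b t) i))
      (≈-trans (reflexive (cong (λ v → vector (2 ℕ.+ M) v i) eq)) (vector-code (2 ℕ.+ M) (combination-b u) i))

    interchange-difference : ∀ a b c d → (a - c) + (b - d) ≈ (a + b) - (c + d)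
    interchange-difference a b c d = ≈-trans (SemigroupProperties.interchange +-commutativeSemigroup a (- c) b
        (- d))
      (+-congˡ (RingProperties.-‿+-comm ring c d))

    module _ (t₀ : Fin (Q ℕ.* Q)) (A₀ : Pair t₀) where

      δF δG : Fin (Q ℕ.* Q) → Series
      δF t i = F t i - F t₀ i
      δG t i = G t i - G t₀ i

      cons-δ : ∀ {t} → φ t ≡ φ t₀ → ∀ i → cons 0# (δF t) i + δG t i ≈ 0#
      cons-δ {t} eq i = ≈-trans (+-congʳ (cons-difference i)) (≈-trans (interchange-difference _ _ _ _)
        (≈-trans (+-congʳ (combination-eq t t₀ eq i)) (-‿inverseʳ _)))
        where
        cons-difference : ∀ i → cons 0# (δF t) i ≈ cons 0# (F t) i - cons 0# (F t₀) i
        cons-difference zero    = ≈-sym (-‿inverseʳ 0#)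
        cons-difference (suc i) = ≈-refl

      cons-δF≋-δG : ∀ {t} → φ t ≡ φ t₀ → cons 0# (δF t) ≋ λ i → - δG t i
      cons-δF≋-δG eq i = +-inverseˡ-unique _ _ (cons-δ eq i)

      -- Coefficient `i` of `δF` is minus coefficient `i + 1` of `δG`, which is zero from `i = M`
      -- on: the length drops by one.
      δF-bounded : ∀ {t} → φ t ≡ φ t₀ → Bounded M (δF t)
      δF-bounded {t} eq i M≤i = ≈-trans (cons-δF≋-δG eq (suc i)) (≈-trans
        (-‿cong (difference-bounded (vector-bounded (suc M) (π₂ t)) (vector-bounded (suc M) (π₂ t₀)) (suc i)
            (ℕ.s≤s M≤i)))
        -0#≈0#)

      -- In return for the shorter length one equation is gained: row `0` comes from `δF` itself,
      -- and row `l + 1` is row `l` of `X δF = - δG`.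
      δF-annihilates : ∀ {t} → φ t ≡ φ t₀ → Pair t → Annihilates M (2 ℕ.+ L) (δF t) x
      δF-annihilates {t} eq (Af , Ag) Fin.zero = ≈-trans (≈-sym (dot-suc M (shift 0 x) (δF-bounded {t} eq)))
        (difference-annihilates {suc M} {suc L} {F t} {F t₀} {x} Af (proj₁ A₀) Fin.zero)
      δF-annihilates {t} eq (Af , Ag) (Fin.suc l) = begin′
        dot M (δF t) (shift (suc (toℕ l)) x)                  ≈⟨ dot-cong M (λ _ → ≈-refl) (shift-suc (toℕ l) x) ⟨
        dot M (δF t) (shift (toℕ l) x ∘ suc)                  ≈⟨ dot-cons M (δF t) (shift (toℕ l) x) ⟨
        dot (suc M) (cons 0# (δF t)) (shift (toℕ l) x)        ≈⟨ dot-cong (suc M) (cons-δF≋-δG eq) (λ _ → ≈-refl) ⟩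
        dot (suc M) (λ i → - δG t i) (shift (toℕ l) x)        ≈⟨ dot-neg (suc M) (δG t) _ ⟩
        - dot (suc M) (δG t) (shift (toℕ l) x)                ≈⟨ -‿cong
            (difference-annihilates {suc M} {suc L} {G t} {G t₀} {x} Ag (proj₂ A₀) l) ⟩
        - 0#                                                  ≈⟨ -0#≈0# ⟩
        0#                                                    ∎′
        where open SetoidReasoning setoid renaming (begin_ to begin′_; _∎ to _∎′)

      δF-injective : ∀ {t u} → φ t ≡ φ t₀ → φ u ≡ φ t₀ → δF t ≋ δF u → t ≡ u
      δF-injective {t} {u} eq eq′ h = trans (sym (Fin.combine-remQuot {Q} Q t)) (trans
        (cong₂ combine (vector-injective (suc M) F≋) (vector-injective (suc M) G≋))
        (Fin.combine-remQuot {Q} Q u))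
        where
        open GroupProperties +-group using (∙-cancelʳ; ∙-cancelˡ)
        F≋ : F t ≋ F u
        F≋ i = ∙-cancelʳ (- F t₀ i) (F t i) (F u i) (h i)
        G≋ : G t ≋ G u
        G≋ i = ∙-cancelˡ (cons 0# (F t) i) (G t i) (G u i)
            (≈-trans (combination-eq t u (trans eq (sym eq′)) i) (+-congʳ (cons≋ i)))
          where
          cons≋ : ∀ i → cons 0# (F u) i ≈ cons 0# (F t) i
          cons≋ zero    = ≈-refl
          cons≋ (suc i) = ≈-sym (F≋ i)

      fibre≤ : count (λ t → Fibre? t (φ t₀)) ℕ.≤ kernelSize M (2 ℕ.+ L) x
      fibre≤ = count-injection (λ t → Fibre? t (φ t₀)) (λ t → annihilates? M (2 ℕ.+ L) (vector M t) x)
        (λ t → code M (δF t))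
        (λ t (p , eq) → annihilates-resp (λ i → ≈-sym (vector-code M (δF-bounded {t} eq) i))
            (δF-annihilates {t} eq p))
        (λ t u (_ , eq) (_ , eq′) h → δF-injective {t} {u} eq eq′ λ i → ≈-trans
          (≈-sym (vector-code M (δF-bounded {t} eq) i))
          (≈-trans (reflexive (cong (λ v → vector M v i) h)) (vector-code M (δF-bounded {u} eq′) i)))

    fibre-bound : ∀ u → count (λ t → Fibre? t u) ℕ.≤ weight u
    fibre-bound u = decidable-stable (_ ℕ.≤? _) λ ¬bound → ¬¬-excluded-middle {A = ∃[ t ] Pair t × φ t ≡ u} λ where
      (no empty) → ¬bound (ℕ.≤-trans (ℕ.≤-reflexive (count≡0 (λ t → Fibre? t u) λ t p → empty (t , p))) ℕ.z≤n)
      (yes (t₀ , p , refl)) → ¬bound (ℕ.≤-trans (fibre≤ t₀ p) (ℕ.≤-reflexive (sym (trans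
        (cong (ℕ._* kernelSize M (2 ℕ.+ L) x) (⟦⟧-true (annihilates? (2 ℕ.+ M) L (vector (2 ℕ.+ M) (φ t₀)) x)
            (φ-annihilates t₀ p)))
        (ℕ.*-identityˡ _)))))

  -- Convexity makes the ratio of consecutive sizes nondecreasing; here ratios `δ` steps apart are
  -- compared. The induction multiplies the previous case by one instance of `kernelSize-convex` and
  -- cancels sizes, which are positive because of the zero vector.
  kernelSize-log-convex : ∀ δ T J x →
    kernelSize (suc J) (δ ℕ.+ T) x ℕ.* kernelSize (δ ℕ.+ J) (suc T) x
      ℕ.≤ kernelSize J (suc (δ ℕ.+ T)) x ℕ.* kernelSize (suc (δ ℕ.+ J)) T x
  kernelSize-log-convex zero    T J x = ℕ.≤-reflexive (ℕ.*-comm (kernelSize (suc J) T x) (kernelSize J (suc T) x))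
  kernelSize-log-convex (suc δ) T J x = ℕ.*-cancelʳ-≤ (A ℕ.* D) (C ℕ.* E) (B ℕ.* D) {{B*D≢0}} (begin
    A ℕ.* D ℕ.* (B ℕ.* D)      ≡⟨ solve 3 (λ A B D → A :* D :* (B :* D) := A :* B :* (D :* D)) refl A B D ⟩
    A ℕ.* B ℕ.* (D ℕ.* D)      ≤⟨ ℕ.*-mono-≤ previous (kernelSize-convex (δ ℕ.+ J) T x) ⟩
    C ℕ.* D ℕ.* (E ℕ.* B)      ≡⟨ solve 4 (λ B C D E → C :* D :* (E :* B) := C :* E :* (B :* D)) refl B C D E ⟩
    C ℕ.* E ℕ.* (B ℕ.* D)      ∎)
    where
    open ℕ.≤-Reasoning
    open ℕ-Solver
    A = kernelSize (suc J) (suc (δ ℕ.+ T)) x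
    B = kernelSize (δ ℕ.+ J) (2 ℕ.+ T) x
    C = kernelSize J (2 ℕ.+ (δ ℕ.+ T)) x
    D = kernelSize (suc (δ ℕ.+ J)) (suc T) x
    E = kernelSize (2 ℕ.+ (δ ℕ.+ J)) T x
    B*D≢0 : ℕ.NonZero (B ℕ.* D)
    B*D≢0 = ℕ.m*n≢0 B D {{ℕ.>-nonZero (1≤kernelSize (δ ℕ.+ J) (2 ℕ.+ T) x)}}
        {{ℕ.>-nonZero (1≤kernelSize (suc (δ ℕ.+ J)) (suc T) x)}}
    previous : A ℕ.* B ℕ.≤ C ℕ.* D
    previous = subst (λ m → kernelSize (suc J) m x ℕ.* B ℕ.≤ kernelSize J (suc m) x ℕ.* D) (ℕ.+-suc δ T)
      (kernelSize-log-convex δ (suc T) J x)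

  2≤q : 2 ℕ.≤ q
  2≤q = distinct (index 0#) (index 1#) λ eq → 1≉0 (≈-sym (index-injective eq))
    where
    distinct : ∀ {n} (i j : Fin n) → ¬ i ≡ j → 2 ℕ.≤ n
    distinct {suc zero}    Fin.zero Fin.zero i≢j = ⊥-elim (i≢j refl)
    distinct {suc (suc n)} _        _        _   = ℕ.s≤s (ℕ.s≤s ℕ.z≤n)

  instance
    q≢0 : ℕ.NonZero q
    q≢0 = ℕ.>-nonZero (ℕ.≤-trans (ℕ.s≤s ℕ.z≤n) 2≤q)

  -- The Hankel matrices for (J , L) and (L , J) are transposes of each other.
  Symmetric : Set c
  Symmetric = ∀ J L x → q ℕ.^ L ℕ.* kernelSize J L x ≡ q ℕ.^ J ℕ.* kernelSize L J x

  -- Convexity between `J` and `L + 1` gives `a a′ ≤ b b′`, where `a′` and `b′` are the mirror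
  -- images of `a` and `b`. Symmetry expresses them through `a` and `b` up to powers of `q`, and
  -- what remains is `a² ≤ (q b)²`. Symmetry is a hypothesis at this point because it is derived
  -- from a character.
  kernelSize-upper : Symmetric → ∀ J L x → J ℕ.≤ L → kernelSize (suc J) L x ℕ.≤ q ℕ.* kernelSize J (suc L) x
  kernelSize-upper symmetric J L x J≤L = ℕ.≮⇒≥ λ qb<a → ℕ.<⇒≱ (ℕ.*-mono-< qb<a qb<a) a²≤
    where
    open ℕ.≤-Reasoning
    open ℕ-Solver
    a = kernelSize (suc J) L x
    a′ = kernelSize L (suc J) x
    b = kernelSize J (suc L) x
    b′ = kernelSize (suc L) J x
    aa′≤bb′ : a ℕ.* a′ ℕ.≤ b ℕ.* b′
    aa′≤bb′ = subst (λ m → kernelSize (suc J) m x ℕ.* kernelSize m (suc J) x ℕ.≤ kernelSize J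
        (suc m) x ℕ.* kernelSize (suc m) J x)
      (ℕ.m∸n+n≡m J≤L) (kernelSize-log-convex (L ℕ.∸ J) J J x)
    a²≤ : a ℕ.* a ℕ.≤ (q ℕ.* b) ℕ.* (q ℕ.* b)
    a²≤ = ℕ.*-cancelˡ-≤ (q ℕ.^ L) {{ℕ.m^n≢0 q L}} (begin
      q ℕ.^ L ℕ.* (a ℕ.* a)
        ≡⟨ solve 2 (λ p a → p :* (a :* a) := a :* (p :* a)) refl (q ℕ.^ L) a ⟩
      a ℕ.* (q ℕ.^ L ℕ.* a)
        ≡⟨ cong (a ℕ.*_) (symmetric (suc J) L x) ⟩
      a ℕ.* (q ℕ.^ suc J ℕ.* a′)
        ≡⟨ solve 3 (λ a p a′ → a :* (p :* a′) := p :* (a :* a′)) refl a (q ℕ.^ suc J) a′ ⟩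
      q ℕ.^ suc J ℕ.* (a ℕ.* a′)
        ≤⟨ ℕ.*-monoʳ-≤ (q ℕ.^ suc J) aa′≤bb′ ⟩
      q ℕ.^ suc J ℕ.* (b ℕ.* b′)
        ≡⟨ solve 4 (λ q p b b′ → q :* p :* (b :* b′) := q :* b :* (p :* b′)) refl q (q ℕ.^ J) b b′ ⟩
      q ℕ.* b ℕ.* (q ℕ.^ J ℕ.* b′)
        ≡⟨ cong (q ℕ.* b ℕ.*_) (symmetric J (suc L) x) ⟨
      q ℕ.* b ℕ.* (q ℕ.^ suc L ℕ.* b)
        ≡⟨ solve 3 (λ q p b → q :* b :* (q :* p :* b) := p :* (q :* b :* (q :* b))) refl q (q ℕ.^ L) b ⟩
      q ℕ.^ L ℕ.* (q ℕ.* b ℕ.* (q ℕ.* b)) ∎)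

  -- Mutual induction on the length. At the first nontrivial length the size jumps from `1` to at
  -- least `q`; from there on convexity carries the ratio along. The case distinction is classical,
  -- which is allowed because the goal is a decidable inequality.
  kernelSize-lower : ∀ M L x → Nontrivial (suc M) L x → q ℕ.* kernelSize M (suc L) x ℕ.≤ kernelSize (suc M) L x
  kernelSize-growth : ∀ M L x → Nontrivial M (suc L) x → q ℕ.* kernelSize M (suc L) x ℕ.≤ kernelSize (suc M) L x

  kernelSize-lower M L x nt = decidable-stable (_ ℕ.≤? _) λ ¬bound → ¬¬-excluded-middle {A = Nontrivial M (suc L) x} λ where
    (yes nt′) → ¬bound (kernelSize-growth M L x nt′)
    (no ¬nt′) → ¬bound (ℕ.≤-trans
      (ℕ.≤-reflexive (trans (cong (q ℕ.*_) (trivial⇒≡1 M (suc L) x ¬nt′)) (ℕ.*-identityʳ q)))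
      (nontrivial⇒q≤ (suc M) L x nt))

  kernelSize-growth zero    L x (f , f-b , f≉0 , _) = ⊥-elim (f≉0 λ i → f-b i ℕ.z≤n)
  kernelSize-growth (suc M) L x nt = ℕ.*-cancelʳ-≤ _ _ W {{ℕ.>-nonZero (1≤kernelSize (suc M) (suc L) x)}} (begin
    q ℕ.* W ℕ.* W                                                   ≡⟨ ℕ.*-assoc q W W ⟩
    q ℕ.* (W ℕ.* W)                                                 ≤⟨ ℕ.*-monoʳ-≤ q (kernelSize-convex M L x) ⟩
    q ℕ.* (kernelSize (2 ℕ.+ M) L x ℕ.* kernelSize M (2 ℕ.+ L) x)   ≡⟨ x∙yz≈y∙xz q (kernelSize (2 ℕ.+ M) L x)
        (kernelSize M (2 ℕ.+ L) x) ⟩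
    kernelSize (2 ℕ.+ M) L x ℕ.* (q ℕ.* kernelSize M (2 ℕ.+ L) x)   ≤⟨ ℕ.*-monoʳ-≤ (kernelSize (2 ℕ.+ M) L x)
        (kernelSize-lower M (suc L) x nt) ⟩
    kernelSize (2 ℕ.+ M) L x ℕ.* W                                  ∎)
    where
    open ℕ.≤-Reasoning
    open SemigroupProperties ℕ.*-commutativeSemigroup using (x∙yz≈y∙xz)
    W = kernelSize (suc M) (suc L) x

  -- (q - 1) [x ∈ H] = w (J + 1, L) - q w (J, L + 1) + (q - 1) for the kernel
  -- sizes w, with terms moved so that no subtraction occurs.
  kernelSize-indicator : Symmetric → ∀ J L x → J ℕ.≤ L → (d : Dec (Nontrivial (suc J) L x)) →
    q ℕ.* ⟦ d ⟧ ℕ.+ q ℕ.* kernelSize J (suc L) x ℕ.+ 1 ≡ kernelSize (suc J) L x ℕ.+ q ℕ.+ ⟦ d ⟧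
  kernelSize-indicator symmetric J L x J≤L (yes nt) = cong (ℕ._+ 1) (trans
    (cong₂ ℕ._+_ (ℕ.*-identityʳ q) (ℕ.≤-antisym (kernelSize-lower J L x nt) (kernelSize-upper symmetric J L x J≤L)))
    (ℕ.+-comm q _))
  kernelSize-indicator symmetric J L x J≤L (no ¬nt) = begin
    q ℕ.* 0 ℕ.+ q ℕ.* kernelSize J (suc L) x ℕ.+ 1    ≡⟨ cong₂ (λ u v → u ℕ.+ q ℕ.* v ℕ.+ 1) (ℕ.*-zeroʳ q)
        (trivial⇒≡1 J (suc L) x ¬nt′) ⟩
    q ℕ.* 1 ℕ.+ 1                                     ≡⟨ cong (ℕ._+ 1) (ℕ.*-identityʳ q) ⟩
    q ℕ.+ 1                                           ≡⟨ ℕ.+-comm q 1 ⟩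
    1 ℕ.+ q                                           ≡⟨ ℕ.+-identityʳ (1 ℕ.+ q) ⟨
    1 ℕ.+ q ℕ.+ 0                                     ≡⟨ cong (λ u → u ℕ.+ q ℕ.+ 0) (trivial⇒≡1 (suc J) L x ¬nt) ⟨
    kernelSize (suc J) L x ℕ.+ q ℕ.+ 0                ∎
    where
    open ≡-Reasoning
    ¬nt′ : ¬ Nontrivial J (suc L) x
    ¬nt′ nt = ℕ.<⇒≱ 2≤q (ℕ.≤-trans (ℕ.m≤m*n q (kernelSize J (suc L) x) {{ℕ.>-nonZero (1≤kernelSize J (suc L) x)}})
      (ℕ.≤-trans (kernelSize-growth J L x nt) (ℕ.≤-reflexive (trivial⇒≡1 (suc J) L x ¬nt))))

  opaque
    unfolding dot shift

    hankelSum-dot : ∀ {m N} (a : Fin (suc m) → Carrier) (x : Fin N → Carrier) (j : Fin (N ℕ.∸ m)) →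
      hankelSum k {m} {N} a x j ≈ dot (suc m) (extend a) (shift (toℕ j) (extend x))
    hankelSum-dot {m} {N} a x j = KΣ.sum-cong-≋ {suc m} λ i → *-cong
      (reflexive (sym (extend-toℕ a i)))
      (reflexive (trans (sym (extend-toℕ x _)) (cong (extend x)
        (trans (Fin.toℕ-fromℕ< (index-bound k {m} {N} i j)) (ℕ.+-comm (toℕ i) (toℕ j))))))

  H⇒nontrivial : ∀ {N} m (x : Fin N → Carrier) → H k m x → Nontrivial (suc m) (N ℕ.∸ m) (extend x)
  H⇒nontrivial m x (a , (i , ai≉0) , eqs) = extend a , extend-bounded a
    , (λ a≋0 → ai≉0 (≈-trans (reflexive (sym (extend-toℕ a i))) (a≋0 (toℕ i))))
    , λ j → ≈-trans (≈-sym (hankelSum-dot a x j)) (eqs j)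

  nontrivial⇒H : ∀ {N} m (x : Fin N → Carrier) → Nontrivial (suc m) (N ℕ.∸ m) (extend x) → H k m x
  nontrivial⇒H {N} m x (f , f-b , f≉0 , A) = a , nonzero
    , λ j → ≈-trans (hankelSum-dot a x j) (≈-trans (dot-cong (suc m) a≋f (λ _ → ≈-refl)) (A j))
    where
    a : Fin (suc m) → Carrier
    a i = f (toℕ i)
    a≋f : extend a ≋ f
    a≋f = extend-≈ (suc m) a (λ _ → ≈-refl) f-b
    nonzero : ∃[ i ] ¬ a i ≈ 0#
    nonzero with degree? (suc m) f-b
    ... | inj₁ f≋0 = ⊥-elim (f≉0 f≋0)
    ... | inj₂ (e , e<m , fe≉0 , _) = fromℕ< e<m , λ h → fe≉0 (subst (λ n → f n ≈ 0#) (Fin.toℕ-fromℕ< e<m) h)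

-- The Hankel form as a functional of products, and pairs with zero product.

module ProductPairing {c ℓ q} (k : FiniteField c ℓ q) where
  open FiniteField k renaming (refl to ≈-refl; sym to ≈-sym; trans to ≈-trans)
  open Polynomials k
  open Hankel k
  open SemigroupProperties *-commutativeSemigroup using () renaming (x∙yz≈y∙xz to *-x∙yz≈y∙xz)
  open Counting using (⟦_⟧; ⟦⟧-true; ⟦⟧-false; count; 1≤count; count≤1; count-all)

  ⊛-bounded-suc : ∀ d e {f g} → Bounded (suc d) f → Bounded e g → Bounded (d ℕ.+ e) (f ⊛ g)
  ⊛-bounded-suc zero    e {f} {g} f-b g-b i h = ≈-trans (⊛-constant g f-b i)
      (≈-trans (*-congˡ (g-b i h)) (zeroʳ (f 0)))
  ⊛-bounded-suc (suc d) e {f} {g} f-b g-b (suc i) (ℕ.s≤s h) = ≈-trans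
    (+-cong (≈-trans (*-congˡ (g-b (suc i) (ℕ.≤-trans (ℕ.m≤n+m e d) (ℕ.m≤n⇒m≤1+n h)))) (zeroʳ (f 0)))
            (⊛-bounded-suc d e (λ j h → f-b (suc j) (ℕ.s≤s h)) g-b i h))
    (+-identityˡ 0#)

  -- Vectors of lengths `J` and `L` have degrees at most `J - 1` and `L - 1`, which is why `J + L`
  -- is `N + 1` and not `N`. For `J = 0` the product vanishes.
  ⊛-size : ∀ J L N {f g} → J ℕ.+ L ≡ suc N → Bounded J f → Bounded L g → Bounded N (f ⊛ g)
  ⊛-size zero    L N {g = g} _  f-b g-b i _ = ⊛-vanish g f-b i
  ⊛-size (suc J) L N refl f-b g-b = ⊛-bounded-suc J L f-b g-b

  opaque
    unfolding dot shift

    dot-extend : ∀ L M {f} x → L ℕ.≤ M → Bounded L f → dot M f x ≈ dot L f x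
    dot-extend zero M x _ b = dot-zero M x (λ i → b i ℕ.z≤n)
    dot-extend (suc L) (suc M) x (ℕ.s≤s L≤M) b = +-congˡ
        (dot-extend L M (x ∘ suc) L≤M (λ i h → b (suc i) (ℕ.s≤s h)))

    dot-+ʳ : ∀ M f x y → dot M f (λ i → x i + y i) ≈ dot M f x + dot M f y
    dot-+ʳ M f x y = ≈-trans (KΣ.sum-cong-≋ {M} λ i → distribˡ (f (toℕ i)) (x (toℕ i)) (y (toℕ i)))
      (KΣ.∑-distrib-+ {M} (λ i → f (toℕ i) * x (toℕ i)) (λ i → f (toℕ i) * y (toℕ i)))

    dot-scaleʳ : ∀ M a f x → dot M f (λ i → a * x i) ≈ a * dot M f x
    dot-scaleʳ M a f x = ≈-trans (KΣ.sum-cong-≋ {M} λ i → *-x∙yz≈y∙xz (f (toℕ i)) a (x (toℕ i)))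
      (≈-sym (KΣ.*-distribˡ-sum {M} a (λ i → f (toℕ i) * x (toℕ i))))

    dot-head : ∀ M f x → dot (suc M) f x ≈ f 0 * x 0 + dot M (f ∘ suc) (x ∘ suc)
    dot-head M f x = ≈-refl

    dot-empty : ∀ f x → dot 0 f x ≈ 0#
    dot-empty f x = ≈-refl

    shift-0 : ∀ l x → shift l x 0 ≈ x l
    shift-0 l x = reflexive (cong x (ℕ.+-identityʳ l))

    shift-tail : ∀ l x → shift l x ∘ suc ≋ shift l (x ∘ suc)
    shift-tail l x i = reflexive (cong x (ℕ.+-suc l i))

    -- Both sides are the Hankel form `Σ f_i g_l x_(i+l)`; exchanging the sums transposes the
    -- matrix.
    pairing-comm : ∀ J L f g x →
      dot L g (λ l → dot J f (shift l x)) ≈ dot J f (λ i → dot L g (shift i x))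
    pairing-comm J L f g x = begin
      KΣ.sum {L} (λ l → g (toℕ l) * KΣ.sum {J} (λ i → f (toℕ i) * x (toℕ l ℕ.+ toℕ i)))
        ≈⟨ KΣ.sum-cong-≋ {L} (λ l → KΣ.*-distribˡ-sum {J} (g (toℕ l)) (λ i → f (toℕ i) * x (toℕ l ℕ.+ toℕ i))) ⟩
      KΣ.sum {L} (λ l → KΣ.sum {J} (λ i → g (toℕ l) * (f (toℕ i) * x (toℕ l ℕ.+ toℕ i))))
        ≈⟨ KΣ.∑-comm {L} {J} (λ l i → g (toℕ l) * (f (toℕ i) * x (toℕ l ℕ.+ toℕ i))) ⟩
      KΣ.sum {J} (λ i → KΣ.sum {L} (λ l → g (toℕ l) * (f (toℕ i) * x (toℕ l ℕ.+ toℕ i))))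
        ≈⟨ KΣ.sum-cong-≋ {J} (λ i → KΣ.sum-cong-≋ {L} λ l → ≈-trans (*-x∙yz≈y∙xz _ _ _)
             (*-congˡ (*-congˡ (reflexive (cong x (ℕ.+-comm (toℕ l) (toℕ i))))))) ⟩
      KΣ.sum {J} (λ i → KΣ.sum {L} (λ l → f (toℕ i) * (g (toℕ l) * x (toℕ i ℕ.+ toℕ l))))
        ≈⟨ KΣ.sum-cong-≋ {J} (λ i → KΣ.*-distribˡ-sum {L} (f (toℕ i)) (λ l → g (toℕ l) * x (toℕ i ℕ.+ toℕ l))) ⟨
      KΣ.sum {J} (λ i → f (toℕ i) * KΣ.sum {L} (λ l → g (toℕ l) * x (toℕ i ℕ.+ toℕ l))) ∎
      where open ≈R

  -- The Hankel form depends on `f` and `g` only through their product, as the functional `x`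
  -- applied to `f ⊛ g`. The induction follows the recursion of `_⊛_`, splitting off the first
  -- coefficient of `f` and shifting `x` along.
  dot-⊛ : ∀ J L N {f g} x → J ℕ.+ L ℕ.≤ suc N → Bounded J f → Bounded L g →
    dot N (f ⊛ g) x ≈ dot L g (λ l → dot J f (shift l x))
  dot-⊛ zero L N {f} {g} x _ f-b g-b = ≈-trans (dot-zero N x (⊛-vanish g f-b))
    (≈-sym (≈-trans (dot-cong L (λ _ → ≈-refl) (λ l → dot-empty f (shift l x)))
      (≈-trans (dot-cong L {g} {g} (λ _ → ≈-refl) (λ l → ≈-sym (zeroˡ 0#)))
      (≈-trans (dot-scaleʳ L 0# g (λ _ → 0#)) (zeroˡ _)))))
  dot-⊛ (suc J) zero zero {f} {g} x _ f-b g-b = ≈-trans (dot-empty (f ⊛ g) x) (≈-sym (dot-empty g _))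
  dot-⊛ (suc J) (suc L) zero x (ℕ.s≤s h) = ⊥-elim (ℕ.m+1+n≢0 J (ℕ.n≤0⇒n≡0 h))
  dot-⊛ (suc J) L (suc N) {f} {g} x (ℕ.s≤s h) f-b g-b = begin
    dot (suc N) (f ⊛ g) x
      ≈⟨ dot-head N (f ⊛ g) x ⟩
    f 0 * g 0 * x 0 + dot N (λ i → f 0 * g (suc i) + (f′ ⊛ g) i) x′
      ≈⟨ +-cong (*-assoc (f 0) (g 0) (x 0)) (dot-+ N (λ i → f 0 * g (suc i)) (f′ ⊛ g) x′) ⟩
    f 0 * (g 0 * x 0) + (dot N (λ i → f 0 * g (suc i)) x′ + dot N (f′ ⊛ g) x′)
      ≈⟨ +-congˡ (+-cong (dot-scale N (f 0) (g ∘ suc) x′) (dot-⊛ J L N x′ h (λ i j → f-b (suc i) (ℕ.s≤s j)) g-b)) ⟩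
    f 0 * (g 0 * x 0) + (f 0 * dot N (g ∘ suc) x′ + rest)
      ≈⟨ +-assoc _ _ _ ⟨
    f 0 * (g 0 * x 0) + f 0 * dot N (g ∘ suc) x′ + rest
      ≈⟨ +-congʳ (≈-trans (≈-sym (distribˡ (f 0) _ _)) (*-congˡ (≈-sym (dot-head N g x)))) ⟩
    f 0 * dot (suc N) g x + rest
      ≈⟨ +-congʳ (*-congˡ (dot-extend L (suc N) x (ℕ.≤-trans (ℕ.m≤n+m L J) h) g-b)) ⟩
    f 0 * dot L g x + rest
      ≈⟨ +-congʳ (dot-scaleʳ L (f 0) g x) ⟨
    dot L g (λ l → f 0 * x l) + rest
      ≈⟨ dot-+ʳ L g (λ l → f 0 * x l) (λ l → dot J f′ (shift l x′)) ⟨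
    dot L g (λ l → f 0 * x l + dot J f′ (shift l x′))
      ≈⟨ dot-cong L (λ _ → ≈-refl) (λ l → ≈-trans (dot-head J f (shift l x))
           (+-cong (*-congˡ (shift-0 l x)) (dot-cong J (λ _ → ≈-refl) (shift-tail l x)))) ⟨
    dot L g (λ l → dot (suc J) f (shift l x)) ∎
    where
    open ≈R
    f′ = f ∘ suc
    x′ = x ∘ suc
    rest = dot L g (λ l → dot J f′ (shift l x′))

  product : ∀ J L → Fin (q ℕ.^ J) → Fin (q ℕ.^ L) → Series
  product J L t u = vector J t ⊛ vector L u

  vanishes? : ∀ J t → Dec (vector J t ≋ 𝟘)
  vanishes? J t with degree? J (vector-bounded J t)
  ... | inj₁ f≋0         = yes f≋0
  ... | inj₂ (_ , _ , d) = no (degree⇒≉0 d)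

  toPoly : ∀ J → Fin (q ℕ.^ J) → Polynomial
  toPoly J t = poly (vector J t) J (vector-bounded J t)

  product-vanishes : ∀ J L t u → product J L t u ≋ 𝟘 → vector J t ≋ 𝟘 ⊎ vector L u ≋ 𝟘
  product-vanishes J L t u h with ⊛-integral (toPoly J t) (toPoly L u)
    (mk≈ λ n → ≈-trans (coeff-* (toPoly J t) (toPoly L u) n) (h n))
  ... | inj₁ f≈0 = inj₁ (at f≈0)
  ... | inj₂ g≈0 = inj₂ (at g≈0)

  vanishes-product : ∀ J L t u → vector J t ≋ 𝟘 ⊎ vector L u ≋ 𝟘 → product J L t u ≋ 𝟘
  vanishes-product J L t u (inj₁ h) n = ≈-trans (⊛-cong h (λ _ → ≈-refl) n) (⊛-zeroˡ (vector L u) n)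
  vanishes-product J L t u (inj₂ h) n = ≈-trans (⊛-comm (vector J t) (vector L u) n)
    (≈-trans (⊛-cong h (λ _ → ≈-refl) n) (⊛-zeroˡ (vector J t) n))

  product-vanishes? : ∀ J L t u → Dec (product J L t u ≋ 𝟘)
  product-vanishes? J L t u = map′ (vanishes-product J L t u) (product-vanishes J L t u)
    (vanishes? J t ⊎-dec vanishes? L u)

  zeroPairs : ℕ → ℕ → ℕ
  zeroPairs J L = ℕΣ.sum (λ t → count (product-vanishes? J L t))

  count-vanishing : ∀ J → count (vanishes? J) ≡ 1
  count-vanishing J = ℕ.≤-antisym
    (count≤1 (vanishes? J) λ t u h k → vector-injective J (λ n → ≈-trans (h n) (≈-sym (k n))))
    (1≤count (vanishes? J) (code J 𝟘) (vector-code J (λ _ _ → ≈-refl)))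

  -- There are no zero divisors, so the row of the zero vector contributes `q ^ L` and every other
  -- row exactly `1`. Adding `1` on the left avoids subtraction.
  zeroPairs-count : ∀ J L → zeroPairs J L ℕ.+ 1 ≡ q ℕ.^ J ℕ.+ q ℕ.^ L
  zeroPairs-count J L = begin
    zeroPairs J L ℕ.+ 1
      ≡⟨ cong (zeroPairs J L ℕ.+_) (count-vanishing J) ⟨
    ℕΣ.sum (λ t → count (product-vanishes? J L t)) ℕ.+ ℕΣ.sum (λ t → ⟦ vanishes? J t ⟧)
      ≡⟨ ℕΣ.∑-distrib-+ (λ t → count (product-vanishes? J L t)) (λ t → ⟦ vanishes? J t ⟧) ⟨
    ℕΣ.sum (λ t → count (product-vanishes? J L t) ℕ.+ ⟦ vanishes? J t ⟧)
      ≡⟨ ℕΣ.sum-cong-≋ (λ t → row t (vanishes? J t)) ⟩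
    ℕΣ.sum (λ t → ⟦ vanishes? J t ⟧ ℕ.* q ℕ.^ L ℕ.+ 1)
      ≡⟨ ℕΣ.∑-distrib-+ (λ t → ⟦ vanishes? J t ⟧ ℕ.* q ℕ.^ L) (λ _ → 1) ⟩
    ℕΣ.sum (λ t → ⟦ vanishes? J t ⟧ ℕ.* q ℕ.^ L) ℕ.+ ℕΣ.sum {q ℕ.^ J} (λ _ → 1)
      ≡⟨ cong₂ ℕ._+_ (trans (sym (ℕΣ.*-distribʳ-sum (q ℕ.^ L) (λ t → ⟦ vanishes? J t ⟧)))
           (trans (cong (ℕ._* q ℕ.^ L) (count-vanishing J)) (ℕ.*-identityˡ (q ℕ.^ L)))) (count-all (q ℕ.^ J)) ⟩
    q ℕ.^ L ℕ.+ q ℕ.^ J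
      ≡⟨ ℕ.+-comm (q ℕ.^ L) (q ℕ.^ J) ⟩
    q ℕ.^ J ℕ.+ q ℕ.^ L ∎
    where
    open ≡-Reasoning
    row : ∀ t (d : Dec (vector J t ≋ 𝟘)) → count (product-vanishes? J L t) ℕ.+ ⟦ d ⟧ ≡ ⟦ d ⟧ ℕ.* q ℕ.^ L ℕ.+ 1
    row t (yes t≋0) = cong (ℕ._+ 1) (trans
      (ℕΣ.sum-cong-≋ λ u → ⟦⟧-true (product-vanishes? J L t u) (vanishes-product J L t u (inj₁ t≋0)))
      (trans (count-all (q ℕ.^ L)) (sym (ℕ.*-identityˡ (q ℕ.^ L)))))
    row t (no t≉0) = trans (ℕ.+-identityʳ _) (trans
      (ℕΣ.sum-cong-≋ λ u → same u (vanishes? L u))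
      (count-vanishing L))
      where
      same : ∀ u (d : Dec (vector L u ≋ 𝟘)) → ⟦ product-vanishes? J L t u ⟧ ≡ ⟦ d ⟧
      same u (yes u≋0) = ⟦⟧-true (product-vanishes? J L t u) (vanishes-product J L t u (inj₂ u≋0))
      same u (no u≉0)  = ⟦⟧-false (product-vanishes? J L t u) λ h → neither (product-vanishes J L t u h)
        where
        neither : ¬ (vector J t ≋ 𝟘 ⊎ vector L u ≋ 𝟘)
        neither (inj₁ h) = t≉0 h
        neither (inj₂ h) = u≉0 h

-- Characters and expected kernel sizes.

-- Values lie in an arbitrary commutative ring because the Fourier identities are purely algebraic;
-- absolute values enter only in the later estimates.
record Character {c ℓ q a b} (k : FiniteField c ℓ q) (A : CommutativeRing a b) : Set (c ⊔ ℓ ⊔ a ⊔ b) where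
  private
    module K = FiniteField k
    module A = CommutativeRing A
    module AΣ = FiniteSums A.commutativeSemiring
  field
    ψ          : K.Carrier → A.Carrier
    ψ-cong     : ∀ {x y} → x K.≈ y → ψ x A.≈ ψ y
    ψ-+        : ∀ x y → ψ (x K.+ y) A.≈ ψ x A.* ψ y
    ψ-0        : ψ K.0# A.≈ A.1#
    orthogonal : ∀ x → ¬ x K.≈ K.0# → AΣ.sum (λ z → ψ (K.element z K.* x)) A.≈ A.0#

module Fourier {c ℓ q a b} (k : FiniteField c ℓ q) (A : CommutativeRing a b) (χ : Character k A) where
  open FiniteField k using (Carrier; _≈_; _≈?_; 0#; element) renaming (_*_ to _*ₖ_)
  private module K = FiniteField k
  open Polynomials k
  open Hankel k
  open ProductPairing k
  open Divisors k using (extend-toℕ)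
  open Character χ
  open CommutativeRing A using (_+_; _*_; 1#) renaming (Carrier to S; _≈_ to _≃_; 0# to 0ₐ)
  module A = CommutativeRing A
  module AΣ = FiniteSums A.commutativeSemiring
  open AΣ using (ι)
  open Counting using (⟦_⟧)
  open SetoidReasoning A.setoid

  ψ-sum : ∀ {n} (f : Fin n → Carrier) → ψ (KΣ.sum f) ≃ AΣ.prod (ψ ∘ f)
  ψ-sum {zero}  f = ψ-0
  ψ-sum {suc n} f = A.trans (ψ-+ (f Fin.zero) _) (A.*-congˡ (ψ-sum (f ∘ Fin.suc)))

  opaque
    unfolding dot

    ψ-dot : ∀ M f x → ψ (dot M f x) ≃ AΣ.prod {M} (λ i → ψ (f (toℕ i) *ₖ x (toℕ i)))
    ψ-dot M f x = ψ-sum {M} (λ i → f (toℕ i) *ₖ x (toℕ i))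

  -- The sum factors over the coordinates. A coordinate where `y` vanishes gives `q`, and a single
  -- nonzero one makes the product vanish by orthogonality.
  complete-sum : ∀ L y (d : Dec (∀ (l : Fin L) → y (toℕ l) ≈ 0#)) →
    AΣ.sum (λ u → ψ (dot L (vector L u) y)) ≃ ι (q ℕ.^ L) * ι ⟦ d ⟧
  complete-sum L y d = begin
    AΣ.sum (λ u → ψ (dot L (vector L u) y))
      ≈⟨ AΣ.sum-cong-≋ (λ u → A.trans (ψ-dot L (vector L u) y)
           (AΣ.prod-cong-≋ {L} λ i → A.reflexive (cong (λ v → ψ (v *ₖ y (toℕ i)))
               (extend-toℕ (sequence k L u) i)))) ⟩
    AΣ.sum (λ (u : Fin (q ℕ.^ L)) → AΣ.prod (λ i → g i (finToFun u i)))
      ≈⟨ AΣ.prod-of-sums L g ⟨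
    AΣ.prod (λ i → AΣ.sum (g i))
      ≈⟨ evaluate d ⟩
    ι (q ℕ.^ L) * ι ⟦ d ⟧ ∎
    where
    g : Fin L → Fin q → S
    g i z = ψ (element z *ₖ y (toℕ i))
    evaluate : ∀ d → AΣ.prod (λ i → AΣ.sum (g i)) ≃ ι (q ℕ.^ L) * ι ⟦ d ⟧
    evaluate (yes y≈0) = begin
      AΣ.prod (λ i → AΣ.sum (g i))      ≈⟨ AΣ.prod-cong-≋ {L} (λ i → A.trans
                                            (AΣ.sum-cong-≋ λ z → A.trans (ψ-cong
                                                (K.trans (K.*-congˡ (y≈0 i)) (K.zeroʳ (element z)))) ψ-0)
                                            (A.trans (AΣ.sum-const q 1#) (A.*-identityʳ (ι q)))) ⟩
      AΣ.prod {L} (λ _ → ι q)           ≈⟨ AΣ.prod-const L q ⟩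
      ι (q ℕ.^ L)                       ≈⟨ A.*-identityʳ _ ⟨
      ι (q ℕ.^ L) * 1#                  ≈⟨ A.*-congˡ AΣ.ι-1 ⟨
      ι (q ℕ.^ L) * ι 1                 ∎
    evaluate (no ¬y≈0) with Fin.¬∀⟶∃¬ L (λ l → y (toℕ l) ≈ 0#) (λ l → y (toℕ l) ≈? 0#) ¬y≈0
    ... | l , yl≉0 = begin
      AΣ.prod (λ i → AΣ.sum (g i))      ≈⟨ AΣ.prod-zero (λ i → AΣ.sum (g i)) l (orthogonal (y (toℕ l)) yl≉0) ⟩
      0ₐ                                ≈⟨ A.zeroʳ _ ⟨
      ι (q ℕ.^ L) * 0ₐ                  ∎

  pairSum : ℕ → ℕ → Series → S
  pairSum J L x = AΣ.sum (λ t → AΣ.sum (λ u → ψ (dot L (vector L u) (λ l → dot J (vector J t) (shift l x)))))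

  kernelSize-pairSum : ∀ J L x → ι (q ℕ.^ L) * ι (kernelSize J L x) ≃ pairSum J L x
  kernelSize-pairSum J L x = begin
    ι (q ℕ.^ L) * ι (kernelSize J L x)
      ≈⟨ A.*-congˡ (AΣ.sum-ι (λ t → ⟦ annihilates? J L (vector J t) x ⟧)) ⟩
    ι (q ℕ.^ L) * AΣ.sum (λ t → ι ⟦ annihilates? J L (vector J t) x ⟧)
      ≈⟨ AΣ.*-distribˡ-sum (ι (q ℕ.^ L)) (λ t → ι ⟦ annihilates? J L (vector J t) x ⟧) ⟩
    AΣ.sum (λ t → ι (q ℕ.^ L) * ι ⟦ annihilates? J L (vector J t) x ⟧)
      ≈⟨ AΣ.sum-cong-≋ (λ t → complete-sum L (λ l → dot J (vector J t) (shift l x))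
          (annihilates? J L (vector J t) x)) ⟨
    pairSum J L x ∎

  pairSum-comm : ∀ J L x → pairSum J L x ≃ pairSum L J x
  pairSum-comm J L x = A.trans
    (AΣ.∑-comm (λ t u → ψ (dot L (vector L u) (λ l → dot J (vector J t) (shift l x)))))
    (AΣ.sum-cong-≋ λ u → AΣ.sum-cong-≋ λ t → ψ-cong (pairing-comm J L (vector J t) (vector L u) x))

  -- The double sum `pairSum` counts left kernel vectors if `u` is summed first and right kernel
  -- vectors if `t` is. In effect this is the equality of row rank and column rank, obtained without
  -- linear algebra.
  ι-symmetric : ∀ J L x → ι (q ℕ.^ L ℕ.* kernelSize J L x) ≃ ι (q ℕ.^ J ℕ.* kernelSize L J x)
  ι-symmetric J L x = begin
    ι (q ℕ.^ L ℕ.* kernelSize J L x)          ≈⟨ AΣ.ι-* (q ℕ.^ L) (kernelSize J L x) ⟩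
    ι (q ℕ.^ L) * ι (kernelSize J L x)        ≈⟨ kernelSize-pairSum J L x ⟩
    pairSum J L x                             ≈⟨ pairSum-comm J L x ⟩
    pairSum L J x                             ≈⟨ kernelSize-pairSum L J x ⟨
    ι (q ℕ.^ J) * ι (kernelSize L J x)        ≈⟨ AΣ.ι-* (q ℕ.^ J) (kernelSize L J x) ⟨
    ι (q ℕ.^ J ℕ.* kernelSize L J x)          ∎

  module _ {N} (p : Fin N → Fin q → S) (p-normalised : ∀ i → AΣ.sum (p i) ≃ 1#) where

    weight : Fin (q ℕ.^ N) → S
    weight s = AΣ.prod (λ i → p i (finToFun s i))

    transform : Fin N → Carrier → S
    transform i x = AΣ.sum (λ z → p i z * ψ (x *ₖ element z))

    transforms : Series → S
    transforms y = AΣ.prod (λ i → transform i (y (toℕ i)))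

    transform-cong : ∀ i {x y} → x ≈ y → transform i x ≃ transform i y
    transform-cong i x≈y = AΣ.sum-cong-≋ {q} λ z → A.*-congˡ (ψ-cong (K.*-congʳ x≈y))

    transform-0 : ∀ i {x} → x ≈ 0# → transform i x ≃ 1#
    transform-0 i x≈0 = A.trans
      (AΣ.sum-cong-≋ λ z → A.trans (A.*-congˡ (A.trans (ψ-cong (K.trans (K.*-congʳ x≈0) (K.zeroˡ (element z))))
          ψ-0)) (A.*-identityʳ (p i z)))
      (p-normalised i)

    total-weight : AΣ.sum weight ≃ 1#
    total-weight = A.trans (A.sym (AΣ.prod-of-sums N p)) (AΣ.prod-one (λ i → AΣ.sum (p i)) p-normalised)

    expectation-ψ : ∀ y → AΣ.sum (λ s → weight s * ψ (dot N y (vector N s))) ≃ transforms y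
    expectation-ψ y = begin
      AΣ.sum (λ s → weight s * ψ (dot N y (vector N s)))
        ≈⟨ AΣ.sum-cong-≋ (λ s → A.trans
             (A.*-congˡ (A.trans (ψ-dot N y (vector N s))
                 (AΣ.prod-cong-≋ {N} λ i → A.reflexive
                 (cong (λ v → ψ (y (toℕ i) *ₖ v)) (extend-toℕ (sequence k N s) i)))))
             (A.sym (AΣ.prod-distrib-* {N} (λ i → p i (finToFun s i))
                 (λ i → ψ (y (toℕ i) *ₖ element (finToFun s i)))))) ⟩
      AΣ.sum (λ (s : Fin (q ℕ.^ N)) → AΣ.prod (λ i → g i (finToFun s i)))
        ≈⟨ AΣ.prod-of-sums N g ⟨
      transforms y ∎
      where
      g : Fin N → Fin q → S
      g i z = p i z * ψ (y (toℕ i) *ₖ element z)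

    expectation : (Fin (q ℕ.^ N) → ℕ) → S
    expectation f = AΣ.sum (λ s → weight s * ι (f s))

    expectation-kernelSize : ∀ J L → J ℕ.+ L ≡ suc N →
      ι (q ℕ.^ L) * expectation (λ s → kernelSize J L (vector N s))
        ≃ AΣ.sum (λ t → AΣ.sum (λ u → transforms (product J L t u)))
    expectation-kernelSize J L J+L≡1+N = begin
      ι (q ℕ.^ L) * AΣ.sum (λ s → weight s * ι (kernelSize J L (vector N s)))
        ≈⟨ AΣ.*-distribˡ-sum (ι (q ℕ.^ L)) (λ s → weight s * ι (kernelSize J L (vector N s))) ⟩
      AΣ.sum (λ s → ι (q ℕ.^ L) * (weight s * ι (kernelSize J L (vector N s))))
        ≈⟨ AΣ.sum-cong-≋ (λ s → A.trans (x∙yz≈y∙xz _ _ _) (A.*-congˡ (kernelSize-pairSum J L (vector N s)))) ⟩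
      AΣ.sum (λ s → weight s * pairSum J L (vector N s))
        ≈⟨ AΣ.sum-cong-≋ (λ s → A.trans (AΣ.*-distribˡ-sum (weight s) (λ t → AΣ.sum (T s t)))
             (AΣ.sum-cong-≋ λ t → AΣ.*-distribˡ-sum (weight s) (T s t))) ⟩
      AΣ.sum (λ s → AΣ.sum (λ t → AΣ.sum (λ u → weight s * T s t u)))
        ≈⟨ AΣ.∑-comm (λ s t → AΣ.sum (λ u → weight s * T s t u)) ⟩
      AΣ.sum (λ t → AΣ.sum (λ s → AΣ.sum (λ u → weight s * T s t u)))
        ≈⟨ AΣ.sum-cong-≋ (λ t → AΣ.∑-comm (λ s u → weight s * T s t u)) ⟩
      AΣ.sum (λ t → AΣ.sum (λ u → AΣ.sum (λ s → weight s * T s t u)))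
        ≈⟨ AΣ.sum-cong-≋ (λ t → AΣ.sum-cong-≋ λ u → AΣ.sum-cong-≋ λ s → A.*-congˡ (ψ-cong
             (dot-⊛ J L N (vector N s) (ℕ.≤-reflexive J+L≡1+N) (vector-bounded J t) (vector-bounded L u)))) ⟨
      AΣ.sum (λ t → AΣ.sum (λ u → AΣ.sum (λ s → weight s * ψ (dot N (product J L t u) (vector N s)))))
        ≈⟨ AΣ.sum-cong-≋ (λ t → AΣ.sum-cong-≋ λ u → expectation-ψ (product J L t u)) ⟩
      AΣ.sum (λ t → AΣ.sum (λ u → transforms (product J L t u))) ∎
      where
      open SemigroupProperties A.*-commutativeSemigroup using (x∙yz≈y∙xz)
      T : Fin (q ℕ.^ N) → Fin (q ℕ.^ J) → Fin (q ℕ.^ L) → S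
      T s t u = ψ (dot L (vector L u) (λ l → dot J (vector J t) (shift l (vector N s))))

    unless : ∀ {a} {P : Set a} → Dec P → S → S
    unless d v = if does d then 0ₐ else v

    errorTerm : ℕ → ℕ → S
    errorTerm J L = AΣ.sum (λ t → AΣ.sum (λ u → unless (product-vanishes? J L t u) (transforms (product J L t u))))

    expectation-split : ∀ J L → J ℕ.+ L ≡ suc N →
      ι (q ℕ.^ L) * expectation (λ s → kernelSize J L (vector N s)) ≃ ι (zeroPairs J L) + errorTerm J L
    expectation-split J L J+L≡1+N = begin
      ι (q ℕ.^ L) * expectation (λ s → kernelSize J L (vector N s))
        ≈⟨ expectation-kernelSize J L J+L≡1+N ⟩
      AΣ.sum (λ t → AΣ.sum (λ u → transforms (product J L t u)))
        ≈⟨ AΣ.sum-cong-≋ (λ t → AΣ.sum-cong-≋ λ u → split t u (product-vanishes? J L t u)) ⟩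
      AΣ.sum (λ t → AΣ.sum (λ u → ι (Z t u) + E t u))
        ≈⟨ AΣ.sum-cong-≋ (λ t → AΣ.∑-distrib-+ (λ u → ι (Z t u)) (E t)) ⟩
      AΣ.sum (λ t → AΣ.sum (λ u → ι (Z t u)) + AΣ.sum (E t))
        ≈⟨ AΣ.∑-distrib-+ (λ t → AΣ.sum (λ u → ι (Z t u))) (λ t → AΣ.sum (E t)) ⟩
      AΣ.sum (λ t → AΣ.sum (λ u → ι (Z t u))) + errorTerm J L
        ≈⟨ A.+-congʳ (A.trans (AΣ.sum-ι (λ t → ℕΣ.sum (Z t))) (AΣ.sum-cong-≋ λ t → AΣ.sum-ι (Z t))) ⟨
      ι (zeroPairs J L) + errorTerm J L ∎
      where
      Z : Fin (q ℕ.^ J) → Fin (q ℕ.^ L) → ℕ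
      Z t u = ⟦ product-vanishes? J L t u ⟧
      E : Fin (q ℕ.^ J) → Fin (q ℕ.^ L) → S
      E t u = unless (product-vanishes? J L t u) (transforms (product J L t u))
      split : ∀ t u (d : Dec (product J L t u ≋ 𝟘)) →
        transforms (product J L t u) ≃ ι ⟦ d ⟧ + unless d (transforms (product J L t u))
      split t u (yes h) = begin
        transforms (product J L t u)    ≈⟨ AΣ.prod-one _ (λ i → transform-0 i (h (toℕ i))) ⟩
        1#                              ≈⟨ AΣ.ι-1 ⟨
        ι 1                             ≈⟨ A.+-identityʳ (ι 1) ⟨
        ι 1 + 0ₐ                        ∎
      split t u (no _) = A.sym (A.+-identityˡ _)

    module _ (symmetric : Symmetric) (J L : ℕ) (J+L≡N : J ℕ.+ L ≡ N) (J≤L : J ℕ.≤ L)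
             (H? : ∀ s → Dec (Nontrivial (suc J) L (vector N s))) where

      probability : S
      probability = expectation (λ s → ⟦ H? s ⟧)

      private
        E₁ = expectation (λ s → kernelSize J (suc L) (vector N s))
        E₂ = expectation (λ s → kernelSize (suc J) L (vector N s))

      expectation-+ : ∀ f g → expectation (λ s → f s ℕ.+ g s) ≃ expectation f + expectation g
      expectation-+ f g = A.trans
        (AΣ.sum-cong-≋ λ s → A.trans (A.*-congˡ (AΣ.ι-+ (f s) (g s))) (A.distribˡ (weight s) (ι (f s)) (ι (g s))))
        (AΣ.∑-distrib-+ (λ s → weight s * ι (f s)) (λ s → weight s * ι (g s)))

      expectation-* : ∀ n f → expectation (λ s → n ℕ.* f s) ≃ ι n * expectation f
      expectation-* n f = A.trans
        (AΣ.sum-cong-≋ λ s → A.trans (A.*-congˡ (AΣ.ι-* n (f s))) (x∙yz≈y∙xz _ _ _))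
        (A.sym (AΣ.*-distribˡ-sum (ι n) (λ s → weight s * ι (f s))))
        where open SemigroupProperties A.*-commutativeSemigroup using (x∙yz≈y∙xz)

      expectation-const : ∀ n → expectation (λ _ → n) ≃ ι n
      expectation-const n = A.trans (A.sym (AΣ.*-distribʳ-sum (ι n) weight))
        (A.trans (A.*-congʳ total-weight) (A.*-identityˡ (ι n)))

      indicator-expectation : ι q * probability + ι q * E₁ + ι 1 ≃ E₂ + ι q + probability
      indicator-expectation = begin
        ι q * probability + ι q * E₁ + ι 1
          ≈⟨ A.+-cong (A.+-cong (expectation-* q (λ s → ⟦ H? s ⟧))
              (expectation-* q (λ s → kernelSize J (suc L) (vector N s)))) (expectation-const 1) ⟨
        expectation (λ s → q ℕ.* ⟦ H? s ⟧) + expectation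
            (λ s → q ℕ.* kernelSize J (suc L) (vector N s)) + expectation (λ _ → 1)
          ≈⟨ A.+-congʳ (expectation-+ (λ s → q ℕ.* ⟦ H? s ⟧) (λ s → q ℕ.* kernelSize J (suc L) (vector N s))) ⟨
        expectation (λ s → q ℕ.* ⟦ H? s ⟧ ℕ.+ q ℕ.* kernelSize J (suc L) (vector N s)) + expectation (λ _ → 1)
          ≈⟨ expectation-+ (λ s → q ℕ.* ⟦ H? s ⟧ ℕ.+ q ℕ.* kernelSize J (suc L) (vector N s)) (λ _ → 1) ⟨
        expectation (λ s → q ℕ.* ⟦ H? s ⟧ ℕ.+ q ℕ.* kernelSize J (suc L) (vector N s) ℕ.+ 1)
          ≈⟨ AΣ.sum-cong-≋ (λ s → A.*-congˡ (AΣ.ι-cong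
              (kernelSize-indicator symmetric J L (vector N s) J≤L (H? s)))) ⟩
        expectation (λ s → kernelSize (suc J) L (vector N s) ℕ.+ q ℕ.+ ⟦ H? s ⟧)
          ≈⟨ expectation-+ (λ s → kernelSize (suc J) L (vector N s) ℕ.+ q) (λ s → ⟦ H? s ⟧) ⟩
        expectation (λ s → kernelSize (suc J) L (vector N s) ℕ.+ q) + probability
          ≈⟨ A.+-congʳ (expectation-+ (λ s → kernelSize (suc J) L (vector N s)) (λ _ → q)) ⟩
        E₂ + expectation (λ _ → q) + probability
          ≈⟨ A.+-congʳ (A.+-congˡ (expectation-const q)) ⟩
        E₂ + ι q + probability ∎

      -- This is `(q - 1) (q^L P - q^J) = Θ₂ - Θ₁` with all terms moved so that no subtraction
      -- occurs. The averaged indicator identity is multiplied by `q^L` because `q^L` and `q^L q`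
      -- are exactly the factors that `expectation-split` requires.
      main-identity :
        ι (q ℕ.^ suc L) * probability + ι (q ℕ.^ J) + errorTerm J (suc L)
          ≃ ι (q ℕ.^ suc J) + errorTerm (suc J) L + ι (q ℕ.^ L) * probability
      -- `β` completes `q^J`, and `α` completes `q^(J+1)`, to a number of zero pairs plus one.
      main-identity = ∙-cancelʳ (α + β) _ _ (begin
        Q * P + ι (q ℕ.^ J) + Θ₁ + (α + β)
          ≈⟨ solve 5 (λ x y z a b → (x :+ y :+ z) :+ (a :+ b) := (x :+ ((y :+ b) :+ z)) :+ a) A.refl (Q * P)
              (ι (q ℕ.^ J)) Θ₁ α β ⟩
        Q * P + (ι (q ℕ.^ J) + β + Θ₁) + α
          ≈⟨ A.+-congʳ (A.+-congˡ (A.+-congʳ (zeros J (suc L)))) ⟨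
        Q * P + (Z₁ + ι 1 + Θ₁) + α
          ≈⟨ solve 5 (λ x z o t a → (x :+ (z :+ o :+ t)) :+ a := (x :+ (z :+ t) :+ a) :+ o) A.refl (Q * P) Z₁
              (ι 1) Θ₁ α ⟩
        Q * P + (Z₁ + Θ₁) + α + ι 1
          ≈⟨ A.+-congʳ scaled ⟩
        Z₂ + Θ₂ + β + α * P + ι 1
          ≈⟨ solve 5 (λ z t b x o → (z :+ t :+ b :+ x) :+ o := ((z :+ o) :+ t) :+ (b :+ x)) A.refl Z₂ Θ₂ β (α * P)
              (ι 1) ⟩
        Z₂ + ι 1 + Θ₂ + (β + α * P)
          ≈⟨ A.+-congʳ (A.+-congʳ (zeros (suc J) L)) ⟩
        ι (q ℕ.^ suc J) + α + Θ₂ + (β + α * P)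
          ≈⟨ solve 5 (λ y a t b x → ((y :+ a) :+ t) :+ (b :+ x) := (y :+ t :+ x) :+ (a :+ b)) A.refl
              (ι (q ℕ.^ suc J)) α Θ₂ β (α * P) ⟩
        ι (q ℕ.^ suc J) + Θ₂ + α * P + (α + β) ∎)
        where
        open GroupProperties A.+-group using (∙-cancelʳ)
        open import Algebra.Solver.Ring.NaturalCoefficients.Default A.commutativeSemiring using (solve; _:+_; _:*_; _:=_)
        P  = probability
        Q  = ι (q ℕ.^ suc L)
        α  = ι (q ℕ.^ L)
        β  = ι (q ℕ.^ suc L)
        Z₁ = ι (zeroPairs J (suc L))
        Z₂ = ι (zeroPairs (suc J) L)
        Θ₁ = errorTerm J (suc L)
        Θ₂ = errorTerm (suc J) L
        zeros : ∀ J L → ι (zeroPairs J L) + ι 1 ≃ ι (q ℕ.^ J) + ι (q ℕ.^ L)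
        zeros J L = A.trans (A.sym (AΣ.ι-+ (zeroPairs J L) 1))
            (A.trans (AΣ.ι-cong (zeroPairs-count J L)) (AΣ.ι-+ (q ℕ.^ J) (q ℕ.^ L)))
        β≃αq : β ≃ α * ι q
        β≃αq = A.trans (AΣ.ι-* q (q ℕ.^ L)) (A.*-comm (ι q) α)
        scaled : Q * P + (Z₁ + Θ₁) + α ≃ Z₂ + Θ₂ + β + α * P
        scaled = begin
          Q * P + (Z₁ + Θ₁) + α
            ≈⟨ A.+-congʳ (A.+-congˡ (expectation-split J (suc L) (trans (ℕ.+-suc J L) (cong suc J+L≡N)))) ⟨
          β * P + β * E₁ + α
            ≈⟨ A.+-cong (A.+-cong (A.*-congʳ β≃αq) (A.*-congʳ β≃αq))
                (A.sym (A.trans (A.*-congˡ AΣ.ι-1) (A.*-identityʳ α))) ⟩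
          α * ι q * P + α * ι q * E₁ + α * ι 1
            ≈⟨ solve 5 (λ a q P E o → a :* q :* P :+ a :* q :* E :+ a :* o := a :* (q :* P :+ q :* E :+ o)) A.refl
                α (ι q) P E₁ (ι 1) ⟩
          α * (ι q * P + ι q * E₁ + ι 1)
            ≈⟨ A.*-congˡ indicator-expectation ⟩
          α * (E₂ + ι q + P)
            ≈⟨ solve 4 (λ a E q P → a :* (E :+ q :+ P) := a :* E :+ a :* q :+ a :* P) A.refl α E₂ (ι q) P ⟩
          α * E₂ + α * ι q + α * P
            ≈⟨ A.+-congʳ (A.+-cong (expectation-split (suc J) L (cong suc J+L≡N)) (A.sym β≃αq)) ⟩
          Z₂ + Θ₂ + β + α * P ∎

-- Factorisations of a fixed nonzero product.

module Factorisations {c ℓ q} (k : FiniteField c ℓ q) where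
  open FiniteField k using (reflexive) renaming (sym to ≈-sym; trans to ≈-trans)
  open Polynomials k
  open Divisors k
  open Hankel k
  open ProductPairing k
  open Counting using (⟦_⟧; count; count≡0; 1≤count; count≤1; count-all; sum-mono-≤)

  Factorises : ∀ J L N → Fin (q ℕ.^ N) → Fin (q ℕ.^ J) → Fin (q ℕ.^ L) → Set _
  Factorises J L N v t u = ¬ product J L t u ≋ 𝟘 × code N (product J L t u) ≡ v

  factorises? : ∀ J L N v t u → Dec (Factorises J L N v t u)
  factorises? J L N v t u = ¬? (product-vanishes? J L t u) ×-dec (code N (product J L t u) Fin.≟ v)

  factorisations : ∀ J L N → Fin (q ℕ.^ N) → ℕ
  factorisations J L N v = ℕΣ.sum (λ t → count (factorises? J L N v t))

  _≟ₚ_ : ∀ f g → Dec (f P.≈ g)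
  f ≟ₚ g with degree? (size (f P.- g)) (bounded (f P.- g))
  ... | inj₁ f-g≈0         = yes (PG.x∙y⁻¹≈ε⇒x≈y f g (mk≈ f-g≈0))
  ... | inj₂ (_ , _ , deg) = no λ f≈g → degree⇒≉0 deg (at (P.trans (P.+-congʳ f≈g) (P.-‿inverseʳ g)))

  module _ (J L N : ℕ) (J+L≡1+N : J ℕ.+ L ≡ suc N) where

    product-bounded : ∀ t u → Bounded N (product J L t u)
    product-bounded t u = ⊛-size J L N J+L≡1+N (vector-bounded J t) (vector-bounded L u)

    factorises⇒≋ : ∀ {v t u} → Factorises J L N v t u → product J L t u ≋ vector N v
    factorises⇒≋ {v} {t} {u} (_ , eq) n = ≈-trans (≈-sym (vector-code N (product-bounded t u) n))
      (reflexive (cong (λ w → vector N w n) eq))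

    factorises⇒≈ : ∀ {v t u} → Factorises J L N v t u → toPoly J t P.* toPoly L u P.≈ toPoly N v
    factorises⇒≈ {v} {t} {u} F = mk≈ λ n → ≈-trans (coeff-* (toPoly J t) (toPoly L u) n) (factorises⇒≋ F n)

    -- The first factor divides the product and determines the second by cancellation, so there are
    -- no more factorisations than divisors.
    factorisations≤divisors : ∀ v D → Complete (toPoly N v) D → factorisations J L N v ℕ.≤ length D
    factorisations≤divisors v D C = begin
      ℕΣ.sum (λ t → count (factorises? J L N v t))
        ≤⟨ sum-mono-≤ per-divisor ⟩
      ℕΣ.sum (λ t → ℕΣ.sum (λ l → ⟦ toPoly J t ≟ₚ List.lookup D l ⟧))
        ≡⟨ ℕΣ.∑-comm (λ t l → ⟦ toPoly J t ≟ₚ List.lookup D l ⟧) ⟩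
      ℕΣ.sum (λ l → count (λ t → toPoly J t ≟ₚ List.lookup D l))
        ≤⟨ sum-mono-≤ (λ l → count≤1 (λ t → toPoly J t ≟ₚ List.lookup D l)
             λ t t′ h h′ → vector-injective J (at (P.trans h (P.sym h′)))) ⟩
      ℕΣ.sum {length D} (λ _ → 1)
        ≡⟨ count-all (length D) ⟩
      length D ∎
      where
      open ℕ.≤-Reasoning
      per-divisor : ∀ t → count (factorises? J L N v t) ℕ.≤ ℕΣ.sum (λ l → ⟦ toPoly J t ≟ₚ List.lookup D l ⟧)
      per-divisor t with Fin.any? (factorises? J L N v t)
      ... | no none = ℕ.≤-trans (ℕ.≤-reflexive (count≡0 (factorises? J L N v t) λ u F → none (u , F))) ℕ.z≤n
      ... | yes (u₀ , F₀@(tu≉0 , _)) = ℕ.≤-trans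
        (count≤1 (factorises? J L N v t) λ u u′ F F′ → vector-injective L (at
          (⊛-cancelˡ (toPoly J t) (toPoly L u) (toPoly L u′)
            (λ t≈0 → tu≉0 (vanishes-product J L t u₀ (inj₁ (at t≈0))))
            (P.trans (factorises⇒≈ F) (P.sym (factorises⇒≈ F′))))))
        (1≤count (λ l → toPoly J t ≟ₚ List.lookup D l) (Any.index t∈D) (Any.lookup-index t∈D))
        where t∈D = C (toPoly J t) (toPoly L u₀ , factorises⇒≈ F₀)

  factorisations-bound : ∀ R .{{_ : ℕ.NonZero R}} J L n → J ℕ.+ L ≡ suc (suc n) → ∀ v →
    factorisations J L (suc n) v ℕ.* R ℕ.^ n ℕ.≤ (R ℕ.^ (q ℕ.^ R) ℕ.* q) ℕ.* suc R ℕ.^ n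
  factorisations-bound R J L n J+L≡ v with vanishes? (suc n) v
  -- Only nonzero products are counted, so the zero vector has no factorisation.
  ... | yes v≋0 = ℕ.≤-trans (ℕ.≤-reflexive (cong (ℕ._* R ℕ.^ n) (trans
          (ℕΣ.sum-cong-≋ λ t → count≡0 (factorises? J L (suc n) v t) λ u F →
            proj₁ F λ i → ≈-trans (factorises⇒≋ J L (suc n) J+L≡ F i) (v≋0 i))
          (ℕΣ.sum-zero (q ℕ.^ J))))) ℕ.z≤n
  -- The double negation of the divisor bound ends here, at a decidable inequality of natural
  -- numbers.
  ... | no v≉0 = decidable-stable (_ ℕ.≤? _) λ ¬bound →
    DivisorBound.divisor-bound R n (toPoly (suc n) v) (vector-bounded (suc n) v)
        (λ v≈0 → v≉0 (at v≈0)) λ (D , C , bound) →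
      ¬bound (ℕ.≤-trans (ℕ.*-monoˡ-≤ (R ℕ.^ n) (factorisations≤divisors J L (suc n) J+L≡ v D C)) bound)

-- Inequalities for real and complex sums, and the embedding of the naturals.

module RealSums where
  open Real
  open ℚ-Solver using (solve; _:+_; _:*_; :-_; _:-_; _:=_; con)
  open Complex
  module ℝR = CommutativeRing ℝ-commutativeRing
  module ℂR = CommutativeRing ℂ-commutativeRing
  module ℝΣ = FiniteSums ℝR.commutativeSemiring
  module ℂΣ = FiniteSums ℂR.commutativeSemiring

  sum-mono : ∀ {n} {f g : Fin n → ℝ} → (∀ i → f i ≤ℝ g i) → ℝΣ.sum f ≤ℝ ℝΣ.sum g
  sum-mono {zero}  h = ≤-refl
  sum-mono {suc n} h = +-mono-≤ (h Fin.zero) (sum-mono (h ∘ Fin.suc))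

  sum-nonNeg : ∀ {n} {f : Fin n → ℝ} → (∀ i → 0ℝ ≤ℝ f i) → 0ℝ ≤ℝ ℝΣ.sum f
  sum-nonNeg {n} h = ≤-trans (≃⇒≤ (≃-sym (ℝΣ.sum-zero n))) (sum-mono h)

  term≤sum : ∀ {n} {f : Fin n → ℝ} → (∀ i → 0ℝ ≤ℝ f i) → ∀ i → f i ≤ℝ ℝΣ.sum f
  term≤sum h Fin.zero    = ≤-trans (≃⇒≤ (≃-sym (ℝR.+-identityʳ _))) (+-mono-≤ ≤-refl (sum-nonNeg (h ∘ Fin.suc)))
  term≤sum h (Fin.suc i) = ≤-trans (≃⇒≤ (≃-sym (ℝR.+-identityˡ _)))
      (+-mono-≤ (h Fin.zero) (term≤sum (h ∘ Fin.suc) i))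

  0≤1 : 0ℝ ≤ℝ 1ℝ
  0≤1 = mk≤ λ ε 0<ε → always λ n → ℚ.≤-trans (ℚ.nonNegative⁻¹ 1ℚ) (p≤p+e 1ℚ (ℚ.<⇒≤ 0<ε))

  0<1 : 0ℝ <ℝ 1ℝ
  0<1 = mk< 1ℚ (ℚ.positive⁻¹ 1ℚ) 0 λ _ _ → ℚ.≤-refl

  prod-nonNeg : ∀ {n} {f : Fin n → ℝ} → (∀ i → 0ℝ ≤ℝ f i) → 0ℝ ≤ℝ ℝΣ.prod f
  prod-nonNeg {zero}  h = 0≤1
  prod-nonNeg {suc n} h = *-nonNeg (h Fin.zero) (prod-nonNeg (h ∘ Fin.suc))

  prod-pos : ∀ {n} {f : Fin n → ℝ} → (∀ i → 0ℝ <ℝ f i) → 0ℝ <ℝ ℝΣ.prod f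
  prod-pos {zero}  h = 0<1
  prod-pos {suc n} h = *-pos-< (h Fin.zero) (prod-pos (h ∘ Fin.suc))

  ^-pos : ∀ {x} → 0ℝ <ℝ x → ∀ n → 0ℝ <ℝ x ^ℕ n
  ^-pos 0<x zero    = 0<1
  ^-pos 0<x (suc n) = *-pos-< 0<x (^-pos 0<x n)

  ι-nonNeg : ∀ n → 0ℝ ≤ℝ ℝΣ.ι n
  ι-nonNeg zero    = ≤-refl
  ι-nonNeg (suc n) = ≤-trans (≃⇒≤ (≃-sym (ℝR.+-identityʳ 0ℝ))) (+-mono-≤ 0≤1 (ι-nonNeg n))

  ι-mono : ∀ {m n} → m ℕ.≤ n → ℝΣ.ι m ≤ℝ ℝΣ.ι n
  ι-mono {m} {n} m≤n = ≤-trans (≃⇒≤ (≃-sym (ℝR.+-identityʳ (ℝΣ.ι m))))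
    (≤-trans (+-mono-≤ ≤-refl (ι-nonNeg (n ℕ.∸ m)))
      (≃⇒≤ (≃-trans (≃-sym (ℝΣ.ι-+ m (n ℕ.∸ m))) (ℝΣ.ι-cong (ℕ.m+[n∸m]≡n m≤n)))))

  ι-pos : ∀ n .{{_ : ℕ.NonZero n}} → 0ℝ <ℝ ℝΣ.ι n
  ι-pos (suc n) = <-≤-trans 0<1 (≤-trans (≃⇒≤ (≃-sym ℝΣ.ι-1)) (ι-mono {1} {suc n} (ℕ.s≤s ℕ.z≤n)))

  ι-fromℚ : ∀ n → ℝΣ.ι n ≃ℝ fromℚ (+ n ℚ./ 1)
  ι-fromℚ n = pointwise λ j → go n j
    where
    go : ∀ n j → seq (ℝΣ.ι n) j ≡ + n ℚ./ 1
    go zero    j = refl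
    go (suc n) j = trans (cong (1ℚ ℚ.+_) (go n j)) (trans (ℚ.+-comm 1ℚ (+ n ℚ./ 1)) (sym (suc-/ 0 n)))

  -- Characteristic zero: identities between natural numbers that are proved through complex sums
  -- can be read back in `ℕ`.
  ι-injective : ∀ m n → ℝΣ.ι m ≃ℝ ℝΣ.ι n → m ≡ n
  ι-injective m n eq = ℕ.≤-antisym
    (ℕ.≮⇒≥ λ n<m → <⇒≱ (strict n<m) (≃⇒≤ eq))
    (ℕ.≮⇒≥ λ m<n → <⇒≱ (strict m<n) (≃⇒≤ (≃-sym eq)))
    where
    strict : ∀ {m n} → m ℕ.< n → ℝΣ.ι m <ℝ ℝΣ.ι n
    strict {m} {n} m<n = <-≤-trans (+-pos-≤ {ℝΣ.ι m} {1ℝ} 0<1)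
      (≤-trans (≃⇒≤ (ℝR.+-comm (ℝΣ.ι m) 1ℝ)) (ι-mono {suc m} {n} m<n))

  *-cancelˡ-≤ : ∀ {c x y} → 0ℝ <ℝ c → c *ℝ x ≤ℝ c *ℝ y → x ≤ℝ y
  *-cancelˡ-≤ {c} {x} {y} 0<c h = ≮⇒≥ λ y<x → <⇒≱
    (<-≤-trans (+-pos-≤ {c *ℝ y} {c *ℝ (x -ℝ y)} (*-pos-< 0<c (difference-pos y<x)))
      (≃⇒≤ (pointwise {c *ℝ y +ℝ c *ℝ (x -ℝ y)} {c *ℝ x} λ n →
          solve 3 (λ c x y → c :* y :+ c :* (x :- y) := c :* x) refl (seq c n) (seq x n) (seq y n)))) h

  ∣+∣≤ : ∀ x y → ∣ x +ℝ y ∣ℝ ≤ℝ ∣ x ∣ℝ +ℝ ∣ y ∣ℝ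
  ∣+∣≤ x y = mk≤ λ ε 0<ε → always λ n → ℚ.≤-trans (ℚ.∣p+q∣≤∣p∣+∣q∣ (seq x n) (seq y n)) (p≤p+e _ (ℚ.<⇒≤ 0<ε))

  ∣*∣≃ : ∀ {x} y → 0ℝ ≤ℝ x → ∣ x *ℝ y ∣ℝ ≃ℝ x *ℝ ∣ y ∣ℝ
  ∣*∣≃ {x} y 0≤x = ≃-trans (pointwise {∣ x *ℝ y ∣ℝ} {∣ x ∣ℝ *ℝ ∣ y ∣ℝ} λ n → ℚ.∣p*q∣≡∣p∣*∣q∣ (seq x n) (seq y n))
    (*-congʳ ∣ y ∣ℝ (≤-antisym (∣x∣≤y ≤-refl (≤-trans (neg-mono-≤ 0≤x)
        (≤-trans (≃⇒≤ (pointwise { -ℝ 0ℝ} {0ℝ} λ n → refl)) 0≤x))) (x≤∣x∣ x)))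
    where
    x≤∣x∣ : ∀ x → x ≤ℝ ∣ x ∣ℝ
    x≤∣x∣ x = mk≤ λ ε 0<ε → always λ n → ℚ.≤-trans (p≤∣p∣ (seq x n)) (p≤p+e _ (ℚ.<⇒≤ 0<ε))

  ∣∣-nonNeg : ∀ x → 0ℝ ≤ℝ ∣ x ∣ℝ
  ∣∣-nonNeg x = mk≤ λ ε 0<ε → always λ n → ℚ.≤-trans (ℚ.0≤∣p∣ (seq x n)) (p≤p+e _ (ℚ.<⇒≤ 0<ε))

  ∣∣-cong : ∀ {x y} → x ≃ℝ y → ∣ x ∣ℝ ≃ℝ ∣ y ∣ℝ
  ∣∣-cong {x} {y} (mk≃ h) = mk≃ λ ε 0<ε → mapE (λ n → ℚ.≤-trans (∣∣p∣-∣q∣∣≤∣p-q∣ (seq x n) (seq y n))) (h ε 0<ε)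

  ∣-∣≃ : ∀ x → ∣ -ℝ x ∣ℝ ≃ℝ ∣ x ∣ℝ
  ∣-∣≃ x = pointwise λ n → ℚ.∣-p∣≡∣p∣ (seq x n)

  -- Only the real part of an error sum matters, since the other terms of the identity are real.
  -- Passing to it first leaves only the triangle inequality for reals to be applied.
  ∣re-sum∣≤ : ∀ {n} {f : Fin n → ℂ} {h : Fin n → ℝ} → (∀ i → ∣ re (f i) ∣ℝ ≤ℝ h i) → ∣ re (ℂΣ.sum f) ∣ℝ ≤ℝ ℝΣ.sum h
  ∣re-sum∣≤ {zero}  b = ≃⇒≤ (pointwise λ n → refl)
  ∣re-sum∣≤ {suc n} b = ≤-trans (∣+∣≤ _ _) (+-mono-≤ (b Fin.zero) (∣re-sum∣≤ (b ∘ Fin.suc)))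

  normSq-prod : ∀ {n} (f : Fin n → ℂ) → normSq (ℂΣ.prod f) ≃ℝ ℝΣ.prod (normSq ∘ f)
  normSq-prod {zero}  f = pointwise λ n → refl
  normSq-prod {suc n} f = ≃-trans (normSq-* (f Fin.zero) (ℂΣ.prod (f ∘ Fin.suc)))
      (*-cong ≃-refl (normSq-prod (f ∘ Fin.suc)))

  ∣∣ℂ-square : ∀ z → ∣ z ∣ℂ *ℝ ∣ z ∣ℂ ≃ℝ normSq z
  ∣∣ℂ-square z = √-square (normSq-nonNeg z)

  ∣∣ℂ-nonNeg : ∀ z → 0ℝ ≤ℝ ∣ z ∣ℂ
  ∣∣ℂ-nonNeg z = √-nonNeg (normSq z)

  -- The comparison is made between squares because multiplicativity is an algebraic identity for
  -- `normSq`.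
  ∣re-prod∣≤ : ∀ {n} (f : Fin n → ℂ) → ∣ re (ℂΣ.prod f) ∣ℝ ≤ℝ ℝΣ.prod (λ i → ∣ f i ∣ℂ)
  ∣re-prod∣≤ f = re≤∣∣ (ℂΣ.prod f) (prod-nonNeg (λ i → ∣∣ℂ-nonNeg (f i)))
    (≃⇒≤ (≃-trans (normSq-prod f) (≃-trans (≃-sym (ℝΣ.prod-cong-≋ λ i → ∣∣ℂ-square (f i)))
      (ℝΣ.prod-distrib-* (λ i → ∣ f i ∣ℂ) (λ i → ∣ f i ∣ℂ)))))

  ∣∣ℂ-cong : ∀ {z w} → z ≃ℂ w → ∣ z ∣ℂ ≃ℝ ∣ w ∣ℂ
  ∣∣ℂ-cong {z} {w} z≃w = ≤-antisym (half z≃w) (half (ℂR.sym {z} {w} z≃w))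
    where
    half : ∀ {z w} → z ≃ℂ w → ∣ z ∣ℂ ≤ℝ ∣ w ∣ℂ
    half {z} {w} h = x²≤y²⇒x≤y (∣∣ℂ-nonNeg w)
      (≃⇒≤ (≃-trans (∣∣ℂ-square z) (≃-trans (normSq-cong h) (≃-sym (∣∣ℂ-square w)))))

  1≤∣1∣ : ∀ {z} → z ≃ℂ 1ℂ → 1ℝ ≤ℝ ∣ z ∣ℂ
  1≤∣1∣ {z} h = x²≤y²⇒x≤y (∣∣ℂ-nonNeg z) (≃⇒≤ (≃-sym (≃-trans (∣∣ℂ-square z)
    (≃-trans (normSq-cong h) (pointwise λ n → refl)))))

  fromℝ-* : ∀ x y → fromℝ (x *ℝ y) ≃ℂ fromℝ x *ℂ fromℝ y
  fromℝ-* x y = (pointwise λ n → solve 2 (λ x y → x :* y := x :* y :- con 0ℚ :* con 0ℚ) refl (seq x n) (seq y n))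
    , (pointwise λ n → solve 2 (λ x y → con 0ℚ := x :* con 0ℚ :+ con 0ℚ :* y) refl (seq x n) (seq y n))

  fromℝ-cong : ∀ {x y} → x ≃ℝ y → fromℝ x ≃ℂ fromℝ y
  fromℝ-cong h = h , ≃-refl

  fromℝ-sum : ∀ {n} (f : Fin n → ℝ) → fromℝ (ℝΣ.sum f) ≃ℂ ℂΣ.sum (fromℝ ∘ f)
  fromℝ-sum {zero}  f = ≃-refl , ≃-refl
  fromℝ-sum {suc n} f = +-cong ≃-refl (proj₁ (fromℝ-sum (f ∘ Fin.suc)))
    , ≃-trans (≃-sym (ℝR.+-identityˡ 0ℝ)) (+-cong ≃-refl (proj₂ (fromℝ-sum (f ∘ Fin.suc))))

  fromℝ-prod : ∀ {n} (f : Fin n → ℝ) → fromℝ (ℝΣ.prod f) ≃ℂ ℂΣ.prod (fromℝ ∘ f)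
  fromℝ-prod {zero}  f = ≃-refl , ≃-refl
  fromℝ-prod {suc n} f = ℂR.trans {fromℝ (f Fin.zero *ℝ P)} {fromℝ (f Fin.zero) *ℂ fromℝ P}
      {fromℝ (f Fin.zero) *ℂ ℂΣ.prod (fromℝ ∘ f ∘ Fin.suc)}
    (fromℝ-* (f Fin.zero) P) (ℂR.*-congˡ {fromℝ (f Fin.zero)} {fromℝ P} {ℂΣ.prod (fromℝ ∘ f ∘ Fin.suc)}
        (fromℝ-prod (f ∘ Fin.suc)))
    where P = ℝΣ.prod (f ∘ Fin.suc)

  ι-ℂ : ∀ n → ℂΣ.ι n ≃ℂ fromℝ (ℝΣ.ι n)
  ι-ℂ zero    = ≃-refl , ≃-refl
  ι-ℂ (suc n) = +-cong ≃-refl (proj₁ (ι-ℂ n)) , ≃-trans (+-cong ≃-refl (proj₂ (ι-ℂ n))) (ℝR.+-identityˡ 0ℝ)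

  re-ι-* : ∀ n z → re (ℂΣ.ι n *ℂ z) ≃ℝ ℝΣ.ι n *ℝ re z
  re-ι-* n z = ≃-trans
    (+-cong (*-congʳ (re z) (proj₁ (ι-ℂ n))) (neg-cong (*-congʳ (im z) (proj₂ (ι-ℂ n)))))
    (pointwise {y = ℝΣ.ι n *ℝ re z} λ j → solve 3 (λ a b c → a :* b :- con 0ℚ :* c := a :* b) refl
        (seq (ℝΣ.ι n) j) (seq (re z) j) (seq (im z) j))

-- Orthogonality for the given complex character.

module ComplexCharacter {c ℓ q} (k : FiniteField c ℓ q) (ψ₀ : NontrivialCharacter k) where
  open FiniteField k renaming (sym to ≈-sym; trans to ≈-trans) hiding (refl)
  open NontrivialCharacter ψ₀
  open IsMonoidHomomorphism isHomomorphism
  open Complex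
  open RealSums using (module ℂR; module ℂΣ)

  module _ (x : Carrier) (x≉0 : ¬ x ≈ 0#) where

    private
      S : ℂ
      S = ℂΣ.sum (λ z → ψ (element z * x))

    translate : ∀ w → S ℂR.≈ S *ℂ ψ (w * x)
    translate w = begin
      S                                                ≈⟨ ℂΣ.sum-permute (λ z → ψ (element z * x)) π ⟩
      ℂΣ.sum (λ z → ψ (element (shift w z) * x))       ≈⟨ ℂΣ.sum-cong-≋ (λ z → ℂR.trans
                                                            (⟦⟧-cong (≈-trans (*-congʳ (element-index
                                                                (element z + w))) (distribʳ x (element z) w)))
                                                            (homo (element z * x) (w * x))) ⟩
      ℂΣ.sum (λ z → ψ (element z * x) *ℂ ψ (w * x))    ≈⟨ ℂΣ.*-distribʳ-sum (ψ (w * x)) (λ z → ψ (element z * x)) ⟨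
      S *ℂ ψ (w * x)                                   ∎
      where
      open SetoidReasoning ℂR.setoid
      shift : Carrier → Fin q → Fin q
      shift w z = index (element z + w)
      shift-shift : ∀ v w → w + v ≈ 0# → ∀ z → shift v (shift w z) ≡ z
      shift-shift v w w+v≈0 z = trans
        (Inverse.from-cong enumeration (≈-trans (+-congʳ (element-index (element z + w)))
          (≈-trans (+-assoc (element z) w v) (≈-trans (+-congˡ w+v≈0) (+-identityʳ (element z))))))
        (Inverse.strictlyInverseʳ enumeration z)
      π = permutation (shift w) (shift (- w)) (shift-shift w (- w) (-‿inverseˡ w))
          (shift-shift (- w) w (-‿inverseʳ w))

    -- Translation by w multiplies the sum by ψ (w x), so a nonzero sum would
    -- make ψ trivial.
    orthogonality : S ℂR.≈ ℂR.0#
    orthogonality = ≃ℂ-stable λ S≄0 → nontrivial λ y →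
      let w = y * proj₁ (inverse x x≉0)
          wx≈y : w * x ≈ y
          wx≈y = ≈-trans (*-assoc y _ x) (≈-trans (*-congˡ (≈-trans (*-comm _ x) (proj₂ (inverse x x≉0))))
              (*-identityʳ y))
          ψwx-1≃0 = *ℂ-cancelʳ-≃0 {ψ (w * x) ℂR.- 1ℂ} {S} (vanish w) S≄0
      in ℂR.trans {ψ y} {ψ (w * x)} {1ℂ} (⟦⟧-cong (≈-sym wx≈y))
          (GroupProperties.x∙y⁻¹≈ε⇒x≈y ℂR.+-group (ψ (w * x)) 1ℂ ψwx-1≃0)
      where
      vanish : ∀ w → (ψ (w * x) ℂR.- 1ℂ) *ℂ S ℂR.≈ ℂR.0#
      vanish w = begin
        (ψ (w * x) ℂR.- 1ℂ) *ℂ S                     ≈⟨ ℂR.distribʳ S (ψ (w * x)) (ℂR.- 1ℂ) ⟩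
        ψ (w * x) *ℂ S ℂR.+ (ℂR.- 1ℂ) *ℂ S           ≈⟨ ℂR.+-cong
            (ℂR.trans (ℂR.*-comm (ψ (w * x)) S) (ℂR.sym (translate w))) (RingProperties.-1*x≈-x ℂR.ring S) ⟩
        S ℂR.+ ℂR.- S                                ≈⟨ ℂR.-‿inverseʳ S ⟩
        ℂR.0#                                        ∎
        where open SetoidReasoning ℂR.setoid

  character : Character k ℂ-commutativeRing
  character = record
    { ψ          = ψ
    ; ψ-cong     = ⟦⟧-cong
    ; ψ-+        = homo
    ; ψ-0        = ε-homo
    ; orthogonal = orthogonality
    }

-- The error terms bounded by Fourier norms.

module Estimate {c ℓ q} (k : FiniteField c ℓ q) (ψ₀ : NontrivialCharacter k) {N} (μ : Fin N → Distribution k) where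
  open FiniteField k using (Carrier; _≈_; 0#; element; index; element-index; reflexive) renaming (sym to ≈-sym)
  open Polynomials k
  open Hankel k
  open ProductPairing k
  open Factorisations k
  open Divisors k using (extend-toℕ)
  open Real
  open Complex
  open RealSums
  open Counting using (⟦_⟧; ⟦⟧-true)

  p : Fin N → Fin q → ℂ
  p i z = fromℝ (mass (μ i) (element z))

  p-normalised : ∀ i → ℂΣ.sum (p i) ℂR.≈ ℂR.1#
  p-normalised i = ℂR.trans {ℂΣ.sum (p i)} {fromℝ (ℝΣ.sum (λ z → mass (μ i) (element z)))} {ℂR.1#}
    (ℂR.sym {fromℝ (ℝΣ.sum (λ z → mass (μ i) (element z)))} {ℂΣ.sum (p i)}
        (fromℝ-sum (λ z → mass (μ i) (element z))))
    (fromℝ-cong (Distribution.normalised (μ i)))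

  module F = Fourier k ℂ-commutativeRing (ComplexCharacter.character k ψ₀)

  T : Fin N → Carrier → ℂ
  T = F.transform p p-normalised

  norms : ℝ
  norms = ℝΣ.prod (λ i → l1Norm k (fourier k ψ₀ (fromℝ ∘ mass (μ i))))

  -- Each norm is at least its term at frequency `0`, whose value is the total mass `1`. The
  -- strictness of the final inequality rests on this.
  norms-pos : 0ℝ <ℝ norms
  norms-pos = prod-pos λ i → <-≤-trans 0<1 (≤-trans
    (1≤∣1∣ (F.transform-0 p p-normalised i (element-index 0#)))
    (term≤sum {f = λ z → ∣ T i (element z) ∣ℂ} (λ z → ∣∣ℂ-nonNeg (T i (element z))) (index 0#)))

  absolute : Series → ℝ
  absolute y = ℝΣ.prod (λ i → ∣ T i (y (toℕ i)) ∣ℂ)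

  absolute-nonNeg : ∀ y → 0ℝ ≤ℝ absolute y
  absolute-nonNeg y = prod-nonNeg λ i → ∣∣ℂ-nonNeg (T i (y (toℕ i)))

  absolute-cong : ∀ {x y} → x ≋ y → absolute x ≃ℝ absolute y
  absolute-cong h = ℝΣ.prod-cong-≋ λ i → ∣∣ℂ-cong (F.transform-cong p p-normalised i (h (toℕ i)))

  -- The sum over all of `k^N` factors into coordinates, so using every vector once costs exactly
  -- the product of the norms.
  sum-absolute : ℝΣ.sum (λ v → absolute (vector N v)) ≃ℝ norms
  sum-absolute = ≃-trans
    (ℝΣ.sum-cong-≋ λ v → ℝΣ.prod-cong-≋ λ i → ∣∣ℂ-cong
        (F.transform-cong p p-normalised i (reflexive (extend-toℕ (sequence k N v) i))))
    (≃-sym (ℝΣ.prod-of-sums N (λ i z → ∣ T i (element z) ∣ℂ)))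

  unlessℝ : ∀ {a} {P : Set a} → Dec P → ℝ → ℝ
  unlessℝ d r = if does d then 0ℝ else r

  ∣re-unless∣≤ : ∀ {a} {P : Set a} (d : Dec P) {z r} → ∣ re z ∣ℝ ≤ℝ r →
      ∣ re (F.unless p p-normalised d z) ∣ℝ ≤ℝ unlessℝ d r
  ∣re-unless∣≤ (yes _) h = ≃⇒≤ (pointwise λ n → refl)
  ∣re-unless∣≤ (no _)  h = h

  module _ (J L : ℕ) (J+L≡1+N : J ℕ.+ L ≡ suc N) where

    error : ℝ
    error = re (F.errorTerm p p-normalised J L)

    -- The value at a product is rewritten as a sum over all `v`. The sums over `(t , u)` and `v`
    -- can then be exchanged, which collects the pairs by their product.
    spread-out : ∀ t u → unlessℝ (product-vanishes? J L t u) (absolute (product J L t u)) ≤ℝ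
      ℝΣ.sum (λ v → ℝΣ.ι ⟦ factorises? J L N v t u ⟧ *ℝ absolute (vector N v))
    spread-out t u = cases (product-vanishes? J L t u)
      where
      terms : Fin (q ℕ.^ N) → ℝ
      terms v = ℝΣ.ι ⟦ factorises? J L N v t u ⟧ *ℝ absolute (vector N v)
      terms-nonNeg : ∀ v → 0ℝ ≤ℝ terms v
      terms-nonNeg v = *-nonNeg (ι-nonNeg ⟦ factorises? J L N v t u ⟧) (absolute-nonNeg (vector N v))
      v₀ = code N (product J L t u)
      cases : ∀ d → unlessℝ d (absolute (product J L t u)) ≤ℝ ℝΣ.sum terms
      cases (yes _) = sum-nonNeg terms-nonNeg
      cases (no h)  = ≤-trans
        (≃⇒≤ (≃-trans (absolute-cong (λ n → ≈-sym (vector-code N (product-bounded J L N J+L≡1+N t u) n)))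
          (≃-trans (≃-sym (ℝR.*-identityˡ (absolute (vector N v₀))))
            (*-congʳ (absolute (vector N v₀)) (≃-trans (≃-sym ℝΣ.ι-1)
                (ℝΣ.ι-cong (sym (⟦⟧-true (factorises? J L N v₀ t u) (h , refl)))))))))
        (term≤sum terms-nonNeg v₀)

    error≤factorisations : ∣ error ∣ℝ ≤ℝ ℝΣ.sum (λ v → ℝΣ.ι (factorisations J L N v) *ℝ absolute (vector N v))
    error≤factorisations = ≤-trans
      (∣re-sum∣≤ λ t → ∣re-sum∣≤ λ u → ∣re-unless∣≤ (product-vanishes? J L t u)
          (∣re-prod∣≤ (λ i → T i (product J L t u (toℕ i)))))
      (≤-trans (sum-mono λ t → sum-mono λ u → spread-out t u)
      (≃⇒≤ (≃-trans (ℝΣ.sum-cong-≋ λ t → ℝΣ.∑-comm (term t))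
      (≃-trans (ℝΣ.∑-comm (λ t v → ℝΣ.sum (λ u → term t u v)))
      (ℝΣ.sum-cong-≋ λ v → ≃-trans
        (ℝΣ.sum-cong-≋ λ t → ≃-sym (ℝΣ.*-distribʳ-sum (absolute (vector N v))
            (λ u → ℝΣ.ι ⟦ factorises? J L N v t u ⟧)))
        (≃-trans (≃-sym (ℝΣ.*-distribʳ-sum (absolute (vector N v))
            (λ t → ℝΣ.sum (λ u → ℝΣ.ι ⟦ factorises? J L N v t u ⟧))))
          (*-congʳ (absolute (vector N v)) (≃-sym (≃-trans
            (ℝΣ.sum-ι (λ t → Counting.count (factorises? J L N v t)))
            (ℝΣ.sum-cong-≋ λ t → ℝΣ.sum-ι (λ u → ⟦ factorises? J L N v t u ⟧)))))))))))
      where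
      term : Fin (q ℕ.^ J) → Fin (q ℕ.^ L) → Fin (q ℕ.^ N) → ℝ
      term t u v = ℝΣ.ι ⟦ factorises? J L N v t u ⟧ *ℝ absolute (vector N v)

    -- `B / r` plays the role of the divisor bound, kept as two natural numbers so that no division
    -- occurs.
    error-bound : ∀ r B → (∀ v → factorisations J L N v ℕ.* r ℕ.≤ B) → ℝΣ.ι r *ℝ ∣ error ∣ℝ ≤ℝ ℝΣ.ι B *ℝ norms
    error-bound r B h = ≤-trans
      (≤-trans (≃⇒≤ (ℝR.*-comm (ℝΣ.ι r) ∣ error ∣ℝ)) (≤-trans (*-monoʳ-≤ (ℝΣ.ι r) (ι-nonNeg r) error≤factorisations)
        (≃⇒≤ (ℝR.*-comm (ℝΣ.sum (λ v → ℝΣ.ι (factorisations J L N v) *ℝ absolute (vector N v))) (ℝΣ.ι r)))))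
      (≤-trans (≃⇒≤ (ℝΣ.*-distribˡ-sum (ℝΣ.ι r) (λ v → ℝΣ.ι (factorisations J L N v) *ℝ absolute (vector N v))))
      (≤-trans (sum-mono λ v → ≤-trans
        (≃⇒≤ (≃-trans (≃-sym (ℝR.*-assoc (ℝΣ.ι r) (ℝΣ.ι (factorisations J L N v)) (absolute (vector N v))))
          (*-congʳ (absolute (vector N v)) (≃-trans (ℝR.*-comm (ℝΣ.ι r) _)
              (≃-sym (ℝΣ.ι-* (factorisations J L N v) r))))))
        (*-monoʳ-≤ (absolute (vector N v)) (absolute-nonNeg (vector N v)) (ι-mono (h v))))
      (≃⇒≤ (≃-trans (≃-sym (ℝΣ.*-distribˡ-sum (ℝΣ.ι B) (λ v → absolute (vector N v))))
        (*-cong (≃-refl {ℝΣ.ι B}) sum-absolute)))))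

  symmetric : Symmetric
  symmetric J L x = ι-injective _ _ (≃-trans (≃-sym (proj₁ (ι-ℂ (q ℕ.^ L ℕ.* kernelSize J L x))))
    (≃-trans (proj₁ (F.ι-symmetric J L x)) (proj₁ (ι-ℂ (q ℕ.^ J ℕ.* kernelSize L J x)))))

  module _ (m : ℕ) (m≤N : m ℕ.≤ N) (m≤N∸m : m ℕ.≤ N ℕ.∸ m) where

    L : ℕ
    L = N ℕ.∸ m

    nontrivial? : ∀ s → Dec (Nontrivial (suc m) L (vector N s))
    nontrivial? s = map′ (H⇒nontrivial m (sequence k N s)) (nontrivial⇒H m (sequence k N s))
        (H? k m (sequence k N s))

    P : ℂ
    P = F.probability p p-normalised symmetric m L (ℕ.m+[n∸m]≡n m≤N) m≤N∸m nontrivial?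

    probability≃Π : P ℂR.≈ fromℝ (Π k m μ)
    probability≃Π = ℂR.trans {P} {ℂΣ.sum (fromℝ ∘ terms)} {fromℝ (Π k m μ)}
      (ℂΣ.sum-cong-≋ {q ℕ.^ N} {λ s → F.weight p p-normalised s *ℂ ℂΣ.ι ⟦ nontrivial? s ⟧} {fromℝ ∘ terms} λ s →
          summand s)
      (ℂR.sym {fromℝ (ℝΣ.sum terms)} {ℂΣ.sum (fromℝ ∘ terms)} (fromℝ-sum terms))
      where
      masses : Fin (q ℕ.^ N) → ℝ
      masses s = ℝΣ.prod (λ i → mass (μ i) (sequence k N s i))
      terms : Fin (q ℕ.^ N) → ℝ
      terms s = if does (H? k m (sequence k N s)) then masses s else 0ℝ
      w : Fin (q ℕ.^ N) → ℂ
      w = F.weight p p-normalised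
      summand : ∀ s → w s *ℂ ℂΣ.ι ⟦ nontrivial? s ⟧ ℂR.≈ fromℝ (terms s)
      summand s with does (H? k m (sequence k N s))
      ... | true  = ℂR.trans {w s *ℂ ℂΣ.ι 1} {w s} {fromℝ (masses s)}
        (ℂR.trans {w s *ℂ ℂΣ.ι 1} {w s *ℂ ℂR.1#} {w s} (ℂR.*-congˡ {w s} {ℂΣ.ι 1} {ℂR.1#} ℂΣ.ι-1)
            (ℂR.*-identityʳ (w s)))
        (ℂR.sym {fromℝ (masses s)} {w s} (fromℝ-prod (λ i → mass (μ i) (sequence k N s i))))
      ... | false = ℂR.zeroʳ (w s)

    Θ₁ Θ₂ : ℝ
    Θ₁ = error m (suc L) (trans (ℕ.+-suc m L) (cong suc (ℕ.m+[n∸m]≡n m≤N)))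
    Θ₂ = error (suc m) L (cong suc (ℕ.m+[n∸m]≡n m≤N))

    real-identity : ℝΣ.ι (q ℕ.^ suc L) *ℝ Π k m μ +ℝ ℝΣ.ι (q ℕ.^ m) +ℝ Θ₁
      ≃ℝ ℝΣ.ι (q ℕ.^ suc m) +ℝ Θ₂ +ℝ ℝΣ.ι (q ℕ.^ L) *ℝ Π k m μ
    real-identity = ≃-trans
      (+-cong (+-cong (≃-sym (scaled (suc L))) (≃-sym (proj₁ (ι-ℂ (q ℕ.^ m))))) (≃-refl {Θ₁}))
      (≃-trans
        (proj₁ (F.main-identity p p-normalised symmetric m L (ℕ.m+[n∸m]≡n m≤N) m≤N∸m nontrivial?))
        (+-cong (+-cong (proj₁ (ι-ℂ (q ℕ.^ suc m))) (≃-refl {Θ₂})) (scaled L)))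
      where
      scaled : ∀ j → re (ℂΣ.ι (q ℕ.^ j) *ℂ P) ≃ℝ ℝΣ.ι (q ℕ.^ j) *ℝ Π k m μ
      scaled j = ≃-trans (re-ι-* (q ℕ.^ j) P) (*-cong (≃-refl {ℝΣ.ι (q ℕ.^ j)}) (proj₁ probability≃Π))

-- Powers with integer exponents and the choice of `R` from `ε`.

module Powers where
  open ℚ-Solver using (solve; _:+_; _:*_; _:=_; con)
  open Real
  open RealSums

  fromℕ⁺≃ι : ∀ n .{{_ : ℕ.NonZero n}} → value (fromℕ⁺ n) ≃ℝ ℝΣ.ι n
  fromℕ⁺≃ι (suc n) = ≃-sym (ι-fromℚ (suc n))

  -- The rational gap `δ` of `ε` has a computable inverse `i`, which lies below one plus the
  -- absolute value of its numerator. Taking that number as `R` gives `1 + 1 / R ≤ 1 + ε` and keeps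
  -- the constant effective.
  archimedean : ∀ (ε : ℝ⁺) → ∃[ r ] 1ℝ ≤ℝ ℝΣ.ι (suc r) *ℝ value ε
  archimedean (x ,⁺ mk< δ 0<δ M a) =
    let (i , 0<i , i*δ≡1) = 1/-positive 0<δ
        K = + suc ℤ.∣ ↥ i ∣ ℚ./ 1
    in ℤ.∣ ↥ i ∣ , ≤-trans
      (mk≤ λ η 0<η → M , λ n hn → begin
        1ℚ                       ≡⟨ i*δ≡1 ⟨
        i ℚ.* δ                  ≤⟨ *-mono-≤ {i} {K} {δ} {seq x n} (ℚ.<⇒≤ 0<δ) (/-nonNeg 0 (suc ℤ.∣ ↥ i ∣))
                                      (ℚ.<⇒≤ (p<1+∣↥p∣ i)) (subst (ℚ._≤ seq x n) (ℚ.+-identityˡ δ) (a n hn)) ⟩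
        K ℚ.* seq x n            ≤⟨ p≤p+e (K ℚ.* seq x n) (ℚ.<⇒≤ 0<η) ⟩
        K ℚ.* seq x n ℚ.+ η      ∎)
      (≃⇒≤ (Real.*-congʳ x (≃-sym (ι-fromℚ (suc ℤ.∣ ↥ i ∣)))))
    where open ℚ.≤-Reasoning

  ^-nonNeg : ∀ {x} → 0ℝ ≤ℝ x → ∀ n → 0ℝ ≤ℝ x ^ℕ n
  ^-nonNeg 0≤x zero    = 0≤1
  ^-nonNeg 0≤x (suc n) = *-nonNeg 0≤x (^-nonNeg 0≤x n)

  ^-+ : ∀ x m n → x ^ℕ (m ℕ.+ n) ≃ℝ x ^ℕ m *ℝ x ^ℕ n
  ^-+ x zero    n = ≃-sym (ℝR.*-identityˡ (x ^ℕ n))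
  ^-+ x (suc m) n = ≃-trans (*-cong (≃-refl {x}) (^-+ x m n)) (≃-sym (ℝR.*-assoc x (x ^ℕ m) (x ^ℕ n)))

  ^ℤ-neg : ∀ x d → x ^ℤ (ℤ.- + d) ≃ℝ (1/ℝ x) ^ℕ d
  ^ℤ-neg x zero    = ≃-refl
  ^ℤ-neg x (suc d) = ≃-refl

  ≡⇒≃ : ∀ {x y} → x ≡ y → x ≃ℝ y
  ≡⇒≃ refl = ≃-refl

  ^ℤ-minus : ∀ x m n → m ℕ.≤ n → x ^ℤ (+ m ℤ.- + n) ≃ℝ (1/ℝ x) ^ℕ (n ℕ.∸ m)
  ^ℤ-minus x m n m≤n = ≃-trans (≡⇒≃ (cong (x ^ℤ_) (trans (ℤ.[+m]-[+n]≡m⊖n m n) (ℤ.⊖-≤ m≤n)))) (^ℤ-neg x (n ℕ.∸ m))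

  ^ℤ-pos : ∀ x i → 0ℝ <ℝ x ^ℤ i
  ^ℤ-pos x (+ n)    = ^-pos (positive x) n
  ^ℤ-pos x -[1+ n ] = ^-pos (1/-pos x) (suc n)

  power-growth : ∀ R {x} → ℝΣ.ι (suc R) ≤ℝ ℝΣ.ι R *ℝ x → 0ℝ ≤ℝ x → ∀ n →
    ℝΣ.ι (suc R ℕ.^ n) ≤ℝ ℝΣ.ι (R ℕ.^ n) *ℝ x ^ℕ n
  power-growth R {x} h 0≤x zero = ≃⇒≤ (≃-sym (ℝR.*-identityʳ (ℝΣ.ι 1)))
  power-growth R {x} h 0≤x (suc n) = ≤-trans (≃⇒≤ (ℝΣ.ι-* (suc R) (suc R ℕ.^ n)))
    (≤-trans (*-mono-≤ℝ (ι-nonNeg (suc R ℕ.^ n)) (*-nonNeg (ι-nonNeg R) 0≤x) h (power-growth R h 0≤x n))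
    (≃⇒≤ (≃-trans
      (pointwise {ℝΣ.ι R *ℝ x *ℝ (ℝΣ.ι (R ℕ.^ n) *ℝ x ^ℕ n)} {ℝΣ.ι R *ℝ ℝΣ.ι (R ℕ.^ n) *ℝ (x *ℝ x ^ℕ n)}
        λ j → solve 4 (λ a x b y → a :* x :* (b :* y) := a :* b :* (x :* y)) refl (seq (ℝΣ.ι R) j) (seq x j)
            (seq (ℝΣ.ι (R ℕ.^ n)) j) (seq (x ^ℕ n) j))
      (Real.*-congʳ (x *ℝ x ^ℕ n) (≃-sym (ℝΣ.ι-* R (R ℕ.^ n)))))))

  ι-growth : ∀ R (ε : ℝ⁺) → 1ℝ ≤ℝ ℝΣ.ι R *ℝ value ε → ℝΣ.ι (suc R) ≤ℝ ℝΣ.ι R *ℝ value (1⁺ +⁺ ε)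
  ι-growth R ε h = ≤-trans (+-mono-≤ h (≤-refl {ℝΣ.ι R}))
    (≃⇒≤ (pointwise {ℝΣ.ι R *ℝ value ε +ℝ ℝΣ.ι R} {ℝΣ.ι R *ℝ value (1⁺ +⁺ ε)} λ j →
      solve 2 (λ a e → a :* e :+ a := a :* (con 1ℚ :+ e)) refl (seq (ℝΣ.ι R) j) (seq (value ε) j)))

-- The constant and the final inequality.

-- With `R = r + 1`, `R ^ (q ^ R) * q` is the constant of the divisor bound; the factor `2` accounts
-- for the two error terms and the extra `1` for strictness.
constant : ℕ → ℕ → ℝ
constant q r = RealSums.ℝΣ.ι (suc (2 ℕ.* (suc r ℕ.^ (q ℕ.^ suc r) ℕ.* q)))

module Bound {c ℓ q} (k : FiniteField c ℓ q) (ψ₀ : NontrivialCharacter k) .{{_ : ℕ.NonZero q}}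
             (ε : ℝ⁺) (r : ℕ) (r-large : 1ℝ ≤ℝ RealSums.ℝΣ.ι (suc r) *ℝ value ε) where
  open Real
  open RealSums
  open Powers
  open ℚ-Solver using (solve; _:+_; _:*_; :-_; _:-_; _:=_; con)
  open Hankel k using (2≤q)
  open Factorisations k using (factorisations-bound)

  R B : ℕ
  R = suc r
  B = R ℕ.^ (q ℕ.^ R) ℕ.* q

  q⁺ E⁺ : ℝ⁺
  q⁺ = fromℕ⁺ q
  E⁺ = 1⁺ +⁺ ε

  E u : ℝ
  E = value E⁺
  u = 1/ℝ q⁺

  0≤E : 0ℝ ≤ℝ E
  0≤E = <⇒≤ (positive E⁺)

  u*q≃1 : u *ℝ ℝΣ.ι q ≃ℝ 1ℝ
  u*q≃1 = ≃-trans (*-cong (≃-refl {u}) (≃-sym (fromℕ⁺≃ι q))) (1/-inverseˡ q⁺)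

  0≤u : 0ℝ ≤ℝ u
  0≤u = 1/-nonNeg q⁺

  u≤1 : u ≤ℝ 1ℝ
  u≤1 = ≤-trans (≃⇒≤ (≃-sym (ℝR.*-identityʳ u))) (≤-trans
    (*-mono-≤ℝ 0≤1 0≤u (≤-refl {u}) (≤-trans (≃⇒≤ (≃-sym ℝΣ.ι-1)) (ι-mono {1} {q} (ℕ.≤-trans (ℕ.n≤1+n 1) 2≤q))))
    (≃⇒≤ u*q≃1))

  u^*q^≃1 : ∀ n → u ^ℕ n *ℝ ℝΣ.ι (q ℕ.^ n) ≃ℝ 1ℝ
  u^*q^≃1 zero = ≃-trans (ℝR.*-identityˡ (ℝΣ.ι 1)) ℝΣ.ι-1
  u^*q^≃1 (suc n) = ≃-trans (*-cong (≃-refl {u *ℝ u ^ℕ n}) (ℝΣ.ι-* q (q ℕ.^ n))) (≃-trans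
    (pointwise {u *ℝ u ^ℕ n *ℝ (ℝΣ.ι q *ℝ ℝΣ.ι (q ℕ.^ n))} {u *ℝ ℝΣ.ι q *ℝ (u ^ℕ n *ℝ ℝΣ.ι (q ℕ.^ n))}
      λ j → solve 4 (λ a b c d → a :* b :* (c :* d) := a :* c :* (b :* d)) refl (seq u j) (seq (u ^ℕ n) j)
          (seq (ℝΣ.ι q) j) (seq (ℝΣ.ι (q ℕ.^ n)) j))
    (≃-trans (*-cong u*q≃1 (u^*q^≃1 n)) (ℝR.*-identityˡ 1ℝ)))

  module _ {n} (μ : Fin (suc n) → Distribution k) (m : ℕ) (2m≤N : 2 ℕ.* m ℕ.≤ suc n) where
    open Estimate k ψ₀ μ

    private
      N : ℕ
      N = suc n

    m+m≤N : m ℕ.+ m ℕ.≤ N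
    m+m≤N = subst (ℕ._≤ N) (cong (m ℕ.+_) (ℕ.+-identityʳ m)) 2m≤N

    m≤N : m ℕ.≤ N
    m≤N = ℕ.≤-trans (ℕ.m≤m+n m m) m+m≤N

    m≤N∸m : m ℕ.≤ N ℕ.∸ m
    m≤N∸m = ℕ.m+n≤o⇒m≤o∸n m m+m≤N

    -- For `m > 0` one has `m + 1 ≤ 2 m ≤ n + 1`. Hence the exponent `m - n` is nonpositive and
    -- gives a power of `1 / q`.
    m≤n : m ℕ.≤ n
    m≤n = go m m+m≤N
      where
      go : ∀ m → m ℕ.+ m ℕ.≤ suc n → m ℕ.≤ n
      go zero    _ = ℕ.z≤n
      go (suc m) (ℕ.s≤s h) = ℕ.≤-trans (ℕ.≤-reflexive (sym (ℕ.+-comm m 1)))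
          (ℕ.≤-trans (ℕ.+-monoʳ-≤ m (ℕ.s≤s ℕ.z≤n)) h)

    -- The factor `R ^ n`, which cleared the denominators of `(1 + 1 / R) ^ n`, is cancelled here
    -- against the same factor in `power-growth`.
    error≤ : ∀ J L (J+L : J ℕ.+ L ≡ suc N) → ∣ error J L J+L ∣ℝ ≤ℝ ℝΣ.ι B *ℝ (E ^ℕ n *ℝ norms)
    error≤ J L J+L = *-cancelˡ-≤ (ι-pos (R ℕ.^ n) {{ℕ.m^n≢0 R n}}) (≤-trans
      (error-bound J L J+L (R ℕ.^ n) (B ℕ.* suc R ℕ.^ n) (factorisations-bound R J L n J+L))
      (≤-trans (*-monoʳ-≤ norms (<⇒≤ norms-pos) (≤-trans
          (≃⇒≤ (≃-trans (ℝΣ.ι-* B (suc R ℕ.^ n)) (*-comm (ℝΣ.ι B) (ℝΣ.ι (suc R ℕ.^ n)))))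
        (*-monoʳ-≤ (ℝΣ.ι B) (ι-nonNeg B) (power-growth R (ι-growth R ε r-large) 0≤E n))))
      (≃⇒≤ (pointwise {ℝΣ.ι (R ℕ.^ n) *ℝ E ^ℕ n *ℝ ℝΣ.ι B *ℝ norms}
          {ℝΣ.ι (R ℕ.^ n) *ℝ (ℝΣ.ι B *ℝ (E ^ℕ n *ℝ norms))}
        λ j → solve 4 (λ a e b p → a :* e :* b :* p := a :* (b :* (e :* p))) refl (seq (ℝΣ.ι (R ℕ.^ n)) j)
            (seq (E ^ℕ n) j) (seq (ℝΣ.ι B) j) (seq norms j)))))

    -- `K` bounds either error term, `Δ` is the deviation from the main term scaled by `q^(N-m)`,
    -- and `q′` is `q - 1`.
    K Δ q′ : ℝ
    K = ℝΣ.ι B *ℝ (E ^ℕ n *ℝ norms)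
    Δ = ℝΣ.ι (q ℕ.^ (N ℕ.∸ m)) *ℝ Π k m μ -ℝ ℝΣ.ι (q ℕ.^ m)
    q′ = ℝΣ.ι (ℕ.pred q)

    1+q′≃q : ∀ j → ℝΣ.ι (q ℕ.^ suc j) ≃ℝ (1ℝ +ℝ q′) *ℝ ℝΣ.ι (q ℕ.^ j)
    1+q′≃q j = ≃-trans (ℝΣ.ι-* q (q ℕ.^ j)) (Real.*-congʳ (ℝΣ.ι (q ℕ.^ j)) (ℝΣ.ι-cong (sym (ℕ.suc-pred q))))

    Δ-identity : q′ *ℝ Δ ≃ℝ Θ₂ m m≤N m≤N∸m -ℝ Θ₁ m m≤N m≤N∸m
    Δ-identity = ≃-trans
      (pointwise {q′ *ℝ Δ} {lhs -ℝ (x +ℝ y +ℝ θ₁ +ℝ q′ *ℝ y)} λ j →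
        solve 5 (λ a Q p y t → a :* (Q :* p :- y) := ((con 1ℚ :+ a) :* Q) :* p :+ y :+ t :-
            (Q :* p :+ y :+ t :+ a :* y)) refl
          (seq q′ j) (seq Q j) (seq (Π k m μ) j) (seq y j) (seq θ₁ j))
      (≃-trans (+-cong identity (≃-refl { -ℝ (x +ℝ y +ℝ θ₁ +ℝ q′ *ℝ y)}))
        (pointwise {rhs -ℝ (x +ℝ y +ℝ θ₁ +ℝ q′ *ℝ y)} {θ₂ -ℝ θ₁} λ j →
          solve 6 (λ a Q p y t s → (con 1ℚ :+ a) :* y :+ s :+ Q :* p :- (Q :* p :+ y :+ t :+ a :* y) := s :- t) refl
            (seq q′ j) (seq Q j) (seq (Π k m μ) j) (seq y j) (seq θ₁ j) (seq θ₂ j)))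
      where
      Q  = ℝΣ.ι (q ℕ.^ (N ℕ.∸ m))
      x  = Q *ℝ Π k m μ
      y  = ℝΣ.ι (q ℕ.^ m)
      θ₁ = Θ₁ m m≤N m≤N∸m
      θ₂ = Θ₂ m m≤N m≤N∸m
      lhs = ((1ℝ +ℝ q′) *ℝ Q) *ℝ Π k m μ +ℝ y +ℝ θ₁
      rhs = (1ℝ +ℝ q′) *ℝ y +ℝ θ₂ +ℝ x
      identity : lhs ≃ℝ rhs
      identity = ≃-trans
        (+-cong (+-cong (Real.*-congʳ (Π k m μ) (≃-sym (1+q′≃q (N ℕ.∸ m)))) (≃-refl {y})) (≃-refl {θ₁}))
        (≃-trans (real-identity m m≤N m≤N∸m)
          (+-cong (+-cong (1+q′≃q m) (≃-refl {θ₂})) (≃-refl {x})))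

    -- The factor `q - 1 ≥ 1` is dropped rather than divided out, and each of the two error terms
    -- contributes one `K`.
    Δ-bound : ∣ Δ ∣ℝ ≤ℝ K +ℝ K
    Δ-bound = ≤-trans (≃⇒≤ (≃-sym (ℝR.*-identityˡ ∣ Δ ∣ℝ))) (≤-trans
      (*-monoʳ-≤ ∣ Δ ∣ℝ (∣∣-nonNeg Δ) (≤-trans (≃⇒≤ (≃-sym ℝΣ.ι-1)) (ι-mono {1} {ℕ.pred q} (ℕ.pred-mono-≤ 2≤q))))
      (≤-trans (≃⇒≤ (≃-trans (≃-sym (∣*∣≃ Δ (ι-nonNeg (ℕ.pred q)))) (∣∣-cong Δ-identity)))
      (≤-trans (∣+∣≤ (Θ₂ m m≤N m≤N∸m) (-ℝ Θ₁ m m≤N m≤N∸m))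
        (+-mono-≤ (error≤ (suc m) (N ℕ.∸ m) (cong suc (ℕ.m+[n∸m]≡n m≤N)))
          (≤-trans (≃⇒≤ (∣-∣≃ (Θ₁ m m≤N m≤N∸m)))
            (error≤ m (suc (N ℕ.∸ m)) (trans (ℕ.+-suc m (N ℕ.∸ m)) (cong suc (ℕ.m+[n∸m]≡n m≤N)))))))))

    deviation : Π k m μ -ℝ u ^ℕ (N ℕ.∸ m ℕ.∸ m) ≃ℝ u ^ℕ (N ℕ.∸ m) *ℝ Δ
    deviation = ≃-trans
      (+-cong
        (≃-trans (≃-sym (ℝR.*-identityˡ (Π k m μ)))
            (≃-trans (Real.*-congʳ (Π k m μ) (≃-sym (u^*q^≃1 L′))) (ℝR.*-assoc (u ^ℕ L′) Q (Π k m μ))))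
        (neg-cong (≃-trans (≃-sym (ℝR.*-identityʳ U)) (≃-trans (*-cong (≃-refl {U}) (≃-sym (u^*q^≃1 m)))
          (≃-trans (≃-sym (ℝR.*-assoc U (u ^ℕ m) (ℝΣ.ι (q ℕ.^ m))))
            (Real.*-congʳ (ℝΣ.ι (q ℕ.^ m)) (≃-trans (≃-sym (^-+ u (L′ ℕ.∸ m) m))
                (≡⇒≃ (cong (u ^ℕ_) (ℕ.m∸n+n≡m m≤N∸m))))))))))
      (pointwise {u ^ℕ L′ *ℝ (Q *ℝ Π k m μ) -ℝ u ^ℕ L′ *ℝ ℝΣ.ι (q ℕ.^ m)} {u ^ℕ L′ *ℝ Δ} λ j →
        solve 3 (λ u x y → u :* x :- u :* y := u :* (x :- y)) refl (seq (u ^ℕ L′) j) (seq (Q *ℝ Π k m μ) j)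
            (seq (ℝΣ.ι (q ℕ.^ m)) j))
      where
      L′ = N ℕ.∸ m
      Q = ℝΣ.ι (q ℕ.^ L′)
      U = u ^ℕ (L′ ℕ.∸ m)

    X : ℝ
    X = E ^ℕ n *ℝ u ^ℕ (n ℕ.∸ m) *ℝ norms

    0<X : 0ℝ <ℝ X
    0<X = *-pos-< (*-pos-< (^-pos (positive E⁺) n) (^-pos (1/-pos q⁺) (n ℕ.∸ m))) norms-pos

    deviation-bound : ∣ Π k m μ -ℝ u ^ℕ (N ℕ.∸ m ℕ.∸ m) ∣ℝ ≤ℝ ℝΣ.ι (2 ℕ.* B) *ℝ X
    deviation-bound = ≤-trans (≃⇒≤ (≃-trans (∣∣-cong deviation) (∣*∣≃ Δ (^-nonNeg 0≤u (N ℕ.∸ m)))))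
      (≤-trans (*-mono-≤ℝ (∣∣-nonNeg Δ) (^-nonNeg 0≤u (n ℕ.∸ m)) u^L≤ Δ-bound)
      (≃⇒≤ (≃-trans
        (pointwise {V *ℝ (K +ℝ K)} {(ℝΣ.ι B +ℝ ℝΣ.ι B) *ℝ X} λ j →
          solve 4 (λ v b e p → v :* (b :* (e :* p) :+ b :* (e :* p)) := (b :+ b) :* (e :* v :* p)) refl
            (seq V j) (seq (ℝΣ.ι B) j) (seq (E ^ℕ n) j) (seq norms j))
        (Real.*-congʳ X (≃-trans (≃-sym (ℝΣ.ι-+ B B)) (ℝΣ.ι-cong (cong (B ℕ.+_) (sym (ℕ.+-identityʳ B)))))))))
      where
      V = u ^ℕ (n ℕ.∸ m)
      -- The exponent `N - m = n - m + 1` of `1 / q` is relaxed to the `n - m` of the statement.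
      u^L≤ : u ^ℕ (N ℕ.∸ m) ≤ℝ V
      u^L≤ = ≤-trans (≃⇒≤ (≡⇒≃ (cong (u ^ℕ_) (ℕ.+-∸-assoc 1 m≤n))))
        (≤-trans (*-monoʳ-≤ V (^-nonNeg 0≤u (n ℕ.∸ m)) u≤1) (≃⇒≤ (ℝR.*-identityˡ V)))

    bound : ∣ Π k m μ -ℝ q⁺ ^ℤ (+ 2 ℤ.* + m ℤ.- (+ n ℤ.+ + 1)) ∣ℝ
              <ℝ constant q r *ℝ E⁺ ^ℤ (+ n) *ℝ q⁺ ^ℤ (+ m ℤ.- + n) *ℝ norms
    bound = ≤-<-trans
      (≤-trans (≃⇒≤ (∣∣-cong (+-cong (≃-refl {Π k m μ}) (neg-cong exponent)))) deviation-bound)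
      -- The extra `1` in `constant` provides one more `X > 0`, which makes the inequality strict.
      (<-≤-trans (+-pos-≤ {ℝΣ.ι (2 ℕ.* B) *ℝ X} {X} 0<X)
        (≃⇒≤ (≃-trans
          (pointwise {ℝΣ.ι (2 ℕ.* B) *ℝ X +ℝ X} {constant q r *ℝ E ^ℕ n *ℝ V *ℝ norms} λ j →
            solve 4 (λ b e v p → b :* (e :* v :* p) :+ e :* v :* p := (con 1ℚ :+ b) :* e :* v :* p) refl
              (seq (ℝΣ.ι (2 ℕ.* B)) j) (seq (E ^ℕ n) j) (seq V j) (seq norms j))
          (Real.*-congʳ norms (*-cong (≃-refl {constant q r *ℝ E ^ℕ n}) (≃-sym (^ℤ-minus q⁺ m n m≤n)))))))
      where
      V = u ^ℕ (n ℕ.∸ m)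
      exponent : q⁺ ^ℤ (+ 2 ℤ.* + m ℤ.- (+ n ℤ.+ + 1)) ≃ℝ u ^ℕ (N ℕ.∸ m ℕ.∸ m)
      exponent = ≃-trans
        (≡⇒≃ (cong₂ (λ i j → q⁺ ^ℤ (i ℤ.- j)) (sym (ℤ.pos-* 2 m)) (cong +_ (ℕ.+-comm n 1))))
        (≃-trans (^ℤ-minus q⁺ (2 ℕ.* m) N 2m≤N)
          (≡⇒≃ (cong (u ^ℕ_) (trans (cong (N ℕ.∸_) (cong (m ℕ.+_) (ℕ.+-identityʳ m))) (sym (ℕ.∸-+-assoc N m m))))))

  rhs-pos : ∀ {N} (μ : Fin N → Distribution k) i j →
    0ℝ <ℝ constant q r *ℝ (1⁺ +⁺ ε) ^ℤ i *ℝ fromℕ⁺ q ^ℤ j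
            *ℝ ∏ℝ (λ i → l1Norm k (fourier k ψ₀ (fromℝ ∘ mass (μ i))))
  rhs-pos μ i j = *-pos-< (*-pos-< (*-pos-< (ι-pos (suc (2 ℕ.* B))) (^ℤ-pos E⁺ i)) (^ℤ-pos q⁺ j))
      (Estimate.norms-pos k ψ₀ μ)

  -- This is the case `n = -1`. The empty sequence lies in `H_0`, since there are no equations and
  -- `1` is a nonzero coefficient; so `Π` is `1`, which is the main term `q^0`.
  deviation₀ : ∀ (μ : Fin 0 → Distribution k) → ∣ Π k 0 μ -ℝ 1ℝ ∣ℝ ≤ℝ 0ℝ
  deviation₀ μ = ≃⇒≤ (≃-trans (∣∣-cong {Π k 0 μ -ℝ 1ℝ} {0ℝ}
      (≃-trans (+-cong Π≃1 (≃-refl { -ℝ 1ℝ})) (ℝR.-‿inverseʳ 1ℝ))) (pointwise {∣ 0ℝ ∣ℝ} {0ℝ} λ j → refl))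
    where
    open FiniteField k using (1#; 1≉0)
    Π≃1 : Π k 0 μ ≃ℝ 1ℝ
    Π≃1 rewrite dec-true (H? k {0} 0 (sequence k 0 Fin.zero))
        ((λ _ → 1#) , (Fin.zero , 1≉0) , λ ()) = ℝR.+-identityʳ 1ℝ

  BoundHolds : ∀ {N} → ℕ → (Fin N → Distribution k) → ℤ → Set
  BoundHolds m μ i =
    ∣ Π k m μ -ℝ fromℕ⁺ q ^ℤ (+ 2 ℤ.* + m ℤ.- (i ℤ.+ + 1)) ∣ℝ
      <ℝ constant q r *ℝ (1⁺ +⁺ ε) ^ℤ i *ℝ fromℕ⁺ q ^ℤ (+ m ℤ.- i)
           *ℝ ∏ℝ (λ i → l1Norm k (fourier k ψ₀ (fromℝ ∘ mass (μ i))))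

  -- The equations N ≡ _ and i ≡ _ keep N and the exponent i = N - 1 from
  -- being normalised when real numbers are compared.
  bound-suc : ∀ {N n} (μ : Fin N → Distribution k) m → N ≡ suc n → 2 ℕ.* m ℕ.≤ N → ∀ i → i ≡ + n → BoundHolds m μ i
  bound-suc μ m refl 2m≤N i refl = bound μ m 2m≤N

  bound-zero : ∀ {N} (μ : Fin N → Distribution k) m → N ≡ 0 → 2 ℕ.* m ℕ.≤ N → ∀ i → i ≡ -[1+ 0 ] → BoundHolds m μ i
  bound-zero μ zero N≡0 _ i i≡ = ≤-<-trans (vanishing μ N≡0 i i≡) (rhs-pos μ i (+ 0 ℤ.- i))
    where
    vanishing : ∀ {N} (μ : Fin N → Distribution k) → N ≡ 0 → ∀ i → i ≡ -[1+ 0 ] →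
      ∣ Π k 0 μ -ℝ fromℕ⁺ q ^ℤ (+ 2 ℤ.* + 0 ℤ.- (i ℤ.+ + 1)) ∣ℝ ≤ℝ 0ℝ
    vanishing μ refl i refl = deviation₀ μ
  bound-zero μ (suc m) refl ()

  bound-all : ∀ m N → 2 ℕ.* m ℕ.≤ N → (μ : Fin N → Distribution k) → BoundHolds m μ (+ N ℤ.- + 1)
  bound-all m N 2m≤N μ = split N refl
    where
    split : ∀ M → N ≡ M → BoundHolds m μ (+ N ℤ.- + 1)
    split zero    N≡M = bound-zero μ m N≡M 2m≤N (+ N ℤ.- + 1) (cong (λ N → + N ℤ.- + 1) N≡M)
    split (suc n) N≡M = bound-suc μ m N≡M 2m≤N (+ N ℤ.- + 1) (cong (λ N → + N ℤ.- + 1) N≡M)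

open import Data.Nat.Base using (ℕ; _≤_) renaming (_*_ to _*ℕ_)
open import Data.Integer.Base using (+_; _-_; _*_; _+_)

theorem2 : ∀ {c ℓ} (q : ℕ) (q-primePower : IsPrimePower q) (ε : ℝ⁺) →
    let q⁺ = fromℕ⁺ q {{isPrimePower⇒nonZero q-primePower}} in
    ∃[ C ] ((k : FiniteField c ℓ q) (ψ₀ : NontrivialCharacter k)
    (m N : ℕ) → 2 *ℕ m ≤ N → (μ : Fin N → Distribution k) →
    let n = + N - + 1 in
    ∣ Π k m μ -ℝ q⁺ ^ℤ (+ 2 * + m - (n + + 1)) ∣ℝ
    <ℝ C *ℝ (1⁺ +⁺ ε) ^ℤ n *ℝ q⁺ ^ℤ (+ m - n)
    *ℝ ∏ℝ (λ i → l1Norm k (fourier k ψ₀ (fromℝ ∘ mass (μ i)))))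
theorem2 q q-primePower ε = constant q (proj₁ (Powers.archimedean ε)) , λ k ψ₀ →
  Bound.bound-all k ψ₀ {{isPrimePower⇒nonZero q-primePower}} ε
    (proj₁ (Powers.archimedean ε)) (proj₂ (Powers.archimedean ε))
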